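{- Let $T$ be a tree of order $n\ge 3$, with distance matrix $\mathcal{D}(T)$. Then: (i) The coefficient sequence (of coefficients of $x^0,x^1,\dots,x^n$) of the distance characteristic polynomial $p_{\mathcal{D}(T)}(x)=\det(xI-\mathcal{D}(T))$ is log-concave. (ii) The sequence $|\delta_0(T)|,\dots,|\delta_{n-2}(T)|$ of absolute values of coefficients of the distance characteristic polynomial is log-concave and unimodal. (iii) The sequence $d_0(T),\dots,d_{n-2}(T)$ of normalized coefficients of the distance characteristic polynomial is log-concave and unimodal.
   Context: A tree is a finite simple undirected connected graph without cycles; its order $n$ is its number of vertices. The distance matrix $\mathcal{D}(G)$ of a connected graph $G$ is indexed by the vertices of $G$, with $(i,j)$-entry equal to the length of a shortest path between $v_i$ and $v_j$. For a graph $G$ on $n$ vertices, $\delta_k(G)$ denotes the coefficient of $x^k$ in $\det(\mathcal{D}(G)-xI)$, so the coefficient of $x^k$ in $p_{\mathcal{D}(G)}(x)=\det(xI-\mathcal{D}(G))$ is $(-1)^n\delta_k(G)$. For $0\le k\le n-2$ the normalized coefficients are $d_k(G)=\frac{1}{2^{n-2}}2^k|\delta_k(G)|$. A sequence $a_0,a_1,\dots,a_m$ of real numbers is unimodal if there is a $k$ such that $a_{i-1}\le a_i$ for $i\le k$ and $a_i\ge a_{i+1}$ for $i\ge k$ (for all indices for which these make sense); it is log-concave if $a_j^2\ge a_{j-1}a_{j+1}$ for all $j=1,\dots,m-1$. -}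

module Defs where

open import Algebra.Bundles.Raw using (RawRing)
import Algebra.Definitions.RawMonoid as RawMonoidDefs
open import Data.Fin.Base using (Fin; zero; suc; toℕ; punchIn)
open import Data.Fin.Properties using (any?; _≟_)
open import Data.Integer.Base as ℤ using (ℤ; +_; ∣_∣)
open import Data.List.Base as List using (List; []; _∷_)
open import Data.Nat.Base as ℕ using (ℕ; zero; suc; _∸_; _^_; z≤n; s≤s)
open import Data.Nat.Properties using (m^n≢0)
open import Data.Product.Base using (∃; ∃-syntax; _×_; _,_)
open import Data.Rational.Base as ℚ using (ℚ)
open import Data.Vec.Base as Vec using (Vec; []; _∷_)
open import Data.Vec.Relation.Unary.Linked using (Linked; linked?)
open import Data.Vec.Relation.Unary.Unique.Propositional using (Unique)
open import Data.Vec.Relation.Unary.AllPairs using (allPairs?)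
open import Level using (0ℓ)
open import Relation.Binary.Core using (Rel)
import Relation.Binary.Definitions as B
open import Relation.Binary.PropositionalEquality.Core using (_≡_)
open import Relation.Nullary using (Dec; yes; no; ¬_)
open import Relation.Nullary.Decidable using (map′; _×-dec_; ¬?)
open import Relation.Nullary.Negation using (contradiction)
import Relation.Unary as U

-- Decidability of adjacency is automatic classically; it is recorded so that
-- distances are computable.
record Graph (n : ℕ) : Set₁ where
  field
    Adj    : Rel (Fin n) 0ℓ
    adj?   : B.Decidable Adj
    sym    : B.Symmetric Adj
    irrefl : ∀ {u} → ¬ Adj u u

module _ {n : ℕ} (G : Graph n) where
  open Graph G

  -- A path of length ℓ is listed by its ℓ + 1 pairwise distinct vertices.
  IsPath : (u v : Fin n) {ℓ : ℕ} → Vec (Fin n) (suc ℓ) → Set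
  IsPath u v vs = Vec.head vs ≡ u × Vec.last vs ≡ v × Linked Adj vs × Unique vs

  HasPath : (u v : Fin n) → ℕ → Set
  HasPath u v ℓ = ∃[ vs ] IsPath u v {ℓ} vs

  Connected : Set
  Connected = ∀ u v → ∃[ ℓ ] HasPath u v ℓ

  -- A cycle on 3 + k vertices: a path whose last vertex is adjacent to its first.
  IsCycle : {k : ℕ} → Vec (Fin n) (3 ℕ.+ k) → Set
  IsCycle vs = Linked Adj vs × Unique vs × Adj (Vec.last vs) (Vec.head vs)

  Acyclic : Set
  Acyclic = ∀ {k} (vs : Vec (Fin n) (3 ℕ.+ k)) → ¬ IsCycle vs

record IsTree {n : ℕ} (G : Graph n) : Set where
  field
    connected : Connected G
    acyclic   : Acyclic G

anyVec? : ∀ {n k} {P : Vec (Fin n) k → Set} → U.Decidable P → Dec (∃ P)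
anyVec? {k = zero}  P? = map′ ([] ,_) (λ { ([] , p) → p }) (P? [])
anyVec? {k = suc k} P? =
  map′ (λ { (x , xs , p) → x ∷ xs , p }) (λ { (x ∷ xs , p) → x , xs , p })
       (any? λ x → anyVec? λ xs → P? (x ∷ xs))

least : {P : ℕ → Set} → U.Decidable P → ∀ w → P w →
        ∃[ m ] (P m × (∀ k → P k → m ℕ.≤ k))
least P? zero    p = zero , p , λ _ _ → z≤n
least P? (suc w) p with P? zero
... | yes p₀ = zero , p₀ , λ _ _ → z≤n
... | no ¬p₀ with least (λ k → P? (suc k)) w p
...   | m , pm , min = suc m , pm , λ where
          zero    p₀ → contradiction p₀ ¬p₀
          (suc k) pk → s≤s (min k pk)

module _ {n : ℕ} (G : Graph n) where
  open Graph G

  hasPath? : ∀ u v ℓ → Dec (HasPath G u v ℓ)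
  hasPath? u v ℓ = anyVec? λ vs →
    (Vec.head vs ≟ u) ×-dec (Vec.last vs ≟ v) ×-dec
    linked? adj? vs ×-dec allPairs? (λ x y → ¬? (x ≟ y)) vs

  module _ (conn : Connected G) where

    shortestPath : ∀ u v →
      ∃[ d ] (HasPath G u v d × (∀ ℓ → HasPath G u v ℓ → d ℕ.≤ ℓ))
    shortestPath u v = let ℓ , p = conn u v in least (hasPath? u v) ℓ p

    distance : Fin n → Fin n → ℕ
    distance u v = let d , _ = shortestPath u v in d

Matrix : Set → ℕ → Set
Matrix A n = Fin n → Fin n → A

module Determinant (R : RawRing 0ℓ 0ℓ) where
  open RawRing R
  open RawMonoidDefs +-rawMonoid using (sum)

  alternate : ℕ → Carrier → Carrier
  alternate zero    x = x
  alternate (suc k) x = - alternate k x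

  -- Laplace expansion along the first row.
  det : ∀ {n} → Matrix Carrier n → Carrier
  det {zero}  M = 1#
  det {suc n} M = sum λ j →
    alternate (toℕ j) (M zero j * det λ i k → M (suc i) (punchIn j k))

-- Polynomials over ℤ, as lists of coefficients starting with the constant
-- term. Trailing zeros are allowed, so equality is coefficientwise.
Poly : Set
Poly = List ℤ

coeff : Poly → ℕ → ℤ
coeff []      _       = + 0
coeff (a ∷ p) zero    = a
coeff (a ∷ p) (suc k) = coeff p k

infixl 6 _+ₚ_ _-ₚ_ _-ₘ_
infixl 7 _*ₚ_
infix  8 -ₚ_

_+ₚ_ : Poly → Poly → Poly
[]      +ₚ q       = q
(a ∷ p) +ₚ []      = a ∷ p
(a ∷ p) +ₚ (b ∷ q) = a ℤ.+ b ∷ p +ₚ q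

_*ₚ_ : Poly → Poly → Poly
[]      *ₚ q = []
(a ∷ p) *ₚ q = List.map (a ℤ.*_) q +ₚ (+ 0 ∷ p *ₚ q)

-ₚ_ : Poly → Poly
-ₚ_ = List.map (λ a → ℤ.- a)

_-ₚ_ : Poly → Poly → Poly
p -ₚ q = p +ₚ (-ₚ q)

const : ℤ → Poly
const a = a ∷ []

X : Poly
X = + 0 ∷ + 1 ∷ []

polyRawRing : RawRing 0ℓ 0ℓ
polyRawRing = record
  { Carrier = Poly
  ; _≈_     = λ p q → ∀ k → coeff p k ≡ coeff q k
  ; _+_     = _+ₚ_
  ; _*_     = _*ₚ_
  ; -_      = -ₚ_
  ; 0#      = []
  ; 1#      = const (+ 1)
  }

open Determinant polyRawRing public using () renaming (det to detₚ)

constMatrix : ∀ {n} → Matrix ℤ n → Matrix Poly n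
constMatrix M i j = const (M i j)

xI : ∀ {n} → Matrix Poly n
xI i j with i ≟ j
... | yes _ = X
... | no  _ = []

_-ₘ_ : ∀ {n} → Matrix Poly n → Matrix Poly n → Matrix Poly n
(M -ₘ N) i j = M i j -ₚ N i j

module _ {n : ℕ} (G : Graph n) (conn : Connected G) where

  distanceMatrix : Matrix ℤ n
  distanceMatrix i j = + distance G conn i j

  distanceCharPoly : Poly
  distanceCharPoly = detₚ (xI -ₘ constMatrix distanceMatrix)

  charCoeff : ℕ → ℚ
  charCoeff k = coeff distanceCharPoly k ℚ./ 1

  δ : ℕ → ℤ
  δ = coeff (detₚ (constMatrix distanceMatrix -ₘ xI))

  absδ : ℕ → ℚ
  absδ k = + ∣ δ k ∣ ℚ./ 1

  normalizedCoeff : ℕ → ℚ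
  normalizedCoeff k =
    (+ 1 ℚ./ (2 ^ (n ∸ 2))) {{m^n≢0 2 (n ∸ 2)}} ℚ.* (+ (2 ^ k) ℚ./ 1) ℚ.* absδ k

-- Finite sequences a 0 , … , a m; values beyond index m are ignored. All the
-- sequences considered here are rational.
LogConcave : (m : ℕ) → (ℕ → ℚ) → Set
LogConcave m a = ∀ j → 1 ℕ.≤ j → j ℕ.≤ m ∸ 1 →
  a (j ∸ 1) ℚ.* a (j ℕ.+ 1) ℚ.≤ a j ℚ.* a j

Unimodal : (m : ℕ) → (ℕ → ℚ) → Set
Unimodal m a = ∃[ k ] (k ℕ.≤ m
  × (∀ i → 1 ℕ.≤ i → i ℕ.≤ k → a (i ∸ 1) ℚ.≤ a i)
  × (∀ i → k ℕ.≤ i → i ℕ.< m → a (i ℕ.+ 1) ℚ.≤ a i))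

{-# OPTIONS --safe #-}
module Submission where

-- Let D be the distance matrix, A = − D, P(x) = det (x + A),
-- and Φ(u, x, y) = det (u + (x + A)(y + A)).
-- Since (x + A)(y + A) + u depends only on x + y and xy + u, the derivation
-- ∂x − ∂y + (x − y)∂u kills Φ. For the coefficients Φ s l k of u^s y^l x^k and
-- L s k = Φ s k k − Φ s (k + 1) (k − 1) this says
--   (k + 2) L s (k + 1) = Φ s (k + 1) (k + 1) + (s + 1) L (s + 1) k.
-- As A is symmetric, the Cauchy–Binet formula writes n! Φ s k k as a sum of
-- squares with nonnegative weights, so L ≥ 0 by induction on k. As
-- Φ 0 l k = p_l p_k, the case s = 0 is log-concavity of the coefficients of P;
-- no real roots are needed.
--
-- Moving the coefficient of a deepest vertex of the support to its parent
-- shows that A is positive on nonzero vectors of coordinate sum 0. Its diagonal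
-- is 0, so elimination by congruence gives det < 0 for every principal submatrix
-- of order at least 2, and by P′ = Σ det (x + A without i) the coefficients of
-- P up to degree n − 2 are negative. Positive log-concave sequences are unimodal.

-- The variable u does two jobs. The derivation ∂x - ∂y sends xy to y - x, so (x + A)(y + A) alone
-- is not annihilated; u, growing at rate x - y, compensates. And for symmetric A, (x + A)(y + A) +
-- u is the Gram matrix of the rows of the block [X + A | 1], read once in x and once in y, with
-- column weights 1 and u. Each maximal minor m(X) of the block contributes a power of u times m(x)
-- m(y), so a coefficient with equal exponents of x and y is a square. The price is that the
-- recursion trades a step down in k for a step up in s, so nonnegativity is proved for all s at
-- once although the goal is s = 0. The ground ring is ℤ, without division: Cauchy-Binet sums over
-- all index families instead of subsets and acquires the factor n!, elimination multiplies rows by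
-- the pivot, and positive factors are cancelled from inequalities. Polynomials in x, y, u are
-- treated as iterated power series, whose coefficients are total functions.

module DeterminantTheory where

  open import Defs
  open import Algebra.Bundles using (CommutativeRing)
  import Algebra.Properties.CommutativeMonoid.Mult as CommutativeMonoidMult
  import Algebra.Properties.CommutativeMonoid.Sum as CommutativeMonoidSum
  import Algebra.Properties.CommutativeSemigroup as CommutativeSemigroupProperties
  import Algebra.Properties.Ring as RingProperties
  import Algebra.Properties.Semiring.Sum as SemiringSum
  open import Data.Fin.Base using (Fin; zero; suc; toℕ; punchIn; punchOut; _↑ˡ_; _↑ʳ_)
  open import Data.Fin.Properties using
      (_≟_; punchInᵢ≢i; punchIn-injective; punchIn-punchOut; suc-injective)
  open import Data.Nat.Base as ℕ using (ℕ; zero; suc; _!)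
  open import Data.Vec.Functional using (Vector; []; _∷_; removeAt; insertAt)
  open import Data.Vec.Functional.Properties using (insertAt-removeAt)
  open import Function.Base using (_∘_; flip; id)
  open import Level using (0ℓ)
  import Relation.Binary.Reasoning.Setoid as SetoidReasoning
  open import Relation.Binary.PropositionalEquality.Core as ≡ using (_≡_; _≢_; _≗_)
  open import Relation.Nullary using (yes; no)
  open import Relation.Nullary.Negation using (contradiction)

  toFront : ∀ {X : Set} {n} → Fin n → Vector X n → Vector X n
  toFront {n = suc n} j J = J j ∷ removeAt J j

  ∷-cong : ∀ {X : Set} {n} (a : X) {J K : Vector X n} → J ≗ K → (a ∷ J) ≗ (a ∷ K)
  ∷-cong a J≗K zero    = ≡.refl
  ∷-cong a J≗K (suc i) = J≗K i

  insertAt-∘ : ∀ {X Y : Set} (f : X → Y) {n} (xs : Vector X n) j v i →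
               f (insertAt xs j v i) ≡ insertAt (f ∘ xs) j (f v) i
  insertAt-∘ f xs zero    v zero    = ≡.refl
  insertAt-∘ f xs zero    v (suc i) = ≡.refl
  insertAt-∘ f {suc n} xs (suc j) v zero    = ≡.refl
  insertAt-∘ f {suc n} xs (suc j) v (suc i) = insertAt-∘ f (xs ∘ suc) j v i

  -- Determinants over a commutative ring.

  module Determinants (R : CommutativeRing 0ℓ 0ℓ) where
    open CommutativeRing R hiding (zero)
    open Determinant rawRing public
    open RingProperties ring
    open SemiringSum semiring using (sum; sum-cong-≋; sum-remove; sum-replicate; sum-replicate-zero;
      *-distribˡ-sum; *-distribʳ-sum) renaming (∑-comm to sum-comm; ∑-distrib-+ to sum-distrib-+)
    open CommutativeMonoidMult +-commutativeMonoid using (_×_; ×-congʳ; ×-assocˡ)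
    open CommutativeSemigroupProperties *-commutativeSemigroup using (x∙yz≈y∙xz)
    open CommutativeMonoidSum *-commutativeMonoid using () renaming
      (sum to product; sum-cong-≋ to product-cong; sum-remove to product-remove;
       ∑-distrib-+ to product-distrib)
    open SetoidReasoning setoid

    -- Opaque copies keep the unifier from unfolding the defining recursions.
    opaque
      ∑ : ∀ {n} → Vector Carrier n → Carrier
      ∑ = sum

      sgn : ℕ → Carrier → Carrier
      sgn = alternate

      Det : ∀ {n} → Matrix Carrier n → Carrier
      Det = det

    minor : ∀ {m n} → Fin (suc m) → Fin (suc n) → (Fin (suc m) → Fin (suc n) → Carrier) →
            Fin m → Fin n → Carrier
    minor i j M k l = M (punchIn i k) (punchIn j l)

    opaque
      unfolding ∑ sgn Det

      Det≡det : ∀ {n} (M : Matrix Carrier n) → Det M ≡ det M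
      Det≡det M = ≡.refl

      Det-zero : (M : Matrix Carrier 0) → Det M ≈ 1#
      Det-zero M = refl

      Det-suc : ∀ {n} (M : Matrix Carrier (suc n)) →
                Det M ≈ ∑ (λ j → sgn (toℕ j) (M zero j * Det (minor zero j M)))
      Det-suc M = refl

      sgn-zero : ∀ x → sgn 0 x ≈ x
      sgn-zero x = refl

      sgn-suc : ∀ k x → sgn (suc k) x ≈ - sgn k x
      sgn-suc k x = refl

      ∑-zero : (f : Vector Carrier 0) → ∑ f ≈ 0#
      ∑-zero f = refl

      ∑-suc : ∀ {n} (f : Vector Carrier (suc n)) → ∑ f ≈ f zero + ∑ (f ∘ suc)
      ∑-suc f = refl

      ∑-cong : ∀ {n} {f g : Vector Carrier n} → (∀ i → f i ≈ g i) → ∑ f ≈ ∑ g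
      ∑-cong = sum-cong-≋

      ∑-remove : ∀ {n} i (f : Vector Carrier (suc n)) → ∑ f ≈ f i + ∑ (f ∘ punchIn i)
      ∑-remove i f = sum-remove f

      ∑-replicate : ∀ n x → ∑ {n} (λ _ → x) ≈ n × x
      ∑-replicate n x = sum-replicate n

      ∑-replicate-0 : ∀ n → ∑ {n} (λ _ → 0#) ≈ 0#
      ∑-replicate-0 = sum-replicate-zero

      ∑-comm : ∀ {m n} (f : Fin m → Fin n → Carrier) →
               ∑ (λ i → ∑ λ j → f i j) ≈ ∑ (λ j → ∑ λ i → f i j)
      ∑-comm = sum-comm

      ∑-+ : ∀ {n} (f g : Vector Carrier n) → ∑ (λ i → f i + g i) ≈ ∑ f + ∑ g
      ∑-+ = sum-distrib-+

      *-∑ : ∀ {n} x (f : Vector Carrier n) → x * ∑ f ≈ ∑ (λ i → x * f i)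
      *-∑ = *-distribˡ-sum

      ∑-* : ∀ {n} (f : Vector Carrier n) x → ∑ f * x ≈ ∑ (λ i → f i * x)
      ∑-* f x = *-distribʳ-sum x f

    ∑-0 : ∀ {n} {f : Vector Carrier n} → (∀ i → f i ≈ 0#) → ∑ f ≈ 0#
    ∑-0 {n} f≈0 = trans (∑-cong f≈0) (∑-replicate-0 n)

    ∑-neg : ∀ {n} (f : Vector Carrier n) → ∑ (λ i → - f i) ≈ - ∑ f
    ∑-neg f = begin
      ∑ (λ i → - f i)        ≈⟨ ∑-cong (λ i → sym (-1*x≈-x (f i))) ⟩
      ∑ (λ i → - 1# * f i)   ≈⟨ *-∑ (- 1#) f ⟨
      - 1# * ∑ f             ≈⟨ -1*x≈-x (∑ f) ⟩
      - ∑ f                  ∎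

    sgn≈ : ∀ k x → sgn k x ≈ sgn k 1# * x
    sgn≈ zero    x = trans (sgn-zero x) (sym (trans (*-congʳ (sgn-zero 1#)) (*-identityˡ x)))
    sgn≈ (suc k) x = begin
      sgn (suc k) x        ≈⟨ sgn-suc k x ⟩
      - sgn k x            ≈⟨ -‿cong (sgn≈ k x) ⟩
      - (sgn k 1# * x)     ≈⟨ -‿distribˡ-* _ _ ⟩
      - sgn k 1# * x       ≈⟨ *-congʳ (sgn-suc k 1#) ⟨
      sgn (suc k) 1# * x   ∎

    sgn-cong : ∀ k {x y} → x ≈ y → sgn k x ≈ sgn k y
    sgn-cong k {x} {y} x≈y = trans (sgn≈ k x) (trans (*-congˡ x≈y) (sym (sgn≈ k y)))

    sgn-*ʳ : ∀ k x y → x * sgn k y ≈ sgn k (x * y)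
    sgn-*ʳ k x y = begin
      x * sgn k y          ≈⟨ *-congˡ (sgn≈ k y) ⟩
      x * (sgn k 1# * y)   ≈⟨ x∙yz≈y∙xz _ _ _ ⟩
      sgn k 1# * (x * y)   ≈⟨ sgn≈ k (x * y) ⟨
      sgn k (x * y)        ∎

    sgn-*ˡ : ∀ k x y → sgn k x * y ≈ sgn k (x * y)
    sgn-*ˡ k x y = trans (*-congʳ (sgn≈ k x)) (trans (*-assoc _ _ _) (sym (sgn≈ k (x * y))))

    sgn-comm : ∀ j k x → sgn j (sgn k x) ≈ sgn k (sgn j x)
    sgn-comm j k x = begin
      sgn j (sgn k x)        ≈⟨ sgn≈ j _ ⟩
      sgn j 1# * sgn k x     ≈⟨ sgn-*ʳ k _ x ⟩
      sgn k (sgn j 1# * x)   ≈⟨ sgn-cong k (sgn≈ j x) ⟨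
      sgn k (sgn j x)        ∎

    sgn-neg : ∀ k x → sgn k (- x) ≈ - sgn k x
    sgn-neg k x = trans (sgn≈ k (- x)) (trans (sym (-‿distribʳ-* _ x)) (-‿cong (sym (sgn≈ k x))))

    sgn-+ : ∀ k x y → sgn k (x + y) ≈ sgn k x + sgn k y
    sgn-+ k x y = trans (sgn≈ k _) (trans (distribˡ _ _ _) (sym (+-cong (sgn≈ k x) (sgn≈ k y))))

    sgn-0 : ∀ k → sgn k 0# ≈ 0#
    sgn-0 k = trans (sgn≈ k 0#) (zeroʳ _)

    sgn-∑ : ∀ k {n} (f : Vector Carrier n) → sgn k (∑ f) ≈ ∑ (λ i → sgn k (f i))
    sgn-∑ k f = trans (sgn≈ k _) (trans (*-∑ _ f) (∑-cong λ i → sym (sgn≈ k (f i))))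

    sgn-involutive : ∀ k x → sgn k (sgn k x) ≈ x
    sgn-involutive zero    x = trans (sgn-zero _) (sgn-zero x)
    sgn-involutive (suc k) x = begin
      sgn (suc k) (sgn (suc k) x)   ≈⟨ sgn-cong (suc k) (sgn-suc k x) ⟩
      sgn (suc k) (- sgn k x)       ≈⟨ sgn-neg (suc k) _ ⟩
      - sgn (suc k) (sgn k x)       ≈⟨ -‿cong (sgn-suc k _) ⟩
      - - sgn k (sgn k x)           ≈⟨ -‿involutive _ ⟩
      sgn k (sgn k x)               ≈⟨ sgn-involutive k x ⟩
      x                             ∎

    Det-cong : ∀ {n} {M N : Matrix Carrier n} → (∀ i j → M i j ≈ N i j) → Det M ≈ Det N
    Det-cong {zero}  {M} {N} M≈N = trans (Det-zero M) (sym (Det-zero N))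
    Det-cong {suc n} {M} {N} M≈N = trans (Det-suc M) (trans
      (∑-cong λ j → sgn-cong (toℕ j)
        (*-cong (M≈N zero j) (Det-cong λ i k → M≈N (suc i) (punchIn j k))))
      (sym (Det-suc N)))

    Det-cong-≡ : ∀ {n} {M N : Matrix Carrier n} → (∀ i j → M i j ≡ N i j) → Det M ≈ Det N
    Det-cong-≡ M≡N = Det-cong λ i j → reflexive (M≡N i j)

    Det-neg : ∀ {n} (M : Matrix Carrier n) → Det (λ i j → - M i j) ≈ sgn n (Det M)
    Det-neg {zero}  M = trans (Det-zero _) (sym (trans (sgn-zero _) (Det-zero M)))
    Det-neg {suc n} M = begin
      Det (λ i j → - M i j)
        ≈⟨ Det-suc _ ⟩
      ∑ (λ j → sgn (toℕ j) (- M zero j * Det (λ i k → - minor zero j M i k)))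
        ≈⟨ ∑-cong (λ j → trans (sgn-cong (toℕ j) (begin
             - M zero j * Det (λ i k → - minor zero j M i k)   ≈⟨ *-congˡ (Det-neg (minor zero j M)) ⟩
             - M zero j * sgn n (Det (minor zero j M))         ≈⟨ -‿distribˡ-* _ _ ⟨
             - (M zero j * sgn n (Det (minor zero j M)))       ≈⟨ -‿cong (sgn-*ʳ n _ _) ⟩
             - sgn n (M zero j * Det (minor zero j M))         ≈⟨ sgn-suc n _ ⟨
             sgn (suc n) (M zero j * Det (minor zero j M))     ∎)) (sgn-comm (toℕ j) (suc n) _)) ⟩
      ∑ (λ j → sgn (suc n) (sgn (toℕ j) (M zero j * Det (minor zero j M))))
        ≈⟨ sgn-∑ (suc n) _ ⟨
      sgn (suc n) (∑ (λ j → sgn (toℕ j) (M zero j * Det (minor zero j M))))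
        ≈⟨ sgn-cong (suc n) (Det-suc M) ⟨
      sgn (suc n) (Det M) ∎

    -- Expanding along the first row and then along the first column gives a
    -- formula that is symmetric under transposition.
    private
      block : ∀ {n} → Matrix Carrier (suc (suc n)) → Fin (suc n) → Fin (suc n) → Carrier
      block M i j = Det (minor i j (λ a b → M (suc a) (suc b)))

      borderTerm : ∀ {n} → Matrix Carrier (suc (suc n)) → Fin (suc n) → Fin (suc n) → Carrier
      borderTerm M i j = sgn (suc (toℕ j)) (sgn (toℕ i) (M zero (suc j) *
          (M (suc i) zero * block M i j)))

      -- The two hypotheses are the transposition rule at the two smaller orders. Only expansion
      -- along the first row holds by definition, so the column expansion of the minors is borrowed
      -- from them; `Det-transpose` supplies both by recursion.
      expand-border : ∀ {n} (M : Matrix Carrier (suc (suc n))) →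
        (∀ (N : Matrix Carrier (suc n)) → Det (flip N) ≈ Det N) →
        (∀ (N : Matrix Carrier n) → Det (flip N) ≈ Det N) →
        Det M ≈ M zero zero * Det (minor zero zero M) + ∑ (λ j → ∑ λ i → borderTerm M i j)
      expand-border {n} M flip₁ flip₀ = begin
        Det M
          ≈⟨ Det-suc M ⟩
        ∑ (λ j → sgn (toℕ j) (M zero j * Det (minor zero j M)))
          ≈⟨ ∑-suc _ ⟩
        sgn 0 (M zero zero * Det (minor zero zero M)) + ∑ row
          ≈⟨ +-cong (sgn-zero _) (∑-cong row≈) ⟩
        M zero zero * Det (minor zero zero M) + ∑ (λ j → ∑ λ i → borderTerm M i j) ∎
        where
        row : Vector Carrier (suc n)
        row j = sgn (suc (toℕ j)) (M zero (suc j) * Det (minor zero (suc j) M))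
        row≈ : ∀ j → row j ≈ ∑ λ i → borderTerm M i j
        row≈ j = begin
          sgn (suc (toℕ j)) (M zero (suc j) * Det (minor zero (suc j) M))
            ≈⟨ sgn-cong (suc (toℕ j)) (*-congˡ (trans (sym (flip₁ _)) (Det-suc _))) ⟩
          sgn (suc (toℕ j)) (M zero (suc j) * ∑ (λ i → sgn (toℕ i)
              (M (suc i) zero * Det (flip (minor i j (λ a b → M (suc a) (suc b)))))))
            ≈⟨ sgn-cong (suc (toℕ j)) (trans (*-∑ _ _) (∑-cong λ i → sgn-*ʳ (toℕ i) _ _)) ⟩
          sgn (suc (toℕ j)) (∑ (λ i → sgn (toℕ i) (M zero (suc j) *
              (M (suc i) zero * Det (flip (minor i j (λ a b → M (suc a) (suc b))))))))
            ≈⟨ sgn-∑ (suc (toℕ j)) _ ⟩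
          ∑ (λ i → sgn (suc (toℕ j)) (sgn (toℕ i) (M zero (suc j) *
              (M (suc i) zero * Det (flip (minor i j (λ a b → M (suc a) (suc b))))))))
            ≈⟨ ∑-cong (λ i → sgn-cong (suc (toℕ j)) (sgn-cong (toℕ i)
                 (*-congˡ (*-congˡ (flip₀ _))))) ⟩
          ∑ (λ i → borderTerm M i j) ∎

    Det-transpose : ∀ {n} (M : Matrix Carrier n) → Det (flip M) ≈ Det M
    Det-transpose {zero}        M = trans (Det-zero _) (sym (Det-zero _))
    Det-transpose {suc zero}    M = trans (Det-suc _) (trans (∑-cong λ { zero → sgn-cong 0
      (*-congˡ (trans (Det-zero _) (sym (Det-zero _)))) }) (sym (Det-suc _)))
    Det-transpose {suc (suc n)} M = begin
      Det (flip M)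
        ≈⟨ expand-border (flip M) Det-transpose Det-transpose ⟩
      M zero zero * Det (minor zero zero (flip M)) + ∑ (λ j → ∑ λ i → borderTerm (flip M) i j)
        ≈⟨ +-cong (*-congˡ (Det-transpose (minor zero zero M)))
             (trans (∑-cong λ j → ∑-cong λ i → term i j) (∑-comm _)) ⟩
      M zero zero * Det (minor zero zero M) + ∑ (λ i → ∑ λ j → borderTerm M j i)
        ≈⟨ expand-border M Det-transpose Det-transpose ⟨
      Det M ∎
      where
      term : ∀ i j → borderTerm (flip M) i j ≈ borderTerm M j i
      term i j = begin
        sgn (suc (toℕ j)) (sgn (toℕ i) (M (suc j) zero * (M zero (suc i) * block (flip M) i j)))
          ≈⟨ sgn-suc _ _ ⟩
        - sgn (toℕ j) (sgn (toℕ i) (M (suc j) zero * (M zero (suc i) * block (flip M) i j)))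
          ≈⟨ -‿cong (trans (sgn-comm (toℕ j) (toℕ i) _) (sgn-cong (toℕ i) (sgn-cong (toℕ j)
               (trans (x∙yz≈y∙xz _ _ _) (*-congˡ (*-congˡ (Det-transpose _))))))) ⟩
        - sgn (toℕ i) (sgn (toℕ j) (M zero (suc i) * (M (suc j) zero * block M j i)))
          ≈⟨ sgn-suc _ _ ⟨
        sgn (suc (toℕ i)) (sgn (toℕ j) (M zero (suc i) * (M (suc j) zero * block M j i))) ∎

    private
      restCols : ∀ {n} (a b : Vector Carrier (suc (suc n))) → (Fin n → Vector Carrier (suc (suc n))) →
                 Vector Carrier n
      restCols a b C j = sgn (suc (suc (toℕ j)))
        (C j zero * Det (minor zero (suc (suc j)) (flip (a ∷ b ∷ C))))

      expand-cols : ∀ {n} (a b : Vector Carrier (suc (suc n)))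
          (C : Fin n → Vector Carrier (suc (suc n))) →
        Det (flip (a ∷ b ∷ C)) ≈ a zero * Det (λ i k → (b ∷ C) k (suc i))
          + (- (b zero * Det (λ i k → (a ∷ C) k (suc i))) + ∑ (restCols a b C))
      expand-cols a b C = trans (Det-suc _) (trans (∑-suc _) (+-cong (sgn-zero _) (trans (∑-suc _)
        (+-congʳ (trans (sgn-suc 0 _) (-‿cong (trans (sgn-zero _) (*-congˡ
          (Det-cong-≡ λ { i zero → ≡.refl ; i (suc k) → ≡.refl })))))))))

      minor-cols : ∀ {n} (a b : Vector Carrier (suc (suc (suc n))))
        (C : Fin (suc n) → Vector Carrier (suc (suc (suc n)))) j i k →
        minor zero (suc (suc j)) (flip (a ∷ b ∷ C)) i k ≡
        flip ((a ∘ suc) ∷ (b ∘ suc) ∷ (λ l → C (punchIn j l) ∘ suc)) i k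
      minor-cols a b C j i zero          = ≡.refl
      minor-cols a b C j i (suc zero)    = ≡.refl
      minor-cols a b C j i (suc (suc k)) = ≡.refl

    -- In the first-row expansion the terms of columns 0 and 1 trade places with opposite signs. In
    -- every other term the swapped pair still forms the first two columns of the minor, so
    -- recursion applies.
    Det-swap-cols : ∀ {n} (a b : Vector Carrier (suc (suc n))) C →
                    Det (flip (a ∷ b ∷ C)) ≈ - Det (flip (b ∷ a ∷ C))
    Det-swap-cols {n} a b C = begin
      Det (flip (a ∷ b ∷ C))
        ≈⟨ expand-cols a b C ⟩
      s + (- t + ∑ (restCols a b C))
        ≈⟨ +-congˡ (+-congˡ (trans (∑-cong (rest-neg a b C)) (∑-neg _))) ⟩
      s + (- t + - ∑ (restCols b a C))
        ≈⟨ trans (sym (+-assoc _ _ _)) (trans (+-congʳ (+-comm _ _)) (+-assoc _ _ _)) ⟩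
      - t + (s + - ∑ (restCols b a C))
        ≈⟨ +-congˡ (trans (+-congʳ (sym (-‿involutive s))) (-‿+-comm _ _)) ⟩
      - t + - (- s + ∑ (restCols b a C))
        ≈⟨ -‿+-comm _ _ ⟩
      - (t + (- s + ∑ (restCols b a C)))
        ≈⟨ -‿cong (expand-cols b a C) ⟨
      - Det (flip (b ∷ a ∷ C)) ∎
      where
      s t : Carrier
      s = a zero * Det (λ i k → (b ∷ C) k (suc i))
      t = b zero * Det (λ i k → (a ∷ C) k (suc i))
      rest-neg : ∀ {n} (a b : Vector Carrier (suc (suc n))) C j →
                 restCols a b C j ≈ - restCols b a C j
      rest-neg {suc n} a b C j = trans (sgn-cong (suc (suc (toℕ j))) (begin
        C j zero * Det (minor zero (suc (suc j)) (flip (a ∷ b ∷ C)))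
          ≈⟨ *-congˡ (trans (Det-cong-≡ (minor-cols a b C j)) (Det-swap-cols _ _ _)) ⟩
        C j zero * - Det (flip ((b ∘ suc) ∷ (a ∘ suc) ∷ (λ l → C (punchIn j l) ∘ suc)))
          ≈⟨ -‿distribʳ-* _ _ ⟨
        - (C j zero * Det (flip ((b ∘ suc) ∷ (a ∘ suc) ∷ (λ l → C (punchIn j l) ∘ suc))))
          ≈⟨ -‿cong (*-congˡ (Det-cong-≡ (minor-cols b a C j))) ⟨
        - (C j zero * Det (minor zero (suc (suc j)) (flip (b ∷ a ∷ C)))) ∎)) (sgn-neg _ _)

    -- The swap rule would give only 2 det = 0, which is too weak in a general ring. Hence the same
    -- expansion is used again: its first two terms cancel and the others vanish by recursion.
    Det-equal-cols : ∀ {n} (a : Vector Carrier (suc (suc n))) C → Det (flip (a ∷ a ∷ C)) ≈ 0#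
    Det-equal-cols a C = begin
      Det (flip (a ∷ a ∷ C))
        ≈⟨ expand-cols a a C ⟩
      s + (- s + ∑ (restCols a a C))
        ≈⟨ +-congˡ (trans (+-congˡ (∑-0 (rest≈0 a C))) (+-identityʳ _)) ⟩
      s + - s
        ≈⟨ -‿inverseʳ s ⟩
      0# ∎
      where
      s : Carrier
      s = a zero * Det (λ i k → (a ∷ C) k (suc i))
      rest≈0 : ∀ {n} (a : Vector Carrier (suc (suc n))) C j → restCols a a C j ≈ 0#
      rest≈0 {suc n} a C j = trans (sgn-cong (suc (suc (toℕ j)))
        (trans (*-congˡ (trans (Det-cong-≡ (minor-cols a a C j)) (Det-equal-cols _ _))) (zeroʳ _)))
        (sgn-0 _)

    Det-swap-rows : ∀ {n} (a b : Vector Carrier (suc (suc n))) C →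
                    Det (a ∷ b ∷ C) ≈ - Det (b ∷ a ∷ C)
    Det-swap-rows a b C = trans (sym (Det-transpose (a ∷ b ∷ C)))
      (trans (Det-swap-cols a b C) (-‿cong (Det-transpose (b ∷ a ∷ C))))

    -- Induction on j: expanding along row 0, which stays in place, leaves minors where the new row
    -- sits one position earlier. Bringing it past row 0 is a single swap, the one extra sign.
    Det-insertAt : ∀ {n} (C : Vector (Vector Carrier (suc n)) n) j a →
                   Det (insertAt C j a) ≈ sgn (toℕ j) (Det (a ∷ C))
    Det-insertAt C zero a = trans
      (Det-cong-≡ λ { zero j → ≡.refl ; (suc i) j → ≡.refl }) (sym (sgn-zero _))
    Det-insertAt {suc n} C (suc j) a = begin
      Det (insertAt C (suc j) a)
        ≈⟨ Det-suc _ ⟩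
      ∑ (λ c → sgn (toℕ c) (C zero c * Det (minor zero c (insertAt C (suc j) a))))
        ≈⟨ ∑-cong (λ c → sgn-cong (toℕ c) (*-congˡ (begin
             Det (minor zero c (insertAt C (suc j) a))
               ≈⟨ Det-cong-≡ (λ i k → ≡.cong (λ v → v k)
                    (insertAt-∘ (_∘ punchIn c) (C ∘ suc) j a i)) ⟩
             Det (insertAt (λ i → C (suc i) ∘ punchIn c) j (a ∘ punchIn c))
               ≈⟨ Det-insertAt _ j _ ⟩
             sgn (toℕ j) (Det ((a ∘ punchIn c) ∷ (λ i → C (suc i) ∘ punchIn c)))
               ≈⟨ sgn-cong (toℕ j)
                    (Det-cong-≡ λ { zero k → ≡.refl ; (suc i) k → ≡.refl }) ⟩
             sgn (toℕ j) (Det (minor zero c (C zero ∷ a ∷ (C ∘ suc)))) ∎))) ⟩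
      ∑ (λ c → sgn (toℕ c) (C zero c * sgn (toℕ j) (Det (minor zero c (C zero ∷ a ∷ (C ∘ suc))))))
        ≈⟨ ∑-cong (λ c → trans (sgn-cong (toℕ c) (sgn-*ʳ (toℕ j) _ _))
             (sgn-comm (toℕ c) (toℕ j) _)) ⟩
      ∑ (λ c → sgn (toℕ j) (sgn (toℕ c) (C zero c * Det (minor zero c (C zero ∷ a ∷ (C ∘ suc))))))
        ≈⟨ sgn-∑ (toℕ j) _ ⟨
      sgn (toℕ j) (∑ (λ c → sgn (toℕ c) (C zero c * Det (minor zero c (C zero ∷ a ∷ (C ∘ suc))))))
        ≈⟨ sgn-cong (toℕ j) (trans (sym (Det-suc _)) (Det-swap-rows _ _ _)) ⟩
      sgn (toℕ j) (- Det (a ∷ C zero ∷ (C ∘ suc)))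
        ≈⟨ trans (sgn-neg (toℕ j) _) (sym (sgn-suc _ _)) ⟩
      sgn (suc (toℕ j)) (Det (a ∷ C zero ∷ (C ∘ suc)))
        ≈⟨ sgn-cong (suc (toℕ j)) (Det-cong-≡
             λ { zero k → ≡.refl ; (suc zero) k → ≡.refl ; (suc (suc i)) k → ≡.refl }) ⟩
      sgn (suc (toℕ j)) (Det (a ∷ C)) ∎

    Det-toFront : ∀ {n} (M : Matrix Carrier n) j → Det M ≈ sgn (toℕ j) (Det (toFront j M))
    Det-toFront {suc n} M j = trans
      (Det-cong-≡ λ i k → ≡.cong (λ v → v k) (≡.sym (insertAt-removeAt M j i)))
      (Det-insertAt (removeAt M j) j (M j))

    Det-equal-rows : ∀ {n} (M : Matrix Carrier n) {i j} → i ≢ j → M i ≡ M j → Det M ≈ 0#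
    Det-equal-rows {suc zero}    M {zero} {zero} i≢j _ = contradiction ≡.refl i≢j
    Det-equal-rows {suc (suc n)} M {i} {j} i≢j Mi≡Mj = begin
      Det M
        ≈⟨ Det-toFront M i ⟩
      sgn (toℕ i) (Det (M i ∷ M′))
        ≈⟨ sgn-cong (toℕ i) (Det-toFront (M i ∷ M′) (suc k)) ⟩
      sgn (toℕ i) (sgn (suc (toℕ k)) (Det (toFront (suc k) (M i ∷ M′))))
        ≈⟨ sgn-cong (toℕ i) (sgn-cong (suc (toℕ k)) (trans (Det-cong-≡ rows)
             (trans (sym (Det-transpose (M i ∷ M i ∷ removeAt M′ k))) (Det-equal-cols _ _)))) ⟩
      sgn (toℕ i) (sgn (suc (toℕ k)) 0#)
        ≈⟨ trans (sgn-cong (toℕ i) (sgn-0 (suc (toℕ k)))) (sgn-0 (toℕ i)) ⟩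
      0# ∎
      where
      M′ : Vector (Vector Carrier (suc (suc n))) (suc n)
      M′ = removeAt M i
      k : Fin (suc n)
      k = punchOut i≢j
      rows : ∀ r c → toFront (suc k) (M i ∷ M′) r c ≡ (M i ∷ M i ∷ removeAt M′ k) r c
      rows zero          c = ≡.cong (λ v → v c)
        (≡.trans (≡.cong M (punchIn-punchOut i≢j)) (≡.sym Mi≡Mj))
      rows (suc zero)    c = ≡.refl
      rows (suc (suc r)) c = ≡.refl

    -- Signs are recorded only for moving one entry to the front, the one permutation that first-row
    -- expansion produces. `repeat` is a separate field because a sign rule does not imply it in
    -- characteristic 2, and `ext` replaces function extensionality.
    record Alternating {X : Set} {n} (f : Vector X n → Carrier) : Set where
      field
        ext    : ∀ {J K} → J ≗ K → f J ≈ f K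
        move   : ∀ J j → f J ≈ sgn (toℕ j) (f (toFront j J))
        repeat : ∀ J {i j} → i ≢ j → J i ≡ J j → f J ≈ 0#
    open Alternating

    Det-alternating : ∀ {X : Set} {n} (N : X → Vector Carrier n) →
                      Alternating (λ (J : Vector X n) → Det (N ∘ J))
    Det-alternating {X} N = record
      { ext    = λ J≗K → Det-cong-≡ λ i k → ≡.cong (λ a → N a k) (J≗K i)
      ; move   = λ J j → trans (Det-toFront (N ∘ J) j)
          (sgn-cong (toℕ j) (Det-cong-≡ λ i k → ≡.cong (λ v → v k) (front N J j i)))
      ; repeat = λ J i≢j Ji≡Jj → Det-equal-rows (N ∘ J) i≢j (≡.cong N Ji≡Jj)
      }
      where
      front : ∀ {m n} (N : X → Vector Carrier m) (J : Vector X n) j i →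
              toFront j (N ∘ J) i ≡ N (toFront j J i)
      front {n = suc n} N J j zero    = ≡.refl
      front {n = suc n} N J j (suc i) = ≡.refl

    -- Sums over index families and the Cauchy-Binet formula.

    opaque
      ∏ : ∀ {n} → Vector Carrier n → Carrier
      ∏ = product

      ∏-zero : (f : Vector Carrier 0) → ∏ f ≈ 1#
      ∏-zero f = refl

      ∏-suc : ∀ {n} (f : Vector Carrier (suc n)) → ∏ f ≈ f zero * ∏ (f ∘ suc)
      ∏-suc f = refl

      ∏-cong : ∀ {n} {f g : Vector Carrier n} → (∀ i → f i ≈ g i) → ∏ f ≈ ∏ g
      ∏-cong = product-cong

      ∏-remove : ∀ {n} i (f : Vector Carrier (suc n)) → ∏ f ≈ f i * ∏ (f ∘ punchIn i)
      ∏-remove i f = product-remove f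

      ∏-* : ∀ {n} (f g : Vector Carrier n) → ∏ (λ i → f i * g i) ≈ ∏ f * ∏ g
      ∏-* = product-distrib

    Extensional : ∀ {p n} → (Vector (Fin p) n → Carrier) → Set
    Extensional g = ∀ {J K} → J ≗ K → g J ≈ g K

    -- All families J are summed, not only increasing ones. For summands that are products of two
    -- alternating factors, families with repetitions give 0 and each n-element index set is counted
    -- n! times, which avoids enumerating subsets.
    ∑F : ∀ {p} n → (Vector (Fin p) n → Carrier) → Carrier
    ∑F zero    g = g []
    ∑F (suc n) g = ∑ λ a → ∑F n λ J → g (a ∷ J)

    ∑F-cong : ∀ {p} n {f g : Vector (Fin p) n → Carrier} → (∀ J → f J ≈ g J) → ∑F n f ≈ ∑F n g
    ∑F-cong zero    f≈g = f≈g []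
    ∑F-cong (suc n) f≈g = ∑-cong λ a → ∑F-cong n λ J → f≈g (a ∷ J)

    *-∑F : ∀ {p} n x (g : Vector (Fin p) n → Carrier) → x * ∑F n g ≈ ∑F n λ J → x * g J
    *-∑F zero    x g = refl
    *-∑F (suc n) x g = trans (*-∑ x _) (∑-cong λ a → *-∑F n x _)

    ∑-∑F-comm : ∀ {p m} n (g : Fin m → Vector (Fin p) n → Carrier) →
                ∑ (λ i → ∑F n (g i)) ≈ ∑F n (λ J → ∑ λ i → g i J)
    ∑-∑F-comm zero    g = refl
    ∑-∑F-comm (suc n) g = trans (∑-comm _) (∑-cong λ a → ∑-∑F-comm n λ i J → g i (a ∷ J))

    ∑F-0 : ∀ {p} n {g : Vector (Fin p) n → Carrier} → (∀ J → g J ≈ 0#) → ∑F n g ≈ 0#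
    ∑F-0 zero    g≈0 = g≈0 []
    ∑F-0 (suc n) g≈0 = ∑-0 λ a → ∑F-0 n λ J → g≈0 (a ∷ J)

    -- The map J ↦ (`J j`, `removeAt J j`) is a bijection, so the right side does not depend on j.
    -- Summing over j later yields the factor n + 1 of the factorial.
    ∑F-removeAt : ∀ {p} n (g : Fin p → Vector (Fin p) n → Carrier) → (∀ a → Extensional (g a)) →
                  ∀ j → ∑F (suc n) (λ J → g (J j) (removeAt J j)) ≈ ∑ λ a → ∑F n (g a)
    ∑F-removeAt n       g ext zero    = refl
    ∑F-removeAt (suc n) g ext (suc j) = begin
      ∑ (λ a → ∑F (suc n) (λ J → g (J j) (removeAt (a ∷ J) (suc j))))
        ≈⟨ ∑-cong (λ a → ∑F-cong (suc n) λ J →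
             ext (J j) {removeAt (a ∷ J) (suc j)} {a ∷ removeAt J j}
               λ { zero → ≡.refl ; (suc i) → ≡.refl }) ⟩
      ∑ (λ a → ∑F (suc n) (λ J → g (J j) (a ∷ removeAt J j)))
        ≈⟨ ∑-cong (λ a → ∑F-removeAt n (λ b K → g b (a ∷ K)) (λ b J≗K → ext b (∷-cong a J≗K)) j) ⟩
      ∑ (λ a → ∑ λ b → ∑F n (λ K → g b (a ∷ K)))
        ≈⟨ ∑-comm _ ⟩
      ∑ (λ b → ∑F (suc n) (g b)) ∎

    ∑F-avoid : ∀ {p} n (a : Fin (suc p)) (g : Vector (Fin (suc p)) n → Carrier) → Extensional g →
               (∀ J i → J i ≡ a → g J ≈ 0#) → ∑F n g ≈ ∑F n (λ J → g (punchIn a ∘ J))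
    ∑F-avoid zero    a g ext g≈0 = ext λ ()
    ∑F-avoid (suc n) a g ext g≈0 = begin
      ∑ (λ b → ∑F n λ J → g (b ∷ J))
        ≈⟨ ∑-remove a _ ⟩
      ∑F n (λ J → g (a ∷ J)) + ∑ (λ b → ∑F n λ J → g (punchIn a b ∷ J))
        ≈⟨ +-cong (∑F-0 n λ J → g≈0 (a ∷ J) zero ≡.refl)
             (∑-cong λ b → ∑F-avoid n a _ (λ J≗K → ext (∷-cong _ J≗K))
               (λ J i Ji≡a → g≈0 (punchIn a b ∷ J) (suc i) Ji≡a)) ⟩
      0# + ∑ (λ b → ∑F n λ J → g (punchIn a b ∷ punchIn a ∘ J))
        ≈⟨ +-identityˡ _ ⟩
      ∑ (λ b → ∑F n λ J → g (punchIn a b ∷ punchIn a ∘ J))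
        ≈⟨ ∑-cong (λ b → ∑F-cong n λ J → ext λ { zero → ≡.refl ; (suc i) → ≡.refl }) ⟩
      ∑ (λ b → ∑F n λ J → g (punchIn a ∘ (b ∷ J))) ∎

    alternating-∘ : ∀ {X Y : Set} {n} {f : Vector Y n → Carrier} (h : X → Y) →
                    Alternating f → Alternating (λ J → f (h ∘ J))
    alternating-∘ {n = n} {f} h alt = record
      { ext    = λ J≗K → ext alt λ i → ≡.cong h (J≗K i)
      ; move   = λ J j → trans (move alt (h ∘ J) j) (sgn-cong (toℕ j) (ext alt (front J j)))
      ; repeat = λ J i≢j Ji≡Jj → repeat alt (h ∘ J) i≢j (≡.cong h Ji≡Jj)
      }
      where
      front : ∀ {n} (J : Vector _ n) j → toFront j (h ∘ J) ≗ h ∘ toFront j J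
      front {suc n} J j zero    = ≡.refl
      front {suc n} J j (suc i) = ≡.refl

    alternating-∷ : ∀ {X : Set} {n} {f : Vector X (suc n) → Carrier} (a : X) →
                    Alternating f → Alternating (λ J → f (a ∷ J))
    alternating-∷ {X} {suc n} {f} a alt = record
      { ext    = λ J≗K → ext alt (∷-cong a J≗K)
      ; move   = move-tail
      ; repeat = λ J i≢j Ji≡Jj → repeat alt (a ∷ J) (i≢j ∘ suc-injective) Ji≡Jj
      }
      where
      -- `J j` is moved past `a` to the very front, at the cost of j + 1 signs, and then `a` is
      -- moved back in front of it, at the cost of one more; the two extra signs cancel.
      move-tail : ∀ J j → f (a ∷ J) ≈ sgn (toℕ j) (f (a ∷ toFront j J))
      move-tail J j = begin
        f (a ∷ J)
          ≈⟨ move alt (a ∷ J) (suc j) ⟩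
        sgn (suc (toℕ j)) (f (J j ∷ removeAt (a ∷ J) (suc j)))
          ≈⟨ sgn-cong (suc (toℕ j)) (ext alt λ
               { zero → ≡.refl ; (suc zero) → ≡.refl ; (suc (suc i)) → ≡.refl }) ⟩
        sgn (suc (toℕ j)) (f (toFront (suc zero) (a ∷ toFront j J)))
          ≈⟨ sgn-suc _ _ ⟩
        - sgn (toℕ j) (f (toFront (suc zero) (a ∷ toFront j J)))
          ≈⟨ sgn-neg _ _ ⟨
        sgn (toℕ j) (- f (toFront (suc zero) (a ∷ toFront j J)))
          ≈⟨ sgn-cong (toℕ j) (trans (-‿cong (sym (sgn-zero _))) (sym (sgn-suc 0 _))) ⟩
        sgn (toℕ j) (sgn 1 (f (toFront (suc zero) (a ∷ toFront j J))))
          ≈⟨ sgn-cong (toℕ j) (move alt (a ∷ toFront j J) (suc zero)) ⟨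
        sgn (toℕ j) (f (a ∷ toFront j J)) ∎
    alternating-∷ {X} {zero} {f} a alt = record
      { ext    = λ J≗K → ext alt (∷-cong a J≗K)
      ; move   = λ J ()
      ; repeat = λ { J {()} }
      }

    along : ∀ {p n} → (Fin n → Fin p → Carrier) → Vector (Fin p) n → Carrier
    along M J = ∏ λ i → M i (J i)

    along-∷ : ∀ {p n} (M : Fin (suc n) → Fin p → Carrier) a J →
              along M (a ∷ J) ≈ M zero a * along (M ∘ suc) J
    along-∷ M a J = ∏-suc _

    along-ext : ∀ {p n} (M : Fin n → Fin p → Carrier) → Extensional (along M)
    along-ext M J≗K = ∏-cong λ i → reflexive (≡.cong (M i) (J≗K i))

    -- Multilinearity in the rows: row i of the product is a combination of rows of N, and `J i`
    -- records the one chosen. With M rectangular it serves both the product rule, p = n, and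
    -- Cauchy-Binet.
    Det-expand-rows : ∀ {p n} (M : Fin n → Fin p → Carrier) (N : Fin p → Fin n → Carrier) →
      Det (λ i j → ∑ λ a → M i a * N a j) ≈ ∑F n λ J → along M J * Det (N ∘ J)
    Det-expand-rows {p} {zero}  M N = begin
      Det (λ i j → ∑ λ a → M i a * N a j)   ≈⟨ Det-zero _ ⟩
      1#                                    ≈⟨ *-identityˡ 1# ⟨
      1# * 1#                               ≈⟨ *-cong (∏-zero _) (Det-zero _) ⟨
      along M [] * Det (N ∘ [])             ∎
    Det-expand-rows {p} {suc n} M N = begin
      Det (λ i j → ∑ λ a → M i a * N a j)
        ≈⟨ Det-suc _ ⟩
      ∑ (λ j → sgn (toℕ j) (∑ (λ a → M zero a * N a j) * Det (MN j)))
        ≈⟨ ∑-cong (λ j → trans (sgn-cong (toℕ j) (∑-* _ _)) (sgn-∑ (toℕ j) _)) ⟩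
      ∑ (λ j → ∑ λ a → sgn (toℕ j) (M zero a * N a j * Det (MN j)))
        ≈⟨ ∑-comm _ ⟩
      ∑ (λ a → ∑ λ j → sgn (toℕ j) (M zero a * N a j * Det (MN j)))
        ≈⟨ ∑-cong row ⟩
      ∑ (λ a → ∑F n λ J → along M (a ∷ J) * Det (N ∘ (a ∷ J))) ∎
      where
      MN : Fin (suc n) → Matrix Carrier n
      MN j i k = ∑ λ a → M (suc i) a * N a (punchIn j k)
      term : Fin p → Vector (Fin p) n → Fin (suc n) → Carrier
      term a J j = sgn (toℕ j) (N a j * Det (minor zero j (N ∘ (a ∷ J))))
      cell : ∀ a j → sgn (toℕ j) (M zero a * N a j * Det (MN j))
                   ≈ M zero a * ∑F n (λ J → along (M ∘ suc) J * term a J j)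
      cell a j = begin
        sgn (toℕ j) (M zero a * N a j * Det (MN j))
          ≈⟨ sgn-cong (toℕ j) (*-assoc _ _ _) ⟩
        sgn (toℕ j) (M zero a * (N a j * Det (MN j)))
          ≈⟨ sgn-*ʳ (toℕ j) _ _ ⟨
        M zero a * sgn (toℕ j) (N a j * Det (MN j))
          ≈⟨ *-congˡ (sgn-*ˡ (toℕ j) _ _) ⟨
        M zero a * (sgn (toℕ j) (N a j) * Det (MN j))
          ≈⟨ *-congˡ (*-congˡ (Det-expand-rows (M ∘ suc) (λ b k → N b (punchIn j k)))) ⟩
        M zero a * (sgn (toℕ j) (N a j) * ∑F n (λ J → along (M ∘ suc) J * Det
            (λ i k → N (J i) (punchIn j k))))
          ≈⟨ *-congˡ (trans (*-∑F n _ _) (∑F-cong n λ J →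
               trans (x∙yz≈y∙xz _ _ _) (*-congˡ (sgn-*ˡ (toℕ j) _ _)))) ⟩
        M zero a * ∑F n (λ J → along (M ∘ suc) J * term a J j) ∎
      row : ∀ a → ∑ (λ j → sgn (toℕ j) (M zero a * N a j * Det (MN j)))
                ≈ ∑F n λ J → along M (a ∷ J) * Det (N ∘ (a ∷ J))
      row a = begin
        ∑ (λ j → sgn (toℕ j) (M zero a * N a j * Det (MN j)))
          ≈⟨ ∑-cong (cell a) ⟩
        ∑ (λ j → M zero a * ∑F n (λ J → along (M ∘ suc) J * term a J j))
          ≈⟨ *-∑ _ _ ⟨
        M zero a * ∑ (λ j → ∑F n (λ J → along (M ∘ suc) J * term a J j))
          ≈⟨ *-congˡ (∑-∑F-comm n _) ⟩
        M zero a * ∑F n (λ J → ∑ λ j → along (M ∘ suc) J * term a J j)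
          ≈⟨ *-∑F n _ _ ⟩
        ∑F n (λ J → M zero a * ∑ λ j → along (M ∘ suc) J * term a J j)
          ≈⟨ ∑F-cong n (λ J → trans (*-congˡ (trans (sym (*-∑ _ _)) (*-congˡ (sym (Det-suc _)))))
               (trans (sym (*-assoc _ _ _)) (*-congʳ (sym (along-∷ M a J))))) ⟩
        ∑F n (λ J → along M (a ∷ J) * Det (N ∘ (a ∷ J))) ∎

    -- An alternating function of n indices out of n is determined by its value
    -- at the identity.
    ∑F-alternating : ∀ {n} (M : Matrix Carrier n) {f : Vector (Fin n) n → Carrier} → Alternating f →
                     ∑F n (λ J → along M J * f J) ≈ Det M * f id
    ∑F-alternating {zero}  M {f} alt = *-cong
      (trans (∏-zero _) (sym (Det-zero M))) (ext alt λ ())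
    ∑F-alternating {suc n} M {f} alt = begin
      ∑ (λ a → ∑F n λ J → along M (a ∷ J) * f (a ∷ J))
        ≈⟨ ∑-cong (λ a → trans (∑F-cong n λ J → trans (*-congʳ (along-∷ M a J)) (*-assoc _ _ _))
             (sym (*-∑F n _ _))) ⟩
      ∑ (λ a → M zero a * ∑F n (λ J → along (M ∘ suc) J * f (a ∷ J)))
        ≈⟨ ∑-cong (λ a → *-congˡ (∑F-avoid n a _
             (λ J≗K → *-cong (along-ext (M ∘ suc) J≗K) (ext alt (∷-cong a J≗K)))
             (λ J i Ji≡a → trans (*-congˡ (repeat alt (a ∷ J) {zero} {suc i} (λ ()) (≡.sym Ji≡a)))
               (zeroʳ _)))) ⟩
      ∑ (λ a → M zero a * ∑F n (λ J → along (minor zero a M) J * f (a ∷ punchIn a ∘ J)))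
        ≈⟨ ∑-cong (λ a → *-congˡ
             (∑F-alternating (minor zero a M) (alternating-∘ (punchIn a) (alternating-∷ a alt)))) ⟩
      ∑ (λ a → M zero a * (Det (minor zero a M) * f (a ∷ punchIn a)))
        -- `a ∷ punchIn a` is `toFront a id`, so the sign of `move` at the identity is exactly the
        -- cofactor sign of column a.
        ≈⟨ ∑-cong (λ a → *-congˡ (*-congˡ (begin
             f (a ∷ punchIn a)
               ≈⟨ sgn-involutive (toℕ a) _ ⟨
             sgn (toℕ a) (sgn (toℕ a) (f (a ∷ punchIn a)))
               ≈⟨ sgn-cong (toℕ a) (move alt id a) ⟨
             sgn (toℕ a) (f id) ∎))) ⟩
      ∑ (λ a → M zero a * (Det (minor zero a M) * sgn (toℕ a) (f id)))
        ≈⟨ ∑-cong (λ a → begin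
             M zero a * (Det (minor zero a M) * sgn (toℕ a) (f id))   ≈⟨ *-assoc _ _ _ ⟨
             M zero a * Det (minor zero a M) * sgn (toℕ a) (f id)     ≈⟨ sgn-*ʳ (toℕ a) _ _ ⟩
             sgn (toℕ a) (M zero a * Det (minor zero a M) * f id)     ≈⟨ sgn-*ˡ (toℕ a) _ _ ⟨
             sgn (toℕ a) (M zero a * Det (minor zero a M)) * f id     ∎) ⟩
      ∑ (λ a → sgn (toℕ a) (M zero a * Det (minor zero a M)) * f id)
        ≈⟨ trans (*-congʳ (Det-suc M)) (∑-* _ _) ⟨
      Det M * f id ∎

    Det-* : ∀ {n} (M N : Matrix Carrier n) → Det (λ i j → ∑ λ a → M i a * N a j) ≈ Det M * Det N
    Det-* M N = trans (Det-expand-rows M N) (∑F-alternating M (Det-alternating N))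

    -- Expand the determinant along its first row and move position j to the front in both factors.
    -- The two signs cancel, and after reindexing each of the n + 1 positions contributes the same
    -- sum, whence (n + 1) · n!.
    ∑F-Det-alternating : ∀ {p n} (M : Fin n → Fin p → Carrier) {f : Vector (Fin p) n → Carrier} →
      Alternating f →
      ∑F n (λ J → Det (λ i k → M i (J k)) * f J) ≈ (n !) × ∑F n (λ J → along M J * f J)
    ∑F-Det-alternating {p} {zero}  M {f} alt = trans
      (*-congʳ (trans (Det-zero _) (sym (∏-zero _)))) (sym (+-identityʳ _))
    ∑F-Det-alternating {p} {suc n} M {f} alt = begin
      ∑F (suc n) (λ J → Det (λ i k → M i (J k)) * f J)
        ≈⟨ ∑F-cong (suc n) (λ J → trans (*-congʳ {f J} (Det-suc (λ i k → M i (J k)))) (∑-* _ _)) ⟩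
      ∑F (suc n) (λ J → ∑ λ j → sgn (toℕ j) (M zero (J j) * D (removeAt J j)) * f J)
        ≈⟨ ∑-∑F-comm (suc n) (λ j J → sgn (toℕ j) (M zero (J j) * D (removeAt J j)) * f J) ⟨
      ∑ (λ j → ∑F (suc n) (λ J → sgn (toℕ j) (M zero (J j) * D (removeAt J j)) * f J))
        ≈⟨ ∑-cong (λ j → ∑F-cong (suc n) (λ J → cell j J)) ⟩
      ∑ {suc n} (λ j → ∑F (suc n) (λ J → h (J j) (removeAt J j)))
        ≈⟨ ∑-cong (∑F-removeAt n h h-ext) ⟩
      ∑ {suc n} (λ j → ∑ λ a → ∑F n (h a))
        ≈⟨ ∑-replicate (suc n) _ ⟩
      suc n × ∑ (λ a → ∑F n (h a))
        ≈⟨ ×-congʳ (suc n) (∑-cong λ a → begin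
             ∑F n (h a)
               ≈⟨ *-∑F n _ _ ⟨
             M zero a * ∑F n (λ J → D J * f (a ∷ J))
               ≈⟨ *-congˡ (∑F-Det-alternating (M ∘ suc) (alternating-∷ a alt)) ⟩
             M zero a * ((n !) × ∑F n (λ J → along (M ∘ suc) J * f (a ∷ J)))
               ≈⟨ ×-comm-* (n !) _ _ ⟩
             (n !) × (M zero a * ∑F n (λ J → along (M ∘ suc) J * f (a ∷ J)))
               ≈⟨ ×-congʳ (n !) (trans (*-∑F n _ _) (∑F-cong n λ J →
                    trans (sym (*-assoc _ _ _)) (*-congʳ (sym (along-∷ M a J))))) ⟩
             (n !) × ∑F n (λ J → along M (a ∷ J) * f (a ∷ J)) ∎) ⟩
      suc n × ∑ (λ a → (n !) × ∑F n (λ J → along M (a ∷ J) * f (a ∷ J)))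
        ≈⟨ ×-congʳ (suc n) (×-∑ (n !) _) ⟨
      suc n × ((n !) × ∑F (suc n) (λ J → along M J * f J))
        ≈⟨ ×-assocˡ _ (suc n) (n !) ⟩
      (suc n !) × ∑F (suc n) (λ J → along M J * f J) ∎
      where
      D : Vector (Fin p) n → Carrier
      D K = Det (λ i k → M (suc i) (K k))
      h : Fin p → Vector (Fin p) n → Carrier
      h a K = M zero a * (D K * f (a ∷ K))
      h-ext : ∀ a → Extensional (h a)
      h-ext a J≗K = *-congˡ (*-cong
        (Det-cong-≡ λ i k → ≡.cong (M (suc i)) (J≗K k)) (ext alt (∷-cong a J≗K)))
      ×-comm-* : ∀ m x y → x * (m × y) ≈ m × (x * y)
      ×-comm-* zero    x y = zeroʳ x
      ×-comm-* (suc m) x y = trans (distribˡ x y _) (+-congˡ (×-comm-* m x y))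
      ×-∑ : ∀ {k} m (g : Vector Carrier k) → m × ∑ g ≈ ∑ (λ i → m × g i)
      ×-∑ {k} zero g = sym (∑-replicate-0 k)
      ×-∑ (suc m) g = trans (+-congˡ (×-∑ m g)) (sym (∑-+ g _))
      cell : ∀ j J → sgn (toℕ j) (M zero (J j) * D (removeAt J j)) * f J ≈ h (J j) (removeAt J j)
      cell j J = begin
        sgn (toℕ j) (M zero (J j) * D (removeAt J j)) * f J
          ≈⟨ *-congˡ (move alt J j) ⟩
        sgn (toℕ j) (M zero (J j) * D (removeAt J j)) * sgn (toℕ j) (f (toFront j J))
          ≈⟨ trans (sgn-*ʳ (toℕ j) _ _) (sgn-cong (toℕ j) (sgn-*ˡ (toℕ j) _ _)) ⟩
        sgn (toℕ j) (sgn (toℕ j) (M zero (J j) * D (removeAt J j) * f (toFront j J)))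
          ≈⟨ trans (sgn-involutive (toℕ j) _) (*-assoc _ _ _) ⟩
        h (J j) (removeAt J j) ∎

    weight : ∀ {p n} → Vector Carrier p → Vector (Fin p) n → Carrier
    weight w J = ∏ λ i → w (J i)

    weighted-alternating : ∀ {p n} (w : Vector Carrier p) {f : Vector (Fin p) n → Carrier} →
                           Alternating f → Alternating (λ J → weight w J * f J)
    weighted-alternating w {f} alt = record
      { ext    = λ J≗K → *-cong (weight-ext J≗K) (ext alt J≗K)
      ; move   = λ J j → trans (*-cong (weight-front J j) (move alt J j)) (sgn-*ʳ (toℕ j) _ _)
      ; repeat = λ J i≢j Ji≡Jj → trans (*-congˡ (repeat alt J i≢j Ji≡Jj)) (zeroʳ _)
      }
      where
      weight-ext : Extensional (weight w)
      weight-ext J≗K = ∏-cong λ i → reflexive (≡.cong w (J≗K i))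
      weight-front : ∀ {n} (J : Vector _ n) j → weight w J ≈ weight w (toFront j J)
      weight-front {suc n} J j = trans (∏-remove j _) (sym (∏-suc _))

    -- M and N stay distinct because they will be the copies of one matrix in the variables x and y;
    -- the squares appear only on extracting coefficients.
    cauchyBinet : ∀ {p n} (w : Vector Carrier p) (M N : Fin n → Fin p → Carrier) →
      (n !) × Det (λ i j → ∑ λ a → M i a * (w a * N j a)) ≈
      ∑F n λ J → Det (λ i k → M i (J k)) * (weight w J * Det (λ i k → N i (J k)))
    cauchyBinet {p} {n} w M N = begin
      (n !) × Det (λ i j → ∑ λ a → M i a * (w a * N j a))
        ≈⟨ ×-congʳ (n !) (Det-cong λ i j → ∑-cong λ a → sym (*-assoc _ _ _)) ⟩
      (n !) × Det (λ i j → ∑ λ a → M i a * w a * N j a)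
        ≈⟨ ×-congʳ (n !) (Det-expand-rows (λ i a → M i a * w a) (flip N)) ⟩
      (n !) × ∑F n (λ J → along (λ i a → M i a * w a) J * Det (λ k j → N j (J k)))
        ≈⟨ ×-congʳ (n !) (∑F-cong n λ J → trans (*-congʳ (∏-* _ _)) (*-assoc _ _ _)) ⟩
      (n !) × ∑F n (λ J → along M J * (weight w J * Det (λ k j → N j (J k))))
        ≈⟨ ∑F-Det-alternating M (weighted-alternating w (Det-alternating (flip N))) ⟨
      ∑F n (λ J → Det (λ i k → M i (J k)) * (weight w J * Det (λ k j → N j (J k))))
        ≈⟨ ∑F-cong n (λ J → *-congˡ (*-congˡ (Det-transpose (λ i k → N i (J k))))) ⟩
      ∑F n (λ J → Det (λ i k → M i (J k)) * (weight w J * Det (λ i k → N i (J k)))) ∎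

    𝟙 : ∀ {n} → Matrix Carrier n
    𝟙 i j with i ≟ j
    ... | yes _ = 1#
    ... | no  _ = 0#

    𝟙-diagonal : ∀ {n} (i : Fin n) → 𝟙 i i ≡ 1#
    𝟙-diagonal i with i ≟ i
    ... | yes _   = ≡.refl
    ... | no  i≢i = contradiction ≡.refl i≢i

    𝟙-off : ∀ {n} {i j : Fin n} → i ≢ j → 𝟙 i j ≡ 0#
    𝟙-off {i = i} {j} i≢j with i ≟ j
    ... | yes i≡j = contradiction i≡j i≢j
    ... | no  _   = ≡.refl

    𝟙-sym : ∀ {n} (i j : Fin n) → 𝟙 i j ≈ 𝟙 j i
    𝟙-sym i j with i ≟ j
    ... | yes ≡.refl = reflexive (≡.sym (𝟙-diagonal i))
    ... | no  i≢j    = reflexive (≡.sym (𝟙-off (i≢j ∘ ≡.sym)))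

    𝟙-punchIn : ∀ {n} (k : Fin (suc n)) i j → 𝟙 (punchIn k i) (punchIn k j) ≡ 𝟙 i j
    𝟙-punchIn k i j with i ≟ j
    ... | yes ≡.refl = 𝟙-diagonal (punchIn k i)
    ... | no  i≢j    = 𝟙-off (i≢j ∘ punchIn-injective k i j)

    𝟙-elim : ∀ {n} (P : Carrier → Set) → P 1# → P 0# → (i j : Fin n) → P (𝟙 i j)
    𝟙-elim P P1 P0 i j with i ≟ j
    ... | yes _ = P1
    ... | no  _ = P0

    ∑-𝟙 : ∀ {n} i (f : Vector Carrier n) → ∑ (λ j → 𝟙 i j * f j) ≈ f i
    ∑-𝟙 {suc n} i f = begin
      ∑ (λ j → 𝟙 i j * f j)
        ≈⟨ ∑-remove i _ ⟩
      𝟙 i i * f i + ∑ (λ j → 𝟙 i (punchIn i j) * f (punchIn i j))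
        ≈⟨ +-cong (trans (*-congʳ (reflexive (𝟙-diagonal i))) (*-identityˡ _))
             (∑-0 λ j → trans (*-congʳ (reflexive (𝟙-off (punchInᵢ≢i i j ∘ ≡.sym)))) (zeroˡ _)) ⟩
      f i + 0#
        ≈⟨ +-identityʳ _ ⟩
      f i ∎

    ∑-++ : ∀ m {n} (f : Vector Carrier (m ℕ.+ n)) →
           ∑ f ≈ ∑ (λ i → f (i ↑ˡ n)) + ∑ (λ i → f (m ↑ʳ i))
    ∑-++ zero    f = sym (trans (+-congʳ (∑-zero _)) (+-identityˡ _))
    ∑-++ (suc m) f = trans (∑-suc f) (trans (+-congˡ (∑-++ m (f ∘ suc)))
      (trans (sym (+-assoc _ _ _)) (+-congʳ (sym (∑-suc _)))))

-- Power series, ring homomorphisms and derivations.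

module SeriesTheory where

  open import Defs
  open import Algebra.Bundles using (CommutativeRing)
  open import Algebra.Bundles.Raw using (RawRing)
  import Algebra.Construct.Pointwise as Pointwise
  import Algebra.Properties.CommutativeMonoid.Mult as CommutativeMonoidMult
  import Algebra.Properties.CommutativeSemigroup as CommutativeSemigroupProperties
  import Algebra.Properties.Ring as RingProperties
  import Algebra.Solver.CommutativeMonoid as CommutativeMonoidSolver
  open import Algebra.Morphism.Structures using (module RingMorphisms)
  open import Data.Fin.Base using (Fin; zero; suc; toℕ; punchIn)
  open import Data.Nat.Base using (ℕ; zero; suc)
  open import Data.Product.Base using (_,_)
  open import Data.Vec.Functional using (Vector; _∷_; removeAt)
  open import Function.Base using (_∘_)
  open import Level using (0ℓ)
  import Relation.Binary.Reasoning.Setoid as SetoidReasoning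
  open import Relation.Binary.PropositionalEquality.Core as ≡ using (_≡_)
  open DeterminantTheory

  Hom : (R S : RawRing 0ℓ 0ℓ) → (RawRing.Carrier R → RawRing.Carrier S) → Set
  Hom R S = RingMorphisms.IsRingHomomorphism R S

  module _ {R S : RawRing 0ℓ 0ℓ} where
    private
      module R = RawRing R
      module S = RawRing S

    mkHom : (f : R.Carrier → S.Carrier) →
            (∀ {x y} → x R.≈ y → f x S.≈ f y) →
            (∀ x y → f (x R.+ y) S.≈ f x S.+ f y) →
            (∀ x y → f (x R.* y) S.≈ f x S.* f y) →
            (∀ x → f (R.- x) S.≈ S.- f x) →
            f R.0# S.≈ S.0# → f R.1# S.≈ S.1# → Hom R S f
    mkHom f cong +-homo *-homo -‿homo 0#-homo 1#-homo = record
      { isSemiringHomomorphism = record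
        { isNearSemiringHomomorphism = record
          { +-isMonoidHomomorphism = record
            { isMagmaHomomorphism = record
              { isRelHomomorphism = record { cong = cong }
              ; homo = +-homo }
            ; ε-homo = 0#-homo }
          ; *-homo = *-homo }
        ; 1#-homo = 1#-homo }
      ; -‿homo = -‿homo }

  module PowerSeries (R : CommutativeRing 0ℓ 0ℓ) where
    open CommutativeRing R hiding (zero)
    open RingProperties ring using (-0#≈0#)
    open SetoidReasoning setoid
    open CommutativeMonoidSolver +-commutativeMonoid using (solve; _⊕_; _⊜_)

    Series : Set
    Series = ℕ → Carrier

    infixl 7 _⊛_
    infix  4 _≋_

    _≋_ : Series → Series → Set
    f ≋ g = ∀ n → f n ≈ g n

    _⊛_ : Series → Series → Series
    (f ⊛ g) zero    = f 0 * g 0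
    (f ⊛ g) (suc n) = f 0 * g (suc n) + (f ∘ suc ⊛ g) n

    const# : Carrier → Series
    const# a zero    = a
    const# a (suc n) = 0#

    shift : Series → Series
    shift f zero    = 0#
    shift f (suc n) = f n

    ⊛-cong : ∀ {f g h k} → f ≋ g → h ≋ k → f ⊛ h ≋ g ⊛ k
    ⊛-cong f≋g h≋k zero    = *-cong (f≋g 0) (h≋k 0)
    ⊛-cong f≋g h≋k (suc n) = +-cong (*-cong (f≋g 0) (h≋k (suc n)))
      (⊛-cong (λ m → f≋g (suc m)) h≋k n)

    ⊛-distribʳ : ∀ h f g → (λ n → f n + g n) ⊛ h ≋ λ n → (f ⊛ h) n + (g ⊛ h) n
    ⊛-distribʳ h f g zero    = distribʳ (h 0) (f 0) (g 0)
    ⊛-distribʳ h f g (suc n) = trans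
      (+-cong (distribʳ _ _ _) (⊛-distribʳ h (f ∘ suc) (g ∘ suc) n))
      (solve 4 (λ a b c d → (a ⊕ b) ⊕ (c ⊕ d) ⊜ (a ⊕ c) ⊕ (b ⊕ d)) refl _ _ _ _)

    *-⊛ : ∀ a f g → (λ n → a * f n) ⊛ g ≋ λ n → a * (f ⊛ g) n
    *-⊛ a f g zero    = *-assoc _ _ _
    *-⊛ a f g (suc n) = trans (+-cong (*-assoc _ _ _) (*-⊛ a (f ∘ suc) g n)) (sym (distribˡ _ _ _))

    -- The definition peels `f 0` off the convolution; peeling `g 0` instead is the mirror image
    -- that commutativity compares it with.
    ⊛-suc : ∀ f g n → (f ⊛ g) (suc n) ≈ (f ⊛ g ∘ suc) n + f (suc n) * g 0
    ⊛-suc f g zero    = refl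
    ⊛-suc f g (suc n) = trans (+-congˡ (⊛-suc (f ∘ suc) g n)) (sym (+-assoc _ _ _))

    ⊛-comm : ∀ f g → f ⊛ g ≋ g ⊛ f
    ⊛-comm f g zero    = *-comm _ _
    ⊛-comm f g (suc n) = begin
      f 0 * g (suc n) + (f ∘ suc ⊛ g) n   ≈⟨ +-cong (*-comm _ _) (⊛-comm (f ∘ suc) g n) ⟩
      g (suc n) * f 0 + (g ⊛ f ∘ suc) n   ≈⟨ +-comm _ _ ⟩
      (g ⊛ f ∘ suc) n + g (suc n) * f 0   ≈⟨ ⊛-suc g f n ⟨
      (g ⊛ f) (suc n)                     ∎

    ⊛-assoc : ∀ f g h → (f ⊛ g) ⊛ h ≋ f ⊛ (g ⊛ h)
    ⊛-assoc f g h zero    = *-assoc _ _ _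
    ⊛-assoc f g h (suc n) = begin
      f 0 * g 0 * h (suc n) + ((λ m → f 0 * g (suc m) + (f ∘ suc ⊛ g) m) ⊛ h) n
        ≈⟨ +-cong (*-assoc _ _ _) (⊛-distribʳ h _ _ n) ⟩
      f 0 * (g 0 * h (suc n)) + (((λ m → f 0 * g (suc m)) ⊛ h) n + ((f ∘ suc ⊛ g) ⊛ h) n)
        ≈⟨ +-congˡ (+-cong (*-⊛ _ _ _ n) (⊛-assoc (f ∘ suc) g h n)) ⟩
      f 0 * (g 0 * h (suc n)) + (f 0 * (g ∘ suc ⊛ h) n + (f ∘ suc ⊛ (g ⊛ h)) n)
        ≈⟨ +-assoc _ _ _ ⟨
      f 0 * (g 0 * h (suc n)) + f 0 * (g ∘ suc ⊛ h) n + (f ∘ suc ⊛ (g ⊛ h)) n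
        ≈⟨ +-congʳ (distribˡ _ _ _) ⟨
      f 0 * (g ⊛ h) (suc n) + (f ∘ suc ⊛ (g ⊛ h)) n ∎

    0⊛ : ∀ f → (λ _ → 0#) ⊛ f ≋ λ _ → 0#
    0⊛ f zero    = zeroˡ _
    0⊛ f (suc n) = trans (+-cong (zeroˡ _) (0⊛ f n)) (+-identityˡ _)

    const#-⊛ : ∀ a f → const# a ⊛ f ≋ λ n → a * f n
    const#-⊛ a f zero    = refl
    const#-⊛ a f (suc n) = trans (+-congˡ (0⊛ f n)) (+-identityʳ _)

    shift-⊛ : ∀ f g → shift f ⊛ g ≋ shift (f ⊛ g)
    shift-⊛ f g zero    = zeroˡ _
    shift-⊛ f g (suc n) = trans (+-congʳ (zeroˡ _)) (+-identityˡ _)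

    1⊛ : ∀ f → const# 1# ⊛ f ≋ f
    1⊛ f n = trans (const#-⊛ 1# f n) (*-identityˡ _)

    seriesRing : CommutativeRing 0ℓ 0ℓ
    seriesRing = record
      { Carrier = Series
      ; _≈_ = _≋_
      ; _+_ = λ f g n → f n + g n
      ; _*_ = _⊛_
      ; -_ = λ f n → - f n
      ; 0# = λ _ → 0#
      ; 1# = const# 1#
      ; isCommutativeRing = record
        { isRing = record
          { +-isAbelianGroup = Pointwise.isAbelianGroup ℕ +-isAbelianGroup
          ; *-cong = ⊛-cong
          ; *-assoc = ⊛-assoc
          ; *-identity = 1⊛ , λ f n → trans (⊛-comm f _ n) (1⊛ f n)
          ; distrib = (λ f g h n → trans (⊛-comm f _ n) (trans (⊛-distribʳ f g h n)
              (+-cong (⊛-comm g f n) (⊛-comm h f n)))) , ⊛-distribʳ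
          }
        ; *-comm = ⊛-comm
        }
      }

    private module S = CommutativeRing seriesRing

    X# : Series
    X# = shift S.1#

    X#-⊛ : ∀ f → X# ⊛ f ≋ shift f
    X#-⊛ f zero    = zeroˡ _
    X#-⊛ f (suc n) = trans (shift-⊛ S.1# f (suc n)) (1⊛ f n)

    const#-homo : Hom rawRing S.rawRing const#
    const#-homo = mkHom const#
      (λ { x≈y zero → x≈y ; x≈y (suc n) → refl })
      (λ { x y zero → refl ; x y (suc n) → sym (+-identityˡ 0#) })
      (λ { x y zero → refl ; x y (suc n) → sym (trans (const#-⊛ x _ (suc n)) (zeroʳ x)) })
      (λ { x zero → refl ; x (suc n) → sym -0#≈0# })
      (λ { zero → refl ; (suc n) → refl })
      (λ { zero → refl ; (suc n) → refl })

    -- Evaluation of the variable at 0, used below to set u = 0 in the Gram determinant and x = 0 in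
    -- the characteristic series.
    head-homo : Hom S.rawRing rawRing (λ f → f 0)
    head-homo = mkHom _ (λ f≋g → f≋g 0) (λ _ _ → refl) (λ _ _ → refl) (λ _ → refl) refl refl

  module _ {R S : CommutativeRing 0ℓ 0ℓ} where
    private
      module R = CommutativeRing R
      module S = CommutativeRing S
      module R[] = PowerSeries R
      module S[] = PowerSeries S

    module _ {φ : R.Carrier → S.Carrier} (hom : Hom R.rawRing S.rawRing φ) where
      open RingMorphisms.IsRingHomomorphism hom

      map-homo : Hom (CommutativeRing.rawRing R[].seriesRing)
          (CommutativeRing.rawRing S[].seriesRing) (φ ∘_)
      map-homo = mkHom (φ ∘_) (λ f≋g n → ⟦⟧-cong (f≋g n)) (λ f g n → +-homo (f n) (g n)) ⊛-homo
        (λ f n → -‿homo (f n)) (λ _ → 0#-homo) λ { zero → 1#-homo ; (suc n) → 0#-homo }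
        where
        ⊛-homo : ∀ f g n → φ ((f R[].⊛ g) n) S.≈ ((φ ∘ f) S[].⊛ (φ ∘ g)) n
        ⊛-homo f g zero    = *-homo _ _
        ⊛-homo f g (suc n) = S.trans (+-homo _ _) (S.+-cong (*-homo _ _) (⊛-homo (f ∘ suc) g n))

  module _ {R : RawRing 0ℓ 0ℓ} (S : CommutativeRing 0ℓ 0ℓ) where
    private
      module R = RawRing R
      module S = CommutativeRing S
      module DR = Determinant R
      module DS = Determinant S.rawRing

    open import Algebra.Definitions.RawMonoid R.+-rawMonoid using () renaming (sum to sumR)
    open import Algebra.Definitions.RawMonoid S.+-rawMonoid using () renaming (sum to sumS)
    open Determinants S using (Det; Det≡det)

    module _ {φ : R.Carrier → S.Carrier} (hom : Hom R S.rawRing φ) where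
      open RingMorphisms.IsRingHomomorphism hom

      private
        sum-homo : ∀ {n} (f : Vector R.Carrier n) {g : Vector S.Carrier n} →
                   (∀ i → φ (f i) S.≈ g i) → φ (sumR f) S.≈ sumS g
        sum-homo {zero}  f φf≈g = 0#-homo
        sum-homo {suc n} f φf≈g = S.trans (+-homo _ _)
          (S.+-cong (φf≈g zero) (sum-homo (f ∘ suc) (φf≈g ∘ suc)))

        alternate-homo : ∀ k {x y} → φ x S.≈ y → φ (DR.alternate k x) S.≈ DS.alternate k y
        alternate-homo zero    φx≈y = φx≈y
        alternate-homo (suc k) φx≈y = S.trans (-‿homo _) (S.-‿cong (alternate-homo k φx≈y))

        det-homo : ∀ {n} (M : Matrix R.Carrier n) {N : Matrix S.Carrier n} →
                   (∀ i j → φ (M i j) S.≈ N i j) → φ (DR.det M) S.≈ DS.det N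
        det-homo {zero}  M φM≈N = 1#-homo
        det-homo {suc n} M φM≈N = sum-homo _ λ j → alternate-homo (toℕ j) (S.trans (*-homo _ _)
          (S.*-cong (φM≈N zero j) (det-homo _ λ i k → φM≈N (suc i) (punchIn j k))))

      -- The source R is only a raw ring, so that list polynomials qualify without a proof of the
      -- ring laws; their determinants are moved to series, where the theory is available.
      det-Det-homo : ∀ {n} (M : Matrix R.Carrier n) {N : Matrix S.Carrier n} →
                     (∀ i j → φ (M i j) S.≈ N i j) → φ (DR.det M) S.≈ Det N
      det-Det-homo M {N} φM≈N = S.trans (det-homo M φM≈N) (S.reflexive (≡.sym (Det≡det N)))

  module _ (R S : CommutativeRing 0ℓ 0ℓ) where
    private
      module R = CommutativeRing R
      module S = CommutativeRing S

    Det-homo : ∀ {φ : R.Carrier → S.Carrier} → Hom R.rawRing S.rawRing φ →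
               ∀ {n} (M : Matrix R.Carrier n) →
               φ (Determinants.Det R M) S.≈ Determinants.Det S (λ i j → φ (M i j))
    Det-homo {φ} hom M = S.trans (S.reflexive (≡.cong φ (Determinants.Det≡det R M)))
      (det-Det-homo S hom M λ i j → S.refl)

  module _ (R : CommutativeRing 0ℓ 0ℓ) where
    open CommutativeRing R hiding (zero)

    record Derivation : Set where
      field
        d       : Carrier → Carrier
        d-cong  : ∀ {x y} → x ≈ y → d x ≈ d y
        d-+     : ∀ x y → d (x + y) ≈ d x + d y
        leibniz : ∀ x y → d (x * y) ≈ d x * y + x * d y

  module Derivations (R : CommutativeRing 0ℓ 0ℓ) where
    open CommutativeRing R hiding (zero)
    open RingProperties ring
    open SetoidReasoning setoid
    open CommutativeMonoidMult +-commutativeMonoid using (_×_; ×-congʳ; ×-distrib-+)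
    open CommutativeMonoidSolver +-commutativeMonoid using (solve; _⊕_; _⊜_)
    open Determinants R
    open PowerSeries R

    module _ (D : Derivation R) where
      open Derivation D

      d-0 : d 0# ≈ 0#
      d-0 = +-identityʳ-unique (d 0#) (d 0#) (trans (sym (d-+ 0# 0#)) (d-cong (+-identityˡ 0#)))

      d-neg : ∀ x → d (- x) ≈ - d x
      d-neg x = +-inverseʳ-unique (d x) (d (- x)) (trans (sym (d-+ x (- x)))
          (trans (d-cong (-‿inverseʳ x)) d-0))

      d-1 : d 1# ≈ 0#
      d-1 = +-identityʳ-unique (d 1#) (d 1#) (sym (trans (d-cong (sym (*-identityˡ 1#)))
        (trans (leibniz 1# 1#) (+-cong (*-identityʳ _) (*-identityˡ _)))))

      d-sgn : ∀ k x → d (sgn k x) ≈ sgn k (d x)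
      d-sgn zero    x = trans (d-cong (sgn-zero x)) (sym (sgn-zero _))
      d-sgn (suc k) x = trans (d-cong (sgn-suc k x))
        (trans (d-neg _) (trans (-‿cong (d-sgn k x)) (sym (sgn-suc k _))))

      d-∑ : ∀ {n} (f : Vector Carrier n) → d (∑ f) ≈ ∑ (d ∘ f)
      d-∑ {zero}  f = trans (d-cong (∑-zero f)) (trans d-0 (sym (∑-zero _)))
      d-∑ {suc n} f = trans (d-cong (∑-suc f))
        (trans (d-+ _ _) (trans (+-congˡ (d-∑ (f ∘ suc))) (sym (∑-suc _))))

      -- The differentiated row is placed in front, ready for first-row expansion; the sign in
      -- `d-Det` pays for the move.
      rowDerivative : ∀ {n} → Matrix Carrier n → Fin n → Matrix Carrier n
      rowDerivative {suc n} M i = (d ∘ M i) ∷ removeAt M i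

      private
        DetRule : ℕ → Set
        DetRule n = ∀ (M : Matrix Carrier n) → d (Det M) ≈ ∑ λ i → sgn (toℕ i) (Det (rowDerivative M i))

        -- The terms where the derivation hits a minor. By the rule for order n the differentiated
        -- row heads the minor, so it is row 1 of the whole matrix; exchanging it with row 0 gives
        -- the sign of index i + 1.
        lower-rows : ∀ {n} → DetRule n → (M : Matrix Carrier (suc n)) →
          ∑ (λ j → sgn (toℕ j) (M zero j * d (Det (minor zero j M)))) ≈
          ∑ (λ i → sgn (suc (toℕ i)) (Det (rowDerivative M (suc i))))
        lower-rows {zero}  rule M = trans (∑-0 λ j → trans (sgn-cong (toℕ j)
          (trans (*-congˡ (trans (rule (minor zero j M)) (∑-zero _))) (zeroʳ _))) (sgn-0 (toℕ j)))
          (sym (∑-zero _))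
        lower-rows {suc n} rule M = begin
          ∑ (λ j → sgn (toℕ j) (M zero j * d (Det (minor zero j M))))
            ≈⟨ ∑-cong (λ j → sgn-cong (toℕ j) (trans (*-congˡ (rule (minor zero j M))) (*-∑ _ _))) ⟩
          ∑ (λ j → sgn (toℕ j) (∑ λ i → M zero j * sgn (toℕ i)
              (Det (rowDerivative (minor zero j M) i))))
            ≈⟨ ∑-cong (λ j → trans (sgn-∑ (toℕ j) _) (∑-cong λ i → trans
                 (sgn-cong (toℕ j) (sgn-*ʳ (toℕ i) _ _)) (sgn-comm (toℕ j) (toℕ i) _))) ⟩
          ∑ (λ j → ∑ λ i → sgn (toℕ i) (sgn (toℕ j) (M zero j * Det
              (rowDerivative (minor zero j M) i))))
            ≈⟨ ∑-comm _ ⟩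
          ∑ (λ i → ∑ λ j → sgn (toℕ i) (sgn (toℕ j) (M zero j * Det
              (rowDerivative (minor zero j M) i))))
            ≈⟨ ∑-cong (λ i → trans (sym (sgn-∑ (toℕ i) _)) (sgn-cong (toℕ i) (trans
                 (∑-cong λ j → sgn-cong (toℕ j) (*-congˡ (Det-cong-≡
                   λ { zero k → ≡.refl ; (suc a) k → ≡.refl })))
                 (sym (Det-suc (swapped i)))))) ⟩
          ∑ (λ i → sgn (toℕ i) (Det (swapped i)))
            ≈⟨ ∑-cong (λ i → trans (sgn-cong (toℕ i) (Det-swap-rows _ _ _))
                 (trans (sgn-neg (toℕ i) _) (trans (sym (sgn-suc _ _))
                   (sgn-cong (suc (toℕ i)) (Det-cong-≡
                     λ { zero k → ≡.refl ; (suc zero) k → ≡.refl ; (suc (suc a)) k → ≡.refl }))))) ⟩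
          ∑ (λ i → sgn (suc (toℕ i)) (Det (rowDerivative M (suc i)))) ∎
          where
          swapped : Fin (suc n) → Matrix Carrier (suc (suc n))
          swapped i = M zero ∷ (d ∘ M (suc i)) ∷ removeAt (M ∘ suc) i

      d-Det : ∀ {n} (M : Matrix Carrier n) →
              d (Det M) ≈ ∑ λ i → sgn (toℕ i) (Det (rowDerivative M i))
      d-Det {zero}  M = begin
        d (Det M)   ≈⟨ d-cong (Det-zero M) ⟩
        d 1#        ≈⟨ d-1 ⟩
        0#          ≈⟨ ∑-zero _ ⟨
        ∑ (λ i → sgn (toℕ i) (Det (rowDerivative M i))) ∎
      d-Det {suc n} M = begin
        d (Det M)
          ≈⟨ trans (d-cong (Det-suc M)) (trans (d-∑ _) (∑-cong λ j → trans (d-sgn (toℕ j) _)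
               (trans (sgn-cong (toℕ j) (leibniz _ _)) (sgn-+ (toℕ j) _ _)))) ⟩
        ∑ (λ j → sgn (toℕ j) (d (M zero j) * Det (minor zero j M))
               + sgn (toℕ j) (M zero j * d (Det (minor zero j M))))
          ≈⟨ ∑-+ _ _ ⟩
        ∑ (λ j → sgn (toℕ j) (d (M zero j) * Det (minor zero j M)))
          + ∑ (λ j → sgn (toℕ j) (M zero j * d (Det (minor zero j M))))
          ≈⟨ +-cong (trans (sym (Det-suc (rowDerivative M zero))) (sym (sgn-zero _)))
              (lower-rows d-Det M) ⟩
        sgn 0 (Det (rowDerivative M zero))
          + ∑ (λ i → sgn (suc (toℕ i)) (Det (rowDerivative M (suc i))))
          ≈⟨ ∑-suc _ ⟨
        ∑ (λ i → sgn (toℕ i) (Det (rowDerivative M i))) ∎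

      d-Det-0 : ∀ {n} (M : Matrix Carrier n) → (∀ i j → d (M i j) ≈ 0#) → d (Det M) ≈ 0#
      d-Det-0 {zero}  M dM≈0 = trans (d-Det M) (∑-zero _)
      d-Det-0 {suc n} M dM≈0 = trans (d-Det M) (∑-0 λ i → trans (sgn-cong (toℕ i) (trans (Det-suc _)
        (∑-0 λ j → trans (sgn-cong (toℕ j) (trans (*-congʳ (dM≈0 i j)) (zeroˡ _))) (sgn-0 (toℕ j)))))
        (sgn-0 (toℕ i)))

      -- Jacobi's formula when the entrywise derivative is the identity matrix: in the expansion of
      -- row i only column i survives, and its cofactor sign cancels the sign of moving that row to
      -- the front.
      d-Det-trace : ∀ {n} (M : Matrix Carrier (suc n)) →
        (∀ i → d (M i i) ≈ 1#) → (∀ i j → d (M i (punchIn i j)) ≈ 0#) →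
        d (Det M) ≈ ∑ λ i → Det (minor i i M)
      d-Det-trace M on off = trans (d-Det M) (∑-cong λ i → begin
        sgn (toℕ i) (Det (rowDerivative M i))
          ≈⟨ sgn-cong (toℕ i) (trans (Det-suc _) (∑-remove i _)) ⟩
        sgn (toℕ i) (sgn (toℕ i) (d (M i i) * Det (minor i i M))
          + ∑ (λ j → sgn (toℕ (punchIn i j)) (d (M i (punchIn i j)) * Det (minor i (punchIn i j) M))))
          ≈⟨ sgn-cong (toℕ i) (+-cong (sgn-cong (toℕ i) (trans (*-congʳ (on i)) (*-identityˡ _)))
               (∑-0 λ j → trans (sgn-cong (toℕ (punchIn i j)) (trans (*-congʳ (off i j)) (zeroˡ _)))
                   (sgn-0 _))) ⟩
        sgn (toℕ i) (sgn (toℕ i) (Det (minor i i M)) + 0#)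
          ≈⟨ trans (sgn-cong (toℕ i) (+-identityʳ _)) (sgn-involutive (toℕ i) _) ⟩
        Det (minor i i M) ∎)

    infixl 6 _+ᴰ_
    infixr 7 _*ᴰ_

    _+ᴰ_ : Derivation R → Derivation R → Derivation R
    D +ᴰ E = record
      { d       = λ x → D.d x + E.d x
      ; d-cong  = λ x≈y → +-cong (D.d-cong x≈y) (E.d-cong x≈y)
      ; d-+     = λ x y → trans (+-cong (D.d-+ x y) (E.d-+ x y))
          (solve 4 (λ a b c d → (a ⊕ b) ⊕ (c ⊕ d) ⊜ (a ⊕ c) ⊕ (b ⊕ d)) refl _ _ _ _)
      ; leibniz = λ x y → trans (+-cong (D.leibniz x y) (E.leibniz x y))
          (trans (solve 4 (λ a b c d → (a ⊕ b) ⊕ (c ⊕ d) ⊜ (a ⊕ c) ⊕ (b ⊕ d)) refl _ _ _ _)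
            (sym (+-cong (distribʳ _ _ _) (distribˡ _ _ _))))
      }
      where
      module D = Derivation D
      module E = Derivation E

    _*ᴰ_ : Carrier → Derivation R → Derivation R
    a *ᴰ D = record
      { d       = λ x → a * d x
      ; d-cong  = λ x≈y → *-congˡ (d-cong x≈y)
      ; d-+     = λ x y → trans (*-congˡ (d-+ x y)) (distribˡ _ _ _)
      ; leibniz = λ x y → trans (*-congˡ (leibniz x y)) (trans (distribˡ _ _ _)
          (+-cong (sym (*-assoc _ _ _)) (x∙yz≈y∙xz _ _ _)))
      }
      where
      open Derivation D
      open CommutativeSemigroupProperties *-commutativeSemigroup using (x∙yz≈y∙xz)

    coefficientwise : Derivation R → Derivation seriesRing
    coefficientwise D = record
      { d       = d ∘_
      ; d-cong  = λ f≋g n → d-cong (f≋g n)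
      ; d-+     = λ f g n → d-+ (f n) (g n)
      ; leibniz = ⊛-leibniz
      }
      where
      open Derivation D
      ⊛-leibniz : ∀ f g n → d ((f ⊛ g) n) ≈ ((d ∘ f) ⊛ g) n + (f ⊛ (d ∘ g)) n
      ⊛-leibniz f g zero    = leibniz _ _
      ⊛-leibniz f g (suc n) = trans (d-+ _ _)
        (trans (+-cong (leibniz _ _) (⊛-leibniz (f ∘ suc) g n))
          (solve 4 (λ a b c d → (a ⊕ b) ⊕ (c ⊕ d) ⊜ (a ⊕ c) ⊕ (b ⊕ d)) refl _ _ _ _))

    derivative : Series → Series
    derivative f n = suc n × f (suc n)

    ×-0 : ∀ m → m × 0# ≈ 0#
    ×-0 zero    = refl
    ×-0 (suc m) = trans (+-identityˡ _) (×-0 m)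

    derivative-const# : ∀ a → derivative (const# a) ≋ λ _ → 0#
    derivative-const# a n = ×-0 (suc n)

    derivative-X# : derivative X# ≋ const# 1#
    derivative-X# zero    = +-identityʳ 1#
    derivative-X# (suc n) = ×-0 (suc (suc n))

    coefficientwise-const# : ∀ (D : Derivation R) a →
      Derivation.d (coefficientwise D) (const# a) ≋ const# (Derivation.d D a)
    coefficientwise-const# D a zero    = refl
    coefficientwise-const# D a (suc n) = d-0 D

    formalDerivative : Derivation seriesRing
    formalDerivative = record
      { d       = derivative
      ; d-cong  = λ f≋g n → ×-congʳ (suc n) (f≋g (suc n))
      ; d-+     = λ f g n → ×-distrib-+ _ _ (suc n)
      ; leibniz = ⊛-leibniz
      }
      where
      ×-*ˡ : ∀ m x y → m × (x * y) ≈ x * (m × y)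
      ×-*ˡ zero    x y = sym (zeroʳ x)
      ×-*ˡ (suc m) x y = trans (+-congˡ (×-*ˡ m x y)) (sym (distribˡ x y _))
      -- With h = `f ∘ suc`, the series f is f 0 + x h and f′ = h + x h′. The product recurses
      -- through h, so the Leibniz rule is carried along this splitting.
      derivative-⊛ : ∀ f g n → (derivative f ⊛ g) (suc n)
                   ≈ (f ∘ suc ⊛ g) (suc n) + (derivative (f ∘ suc) ⊛ g) n
      derivative-⊛ f g n = begin
        (derivative f ⊛ g) (suc n)
          ≈⟨ ⊛-cong {derivative f} {λ m → f (suc m) + shift (derivative (f ∘ suc)) m} {g} {g}
               (λ { zero → refl ; (suc m) → refl }) (λ _ → refl) (suc n) ⟩
        ((λ m → f (suc m) + shift (derivative (f ∘ suc)) m) ⊛ g) (suc n)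
          ≈⟨ ⊛-distribʳ g (f ∘ suc) (shift (derivative (f ∘ suc))) (suc n) ⟩
        (f ∘ suc ⊛ g) (suc n) + (shift (derivative (f ∘ suc)) ⊛ g) (suc n)
          ≈⟨ +-congˡ (shift-⊛ (derivative (f ∘ suc)) g (suc n)) ⟩
        (f ∘ suc ⊛ g) (suc n) + (derivative (f ∘ suc) ⊛ g) n ∎
      ⊛-leibniz : ∀ f g n → derivative (f ⊛ g) n ≈ (derivative f ⊛ g) n + (f ⊛ derivative g) n
      ⊛-leibniz f g zero = begin
        f 0 * g 1 + f 1 * g 0 + 0#             ≈⟨ +-identityʳ _ ⟩
        f 0 * g 1 + f 1 * g 0                  ≈⟨ +-comm _ _ ⟩
        f 1 * g 0 + f 0 * g 1                  ≈⟨ +-cong (*-congʳ (+-identityʳ _))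
            (*-congˡ (+-identityʳ _)) ⟨
        (f 1 + 0#) * g 0 + f 0 * (g 1 + 0#)    ∎
      ⊛-leibniz f g (suc n) = begin
        f 0 * g (suc (suc n)) + (f ∘ suc ⊛ g) (suc n) + suc n ×
            (f 0 * g (suc (suc n)) + (f ∘ suc ⊛ g) (suc n))
          ≈⟨ +-congˡ (trans (×-distrib-+ _ _ (suc n)) (+-cong (×-*ˡ (suc n) _ _)
              (⊛-leibniz (f ∘ suc) g n))) ⟩
        f 0 * g (suc (suc n)) + (f ∘ suc ⊛ g) (suc n)
          + (f 0 * derivative (g ∘ suc) n + ((derivative (f ∘ suc) ⊛ g) n + (f ∘ suc ⊛ derivative g) n))
          ≈⟨ solve 5 (λ a b c d e → (a ⊕ b) ⊕ (c ⊕ (d ⊕ e)) ⊜ (b ⊕ d) ⊕ ((a ⊕ c) ⊕ e)) refl _ _ _ _ _ ⟩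
        (f ∘ suc ⊛ g) (suc n) + (derivative (f ∘ suc) ⊛ g) n
          + (f 0 * g (suc (suc n)) + f 0 * derivative (g ∘ suc) n + (f ∘ suc ⊛ derivative g) n)
          ≈⟨ +-cong (derivative-⊛ f g n) (+-congʳ (distribˡ _ _ _)) ⟨
        (derivative f ⊛ g) (suc n) + (f ⊛ derivative g) (suc n) ∎

-- Gram determinants of matrix pencils.

module GramDeterminants where

  open import Defs hiding (δ)
  open import Algebra.Bundles using (CommutativeRing)
  open import Algebra.Morphism.Structures using (module RingMorphisms)
  import Algebra.Properties.CommutativeMonoid.Mult as CommutativeMonoidMult
  import Algebra.Properties.Ring as RingProperties
  import Algebra.Solver.Ring.NaturalCoefficients.Default as RingSolver
  open import Data.Fin.Base using (Fin; zero; suc)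
  open import Data.Fin.Properties using (_≟_)
  open import Data.Nat.Base as ℕ using (ℕ; zero; suc; _!)
  open import Data.Vec.Functional using (Vector; _++_)
  open import Data.Vec.Functional.Properties using (lookup-++ˡ; lookup-++ʳ)
  open import Function.Base using (_∘_)
  open import Level using (0ℓ)
  import Relation.Binary.Reasoning.Setoid as SetoidReasoning
  open import Relation.Nullary using (yes; no)
  open DeterminantTheory
  open SeriesTheory

  module _ (R S : CommutativeRing 0ℓ 0ℓ) where
    private
      module R = CommutativeRing R
      module S = CommutativeRing S
      module DR = Determinants R
      module DS = Determinants S

    module _ {φ : R.Carrier → S.Carrier} (hom : Hom R.rawRing S.rawRing φ) where
      open RingMorphisms.IsRingHomomorphism hom

      ∑-homo : ∀ {n} (f : Vector R.Carrier n) → φ (DR.∑ f) S.≈ DS.∑ (φ ∘ f)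
      ∑-homo {zero}  f = S.trans (⟦⟧-cong (DR.∑-zero f)) (S.trans 0#-homo (S.sym (DS.∑-zero _)))
      ∑-homo {suc n} f = S.trans (⟦⟧-cong (DR.∑-suc f)) (S.trans (+-homo _ _)
        (S.trans (S.+-congˡ (∑-homo (f ∘ suc))) (S.sym (DS.∑-suc _))))

      ∏-homo : ∀ {n} (f : Vector R.Carrier n) → φ (DR.∏ f) S.≈ DS.∏ (φ ∘ f)
      ∏-homo {zero}  f = S.trans (⟦⟧-cong (DR.∏-zero f)) (S.trans 1#-homo (S.sym (DS.∏-zero _)))
      ∏-homo {suc n} f = S.trans (⟦⟧-cong (DR.∏-suc f)) (S.trans (*-homo _ _)
        (S.trans (S.*-congˡ (∏-homo (f ∘ suc))) (S.sym (DS.∏-suc _))))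

      𝟙-homo : ∀ {n} (i j : Fin n) → φ (DR.𝟙 i j) S.≈ DS.𝟙 i j
      𝟙-homo i j with i ≟ j
      ... | yes _ = 1#-homo
      ... | no  _ = 0#-homo

  -- (x + A)(y + A) + u depends only on x + y and xy + u, so it is annihilated
  -- by ∂x − ∂y + (x − y)∂u.
  module _ (R : CommutativeRing 0ℓ 0ℓ) where
    open CommutativeRing R hiding (zero)
    open RingProperties ring
    open Determinants R
    open Derivations R
    open SetoidReasoning setoid
    open RingSolver commutativeSemiring using (solve; _:+_; _:*_; _:=_)

    module _ {n} (x y u : Carrier) (a : Matrix Carrier n) (a-sym : ∀ i j → a i j ≈ a j i) where

      shiftedProduct : Matrix Carrier n
      shiftedProduct i j = ∑ (λ c → (x * 𝟙 i c + a i c) * (y * 𝟙 j c + a j c)) + ∑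
          (λ c → 𝟙 i c * (u * 𝟙 j c))

      shiftedProduct≈ : ∀ i j → shiftedProduct i j ≈
        (x * y + u) * 𝟙 i j + (x + y) * a i j + ∑ (λ c → a i c * a c j)
      shiftedProduct≈ i j = begin
        ∑ (λ c → (x * 𝟙 i c + a i c) * (y * 𝟙 j c + a j c)) + ∑ (λ c → 𝟙 i c * (u * 𝟙 j c))
          ≈⟨ +-cong (trans (∑-cong λ c → solve 6 (λ x y δ δ′ a a′ →
                 (x :* δ :+ a) :* (y :* δ′ :+ a′) :=
                 δ :* (x :* (y :* δ′ :+ a′)) :+ (δ′ :* (y :* a) :+ a :* a′))
                 refl x y (𝟙 i c) (𝟙 j c) (a i c) (a j c))
               (trans (∑-+ _ _) (+-cong (∑-𝟙 i _) (trans (∑-+ _ _) (+-congʳ (∑-𝟙 j _))))))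
               (∑-𝟙 i _) ⟩
        x * (y * 𝟙 j i + a j i) + (y * a i j + ∑ (λ c → a i c * a j c)) + u * 𝟙 j i
          ≈⟨ +-cong (+-cong (*-congˡ (+-cong (*-congˡ (𝟙-sym j i)) (a-sym j i)))
               (+-congˡ (∑-cong λ c → *-congˡ (a-sym j c)))) (*-congˡ (𝟙-sym j i)) ⟩
        x * (y * 𝟙 i j + a i j) + (y * a i j + ∑ (λ c → a i c * a c j)) + u * 𝟙 i j
          ≈⟨ solve 6 (λ x y u δ a s → x :* (y :* δ :+ a) :+ (y :* a :+ s) :+ u :* δ :=
               (x :* y :+ u) :* δ :+ (x :+ y) :* a :+ s) refl x y u (𝟙 i j) (a i j) _ ⟩
        (x * y + u) * 𝟙 i j + (x + y) * a i j + ∑ (λ c → a i c * a c j) ∎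
      module _ (D : Derivation R) where
        open Derivation D

        private
          d-*-0 : ∀ {p q} → d p ≈ 0# → d q ≈ 0# → d (p * q) ≈ 0#
          d-*-0 {p} {q} dp dq = trans (leibniz p q) (trans
            (+-cong (trans (*-congʳ dp) (zeroˡ _)) (trans (*-congˡ dq) (zeroʳ _))) (+-identityˡ 0#))

          d-+-0 : ∀ {p q} → d p ≈ 0# → d q ≈ 0# → d (p + q) ≈ 0#
          d-+-0 dp dq = trans (d-+ _ _) (trans (+-cong dp dq) (+-identityˡ 0#))

        d-Det-shiftedProduct : d x ≈ 1# → d y ≈ - 1# → d u ≈ x - y →
                               (∀ i j → d (a i j) ≈ 0#) → d (Det shiftedProduct) ≈ 0#
        d-Det-shiftedProduct dx dy du da = trans (d-cong (Det-cong shiftedProduct≈))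
          (d-Det-0 D _ λ i j → d-+-0 (d-+-0 (d-*-0 dxy+u (d𝟙 i j)) (d-*-0 dx+y (da i j)))
            (trans (d-∑ D _) (∑-0 λ c → d-*-0 (da i c) (da c j))))
          where
          d𝟙 : ∀ i j → d (𝟙 {n} i j) ≈ 0#
          d𝟙 = 𝟙-elim (λ z → d z ≈ 0#) (d-1 D) (d-0 D)
          dx+y : d (x + y) ≈ 0#
          dx+y = trans (d-+ x y) (trans (+-cong dx dy) (-‿inverseʳ 1#))
          -- This fixes the rate of u: the product xy contributes y - x, which `d u ≈ x - y`
          -- cancels.
          dxy+u : d (x * y + u) ≈ 0#
          dxy+u = begin
            d (x * y + u)                    ≈⟨ d-+ _ _ ⟩
            d (x * y) + d u                  ≈⟨ +-cong (leibniz x y) du ⟩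
            d x * y + x * d y + (x - y)      ≈⟨ +-congʳ (+-cong (trans (*-congʳ dx) (*-identityˡ y))
                                                  (trans (*-congˡ dy) (trans (sym
                                                      (-‿distribʳ-* _ _)) (-‿cong (*-identityʳ x))))) ⟩
            y - x + (x - y)                  ≈⟨ +-congʳ (+-comm y (- x)) ⟩
            - x + y + (x - y)                ≈⟨ +-congˡ (trans (+-comm x (- y))
                (sym (+-congˡ (-‿involutive x)))) ⟩
            - x + y + (- y - - x)            ≈⟨ +-congˡ (trans (-‿+-comm y (- x))
                (-‿cong (+-comm y (- x)))) ⟩
            - x + y - (- x + y)              ≈⟨ -‿inverseʳ _ ⟩
            0#                               ∎

  module Pencil (R : CommutativeRing 0ℓ 0ℓ) where
    open CommutativeRing R hiding (zero)
    open Determinants R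

    pencil : ∀ {n} → Carrier → Matrix Carrier n → Matrix Carrier n
    pencil X A i j = X * 𝟙 i j + A i j

    -- The columns of [ X + A | 1 ], weighted by 1 and X.
    columns : ∀ {n} → Carrier → Matrix Carrier n → Fin n → Vector Carrier (n ℕ.+ n)
    columns X A i = pencil X A i ++ 𝟙 i

    colWeight : ∀ {n} → Carrier → Vector Carrier (n ℕ.+ n)
    colWeight {n} X = (λ (_ : Fin n) → 1#) ++ (λ (_ : Fin n) → X)

  module Gram (R S : CommutativeRing 0ℓ 0ℓ) where
    private
      module R = CommutativeRing R
      module S = CommutativeRing S
      module DR = Determinants R
      module DS = Determinants S
    open Pencil R

    module _ {φx φy φu : R.Carrier → S.Carrier} (hx : Hom R.rawRing S.rawRing φx)
             (hy : Hom R.rawRing S.rawRing φy) (hu : Hom R.rawRing S.rawRing φu)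
             {n} (X : R.Carrier) (A : Matrix R.Carrier n) where
      private
        module Hx = RingMorphisms.IsRingHomomorphism hx
        module Hy = RingMorphisms.IsRingHomomorphism hy
        module Hu = RingMorphisms.IsRingHomomorphism hu

      -- One ring R with a variable X and three maps into S, meant to send X to x, y and u. A
      -- maximal minor is computed once over R, and its images under φx and φy are the two factors
      -- of its Cauchy-Binet term.
      gram : Matrix S.Carrier n
      gram i j = DS.∑ λ c → φx (columns X A i c) S.* (φu (colWeight {n} X c) S.* φy (columns X A j c))

      selected : Vector (Fin (n ℕ.+ n)) n → R.Carrier
      selected J = DR.Det λ i k → columns X A i (J k)

      open SetoidReasoning S.setoid
      open CommutativeMonoidMult S.+-commutativeMonoid using (_×_)

      gram-cauchyBinet : (n !) × DS.Det gram S.≈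
        DS.∑F n λ J → φx (selected J) S.* (φu (DR.weight (colWeight {n} X) J) S.* φy (selected J))
      gram-cauchyBinet = S.trans
        (DS.cauchyBinet (φu ∘ colWeight {n} X) (λ i → φx ∘ columns X A i) (λ i → φy ∘ columns X A i))
        (DS.∑F-cong n λ J → S.*-cong (S.sym (Det-homo R S hx _))
          (S.*-cong (S.sym (∏-homo R S hu _)) (S.sym (Det-homo R S hy _))))

      private
        gram-split : ∀ i j → gram i j S.≈
          DS.∑ (λ c → φx (pencil X A i c) S.* φy (pencil X A j c))
          S.+ DS.∑ (λ c → DS.𝟙 i c S.* (φu X S.* DS.𝟙 j c))
        gram-split i j = S.trans (DS.∑-++ n _) (S.+-cong
          (DS.∑-cong λ c → S.*-cong
            (Hx.⟦⟧-cong (R.reflexive (lookup-++ˡ (pencil X A i) (DR.𝟙 i) c)))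
            (S.trans (S.*-cong
              (S.trans (Hu.⟦⟧-cong (R.reflexive (lookup-++ˡ {m = n} {n = n} (λ _ → R.1#)
                  (λ _ → X) c))) Hu.1#-homo)
              (Hy.⟦⟧-cong (R.reflexive (lookup-++ˡ (pencil X A j) (DR.𝟙 j) c))))
              (S.*-identityˡ _)))
          (DS.∑-cong λ c → S.*-cong
            (S.trans (Hx.⟦⟧-cong (R.reflexive (lookup-++ʳ (pencil X A i) (DR.𝟙 i) c)))
                (𝟙-homo R S hx i c))
            (S.*-cong
              (Hu.⟦⟧-cong (R.reflexive (lookup-++ʳ {m = n} {n = n} (λ _ → R.1#) (λ _ → X) c)))
              (S.trans (Hy.⟦⟧-cong (R.reflexive (lookup-++ʳ (pencil X A j) (DR.𝟙 j) c)))
                  (𝟙-homo R S hy j c)))))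

      gram-u≈0 : φu X S.≈ S.0# →
        DS.Det gram S.≈ φx (DR.Det (pencil X A)) S.* φy (DR.Det (pencil X A))
      gram-u≈0 u≈0 = begin
        DS.Det gram
          ≈⟨ DS.Det-cong (λ i j → S.trans (gram-split i j) (S.trans (S.+-congˡ (DS.∑-0 λ c →
               S.trans (S.*-congˡ (S.trans (S.*-congʳ u≈0) (S.zeroˡ _))) (S.zeroʳ _)))
                   (S.+-identityʳ _))) ⟩
        DS.Det (λ i j → DS.∑ λ c → φx (pencil X A i c) S.* φy (pencil X A j c))
          ≈⟨ DS.Det-* (λ i c → φx (pencil X A i c)) (λ c j → φy (pencil X A j c)) ⟩
        DS.Det (λ i c → φx (pencil X A i c)) S.* DS.Det (λ c j → φy (pencil X A j c))
          ≈⟨ S.*-cong (S.sym (Det-homo R S hx _))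
               (S.trans (DS.Det-transpose (λ j c → φy (pencil X A j c))) (S.sym (Det-homo R S hy _))) ⟩
        φx (DR.Det (pencil X A)) S.* φy (DR.Det (pencil X A)) ∎

      module _ (A-sym : ∀ i j → A i j R.≈ A j i) (A-const : ∀ i j → φy (A i j) S.≈ φx (A i j)) where

        d-Det-gram : ∀ (D : Derivation S) → let open Derivation D in
          d (φx X) S.≈ S.1# → d (φy X) S.≈ S.- S.1# → d (φu X) S.≈ φx X S.- φy X →
          (∀ i j → d (φx (A i j)) S.≈ S.0#) → d (DS.Det gram) S.≈ S.0#
        d-Det-gram D dx dy du dA = S.trans (d-cong (DS.Det-cong λ i j →
          S.trans (gram-split i j) (S.+-congʳ (DS.∑-cong λ c → S.*-cong
            (S.trans (Hx.+-homo _ _) (S.+-congʳ (S.trans (Hx.*-homo _ _)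
                (S.*-congˡ (𝟙-homo R S hx i c)))))
            (S.trans (Hy.+-homo _ _) (S.+-cong (S.trans (Hy.*-homo _ _) (S.*-congˡ (𝟙-homo R S hy j c)))
              (A-const j c)))))))
          (d-Det-shiftedProduct S _ _ _ _ (λ i j → Hx.⟦⟧-cong (A-sym i j)) D dx dy du dA)
          where open Derivation D

-- Log-concavity of the characteristic series of a symmetric matrix.

module CharacteristicSeries where

  open import Defs hiding (δ)
  open import Algebra.Bundles using (CommutativeRing)
  open import Algebra.Morphism.Structures using (module RingMorphisms)
  open import Algebra.Morphism.Construct.Composition using (isRingHomomorphism)
  import Algebra.Properties.CommutativeMonoid.Mult as CommutativeMonoidMult
  import Algebra.Properties.Ring as RingProperties
  open import Data.Fin.Base using (Fin; zero; suc; splitAt)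
  open import Data.Integer.Base as ℤ using (ℤ; +_; 0ℤ; 1ℤ)
  import Data.Integer.Properties as ℤ
  open import Data.Integer.Tactic.RingSolver using (solve-∀)
  open import Data.Nat.Base as ℕ using (ℕ; zero; suc; _!)
  import Data.Nat.Properties as ℕ
  open import Data.Sum.Base using (inj₁; inj₂)
  open import Data.Vec.Functional using (Vector; []; _∷_; _++_)
  open import Function.Base using (_∘_)
  open import Level using (0ℓ)
  open import Relation.Binary.PropositionalEquality as ≡ using (_≡_)
  open DeterminantTheory
  open SeriesTheory
  open GramDeterminants

  ℤ-ring : CommutativeRing 0ℓ 0ℓ
  ℤ-ring = ℤ.+-*-commutativeRing

  module P₁ = PowerSeries ℤ-ring
  ℤ⟦x⟧ : CommutativeRing 0ℓ 0ℓ
  ℤ⟦x⟧ = P₁.seriesRing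

  module P₂ = PowerSeries ℤ⟦x⟧
  ℤ⟦x,y⟧ : CommutativeRing 0ℓ 0ℓ
  ℤ⟦x,y⟧ = P₂.seriesRing

  module P₃ = PowerSeries ℤ⟦x,y⟧
  ℤ⟦x,y,u⟧ : CommutativeRing 0ℓ 0ℓ
  ℤ⟦x,y,u⟧ = P₃.seriesRing

  module R₁ = CommutativeRing ℤ⟦x⟧
  module R₂ = CommutativeRing ℤ⟦x,y⟧
  module R₃ = CommutativeRing ℤ⟦x,y,u⟧
  module D₀ = Determinants ℤ-ring
  module D₁ = Determinants ℤ⟦x⟧
  module D₂ = Determinants ℤ⟦x,y⟧
  module D₃ = Determinants ℤ⟦x,y,u⟧
  open CommutativeMonoidMult (CommutativeRing.+-commutativeMonoid ℤ-ring) using (_×_)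

  -- In F : R₃.Carrier the coefficient of u^s y^l x^k is F s l k.
  ιx ιy ιu : R₁.Carrier → R₃.Carrier
  ιx = P₃.const# ∘ P₂.const#
  ιy = P₃.const# ∘ (P₁.const# ∘_)
  ιu = (P₂.const# ∘ P₁.const#) ∘_

  ιx-homo : Hom R₁.rawRing R₃.rawRing ιx
  ιx-homo = isRingHomomorphism R₃.trans P₂.const#-homo P₃.const#-homo

  map-const-homo : Hom R₁.rawRing R₂.rawRing (P₁.const# ∘_)
  map-const-homo = map-homo P₁.const#-homo

  ιy-homo : Hom R₁.rawRing R₃.rawRing ιy
  ιy-homo = isRingHomomorphism R₃.trans map-const-homo P₃.const#-homo

  ιu-homo : Hom R₁.rawRing R₃.rawRing ιu
  ιu-homo = map-homo (isRingHomomorphism R₂.trans P₁.const#-homo P₂.const#-homo)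

  map-const-X# : (P₁.const# ∘ P₁.X#) R₂.≈ P₂.X#
  map-const-X# zero    zero    = ≡.refl
  map-const-X# zero    (suc k) = ≡.refl
  map-const-X# (suc zero)    k = ≡.refl
  map-const-X# (suc (suc l)) zero    = ≡.refl
  map-const-X# (suc (suc l)) (suc k) = ≡.refl

  ∂x ∂y ∂u ∂ : Derivation ℤ⟦x,y,u⟧
  ∂x = Derivations.coefficientwise ℤ⟦x,y⟧ (Derivations.coefficientwise ℤ⟦x⟧
      (Derivations.formalDerivative ℤ-ring))
  ∂y = Derivations.coefficientwise ℤ⟦x,y⟧ (Derivations.formalDerivative ℤ⟦x⟧)
  ∂u = Derivations.formalDerivative ℤ⟦x,y⟧
  ∂ = ∂x +ᴰ (R₃.- R₃.1#) *ᴰ ∂y +ᴰ (ιx P₁.X# R₃.- ιy P₁.X#) *ᴰ ∂u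
    where open Derivations ℤ⟦x,y,u⟧ using (_+ᴰ_; _*ᴰ_)

  0≤*+ : ∀ m {z} → 0ℤ ℤ.≤ z → 0ℤ ℤ.≤ m × z
  0≤*+ zero    0≤z = ℤ.≤-refl
  0≤*+ (suc m) 0≤z = ℤ.+-mono-≤ 0≤z (0≤*+ m 0≤z)

  ×≡* : ∀ m z → m × z ≡ + m ℤ.* z
  ×≡* zero    z = ≡.refl
  ×≡* (suc m) z = ≡.trans (≡.cong (ℤ._+_ z) (×≡* m z)) (≡.sym (ℤ.suc-* (+ m) z))

  0≤-×-cancel : ∀ m z .{{_ : ℕ.NonZero m}} → 0ℤ ℤ.≤ m × z → 0ℤ ℤ.≤ z
  0≤-×-cancel (suc m) z 0≤ = ℤ.*-cancelˡ-≤-pos 0ℤ z (+ suc m)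
    (≡.subst₂ ℤ._≤_ (≡.sym (ℤ.*-zeroʳ (+ suc m))) (×≡* (suc m) z) 0≤)

  module LogConcavityRecursion (F : R₃.Carrier) where

    -- The quantity L of the overview. At k = 0 the subtracted coefficient would have x-exponent -1,
    -- so it is dropped.
    lc : ℕ → ℕ → ℤ
    lc s zero    = F s 0 0
    lc s (suc k) = F s (suc k) (suc k) ℤ.- F s (suc (suc k)) k

    private
      module M₁ = CommutativeMonoidMult R₁.+-commutativeMonoid
      module M₂ = CommutativeMonoidMult R₂.+-commutativeMonoid

      ×₁-coefficient : ∀ m f k → (m M₁.× f) k ≡ m × f k
      ×₁-coefficient zero    f k = ≡.refl
      ×₁-coefficient (suc m) f k = ≡.cong (ℤ._+_ (f k)) (×₁-coefficient m f k)

      ×₂-coefficient : ∀ m f l k → (m M₂.× f) l k ≡ m × f l k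
      ×₂-coefficient zero    f l k = ≡.refl
      ×₂-coefficient (suc m) f l k = ≡.cong (ℤ._+_ (f l k)) (×₂-coefficient m f l k)

      x*-coefficient : ∀ G s l k → (ιx P₁.X# R₃.* G) s l k ≡ P₁.shift (G s l) k
      x*-coefficient G s l k = ≡.trans (P₃.const#-⊛ (P₂.const# P₁.X#) G s l k)
        (≡.trans (P₂.const#-⊛ P₁.X# (G s) l k) (P₁.X#-⊛ (G s l) k))

      y*-coefficient : ∀ G s l k → (ιy P₁.X# R₃.* G) s l k ≡ P₂.shift (G s) l k
      y*-coefficient G s l k = ≡.trans (P₃.const#-⊛ (P₁.const# ∘ P₁.X#) G s l k)
        (≡.trans (P₂.⊛-cong {P₁.const# ∘ P₁.X#} {P₂.X#} {G s} {G s} map-const-X# (λ _ _ → ≡.refl) l k)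
          (P₂.X#-⊛ (G s) l k))

    module _ (∂F≈0 : Derivation.d ∂ F R₃.≈ R₃.0#) where

      -- The coefficient of u^s y^l x^k in ∂F. The two shifts come from multiplying ∂u F by x and by
      -- y.
      coefficients : ∀ s l k → suc k × F s l (suc k) ℤ.- suc l × F s (suc l) k
        ℤ.+ (P₁.shift (λ k → suc s × F (suc s) l k) k ℤ.- P₂.shift
            (λ l k → suc s × F (suc s) l k) l k) ≡ 0ℤ
      coefficients s l k = ≡.trans (≡.sym (≡.cong₂ ℤ._+_
        (≡.cong (ℤ._+_ (suc k × F s l (suc k))) -∂y) [x-y]∂u)) (∂F≈0 s l k)
        where
        open RingProperties R₃.ring using (-1*x≈-x; [y-z]x≈yx-zx)
        -∂y : ((R₃.- R₃.1#) R₃.* Derivation.d ∂y F) s l k ≡ ℤ.- (suc l × F s (suc l) k)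
        -∂y = ≡.trans (-1*x≈-x (Derivation.d ∂y F) s l k) (≡.cong (ℤ.-_)
            (×₁-coefficient (suc l) (F s (suc l)) k))
        G : R₃.Carrier
        G = Derivation.d ∂u F
        G-coefficient : ∀ l k → G s l k ≡ suc s × F (suc s) l k
        G-coefficient l k = ×₂-coefficient (suc s) (F (suc s)) l k
        shift₁ : ∀ k → P₁.shift (G s l) k ≡ P₁.shift (λ k → suc s × F (suc s) l k) k
        shift₁ zero    = ≡.refl
        shift₁ (suc k) = G-coefficient l k
        shift₂ : ∀ l → P₂.shift (G s) l k ≡ P₂.shift (λ l k → suc s × F (suc s) l k) l k
        shift₂ zero    = ≡.refl
        shift₂ (suc l) = G-coefficient l k
        [x-y]∂u : ((ιx P₁.X# R₃.- ιy P₁.X#) R₃.* G) s l k ≡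
          P₁.shift (λ k → suc s × F (suc s) l k) k ℤ.- P₂.shift (λ l k → suc s × F (suc s) l k) l k
        [x-y]∂u = ≡.trans ([y-z]x≈yx-zx G (ιx P₁.X#) (ιy P₁.X#) s l k)
          (≡.cong₂ (λ p q → p ℤ.- q) (≡.trans (x*-coefficient G s l k) (shift₁ k))
            (≡.trans (y*-coefficient G s l k) (shift₂ l)))

      private
        -- With K = k + 1 and S = s + 1 the last bracket is the left side of
        -- `coefficients s (suc k) k`, hence zero.
        rearrange : ∀ K a b S c e → (1ℤ ℤ.+ K) ℤ.* (a ℤ.- b) ≡
          a ℤ.+ S ℤ.* (c ℤ.- e) ℤ.+ (K ℤ.* a ℤ.- (1ℤ ℤ.+ K) ℤ.* b ℤ.+ (S ℤ.* e ℤ.- S ℤ.* c))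
        rearrange = solve-∀

        next : ℕ → ℕ → ℤ
        next s zero    = 0ℤ
        next s (suc k) = F s (suc (suc k)) k

        lc≡ : ∀ s k → lc s k ≡ F s k k ℤ.- next s k
        lc≡ s zero    = ≡.sym (ℤ.+-identityʳ _)
        lc≡ s (suc k) = ≡.refl

        shift≡ : ∀ s k → P₁.shift (λ m → suc s × F (suc s) (suc k) m) k ≡ + suc s ℤ.* next (suc s) k
        shift≡ s zero    = ≡.sym (ℤ.*-zeroʳ (+ suc s))
        shift≡ s (suc k) = ×≡* (suc s) _

      -- The coefficient relation is read one step off the diagonal, at l = k + 1. It weighs the
      -- diagonal coefficient by k + 1 and its neighbour by k + 2; adding the diagonal coefficient
      -- once more evens the weights.
      lc-recursion : ∀ s k → suc (suc k) × lc s (suc k) ≡ F s (suc k) (suc k) ℤ.+ suc s × lc (suc s) k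
      lc-recursion s k = begin
        suc (suc k) × (a ℤ.- b)
          ≡⟨ ×≡* (suc (suc k)) _ ⟩
        + suc (suc k) ℤ.* (a ℤ.- b)
          ≡⟨ rearrange (+ suc k) a b (+ suc s) (F (suc s) k k) (next (suc s) k) ⟩
        a ℤ.+ + suc s ℤ.* (F (suc s) k k ℤ.- next (suc s) k) ℤ.+ E
          ≡⟨ ≡.cong₂ ℤ._+_ (≡.cong (ℤ._+_ a) (≡.trans (≡.cong (ℤ._*_ (+ suc s)) (≡.sym (lc≡ (suc s) k)))
               (≡.sym (×≡* (suc s) _)))) E≡0 ⟩
        a ℤ.+ suc s × lc (suc s) k ℤ.+ 0ℤ
          ≡⟨ ℤ.+-identityʳ _ ⟩
        a ℤ.+ suc s × lc (suc s) k ∎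
        where
        open ≡.≡-Reasoning
        a b E : ℤ
        a = F s (suc k) (suc k)
        b = F s (suc (suc k)) k
        E = + suc k ℤ.* a ℤ.- + suc (suc k) ℤ.* b ℤ.+ (+ suc s ℤ.* next (suc s) k ℤ.- + suc s ℤ.* F
            (suc s) k k)
        E≡0 : E ≡ 0ℤ
        E≡0 = ≡.trans (≡.cong₂ ℤ._+_
            (≡.cong₂ ℤ._-_ (≡.sym (×≡* (suc k) a)) (≡.sym (×≡* (suc (suc k)) b)))
            (≡.cong₂ ℤ._-_ (≡.sym (shift≡ s k)) (≡.sym (×≡* (suc s) (F (suc s) k k)))))
          (coefficients s (suc k) k)

      lc≥0 : (∀ s k → 0ℤ ℤ.≤ F s k k) → ∀ k s → 0ℤ ℤ.≤ lc s k
      lc≥0 F≥0 zero    s = F≥0 s 0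
      lc≥0 F≥0 (suc k) s = 0≤-×-cancel (suc (suc k)) _ (≡.subst (0ℤ ℤ.≤_) (≡.sym (lc-recursion s k))
        (ℤ.+-mono-≤ (F≥0 s (suc k)) (0≤*+ (suc s) (lc≥0 F≥0 k (suc s)))))

  0≤i*i : ∀ i → 0ℤ ℤ.≤ i ℤ.* i
  0≤i*i (+ n)        = ≡.subst (0ℤ ℤ.≤_) (ℤ.pos-* n n) (ℤ.+≤+ ℕ.z≤n)
  0≤i*i ℤ.-[1+ n ]   = ℤ.+≤+ ℕ.z≤n

  0≤i*j : ∀ {i j} → 0ℤ ℤ.≤ i → 0ℤ ℤ.≤ j → 0ℤ ℤ.≤ i ℤ.* j
  0≤i*j {i} {j} 0≤i 0≤j = ≡.subst (ℤ._≤ i ℤ.* j) (ℤ.*-zeroʳ i)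
    (ℤ.*-monoˡ-≤-nonNeg i {{ℤ.nonNegative 0≤i}} 0≤j)

  module _ {n} (A : Matrix ℤ n) where
    open Pencil ℤ⟦x⟧
    open Gram ℤ⟦x⟧ ℤ⟦x,y,u⟧

    charMatrix : Matrix R₁.Carrier n
    charMatrix = pencil P₁.X# (λ i j → P₁.const# (A i j))

    charSeries : ℕ → ℤ
    charSeries = D₁.Det charMatrix

    private
      C : Matrix R₁.Carrier n
      C i j = P₁.const# (A i j)

      Φ : R₃.Carrier
      Φ = D₃.Det (gram ιx-homo ιy-homo ιu-homo P₁.X# C)

      ιy-const : ∀ z → ιy (P₁.const# z) R₃.≈ ιx (P₁.const# z)
      ιy-const z = RingMorphisms.IsRingHomomorphism.⟦⟧-cong P₃.const#-homo
        {P₁.const# ∘ P₁.const# z} {P₂.const# (P₁.const# z)}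
        λ { zero k → ≡.refl ; (suc l) zero → ≡.refl ; (suc l) (suc k) → ≡.refl }

      ∂-sum : ∀ F {p q r} → Derivation.d ∂x F R₃.≈ p → Derivation.d ∂y F R₃.≈ q → Derivation.d ∂u F
          R₃.≈ r →
        Derivation.d ∂ F R₃.≈ p R₃.- q R₃.+ (ιx P₁.X# R₃.- ιy P₁.X#) R₃.* r
      ∂-sum F {p} {q} {r} ≈p ≈q ≈r = R₃.+-cong (R₃.+-cong ≈p (R₃.trans
        (R₃.*-congˡ {R₃.- R₃.1#} ≈q) (-1*x≈-x q))) (R₃.*-congˡ {ιx P₁.X# R₃.- ιy P₁.X#} ≈r)
        where open RingProperties R₃.ring using (-1*x≈-x)

      module C₂ = RingMorphisms.IsRingHomomorphism P₂.const#-homo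
      module C₃ = RingMorphisms.IsRingHomomorphism P₃.const#-homo
      module V₀ = Derivations ℤ-ring
      module V₁ = Derivations ℤ⟦x⟧
      module V₂ = Derivations ℤ⟦x,y⟧

      x-y : R₃.Carrier
      x-y = ιx P₁.X# R₃.- ιy P₁.X#

      ∂x-ιx : ∀ f g → V₀.derivative f R₁.≈ g → Derivation.d ∂x (ιx f) R₃.≈ ιx g
      ∂x-ιx f g f′≈g = R₃.trans
        (V₂.coefficientwise-const# (V₁.coefficientwise V₀.formalDerivative) (P₂.const# f))
        (C₃.⟦⟧-cong (R₂.trans (V₁.coefficientwise-const# V₀.formalDerivative f) (C₂.⟦⟧-cong f′≈g)))

      ∂y-ιx : ∀ f → Derivation.d ∂y (ιx f) R₃.≈ R₃.0#
      ∂y-ιx f = R₃.trans (V₂.coefficientwise-const# V₁.formalDerivative (P₂.const# f))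
        (R₃.trans (C₃.⟦⟧-cong (V₁.derivative-const# f)) C₃.0#-homo)

      ∂u-const : ∀ f → Derivation.d ∂u (P₃.const# f) R₃.≈ R₃.0#
      ∂u-const f = V₂.derivative-const# f

      ∂x-ιy : ∀ f → Derivation.d ∂x (ιy f) R₃.≈ R₃.0#
      ∂x-ιy f = R₃.trans
        (V₂.coefficientwise-const# (V₁.coefficientwise V₀.formalDerivative) (P₁.const# ∘ f))
        (R₃.trans (C₃.⟦⟧-cong (λ l → V₀.derivative-const# (f l))) C₃.0#-homo)

      ∂y-ιy : Derivation.d ∂y (ιy P₁.X#) R₃.≈ R₃.1#
      ∂y-ιy = R₃.trans (V₂.coefficientwise-const# V₁.formalDerivative (P₁.const# ∘ P₁.X#))
        (C₃.⟦⟧-cong (R₂.trans (Derivation.d-cong V₁.formalDerivative map-const-X#) V₁.derivative-X#))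

      ∂x-ιu : ∀ f → Derivation.d ∂x (ιu f) R₃.≈ R₃.0#
      ∂x-ιu f s = R₂.trans (V₁.coefficientwise-const# V₀.formalDerivative (P₁.const# (f s)))
        (R₂.trans (C₂.⟦⟧-cong (V₀.derivative-const# (f s))) C₂.0#-homo)

      ∂y-ιu : ∀ f → Derivation.d ∂y (ιu f) R₃.≈ R₃.0#
      ∂y-ιu f s = V₁.derivative-const# (P₁.const# (f s))

      ∂u-ιu : Derivation.d ∂u (ιu P₁.X#) R₃.≈ R₃.1#
      ∂u-ιu = R₃.trans (Derivation.d-cong V₂.formalDerivative ιu-X#) V₂.derivative-X#
        where
        module Hc = RingMorphisms.IsRingHomomorphism
            (isRingHomomorphism R₂.trans P₁.const#-homo P₂.const#-homo)
        ιu-X# : ιu P₁.X# R₃.≈ P₃.X#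
        ιu-X# zero          = Hc.0#-homo
        ιu-X# (suc zero)    = Hc.1#-homo
        ιu-X# (suc (suc s)) = Hc.0#-homo

      open RingProperties R₃.ring using (-0#≈0#)

      p-0+q0 : ∀ p q → p R₃.- R₃.0# R₃.+ q R₃.* R₃.0# R₃.≈ p
      p-0+q0 p q = R₃.trans (R₃.+-cong {p R₃.- R₃.0#} {p}
        (R₃.trans (R₃.+-congˡ {p} -0#≈0#) (R₃.+-identityʳ p)) (R₃.zeroʳ q)) (R₃.+-identityʳ p)

      ∂x≈1 : Derivation.d ∂ (ιx P₁.X#) R₃.≈ R₃.1#
      ∂x≈1 = R₃.trans (∂-sum (ιx P₁.X#) (∂x-ιx P₁.X# R₁.1# V₀.derivative-X#) (∂y-ιx P₁.X#)
        (∂u-const (P₂.const# P₁.X#))) (p-0+q0 R₃.1# x-y)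

      ∂y≈-1 : Derivation.d ∂ (ιy P₁.X#) R₃.≈ R₃.- R₃.1#
      ∂y≈-1 = R₃.trans (∂-sum (ιy P₁.X#) (∂x-ιy P₁.X#) ∂y-ιy (∂u-const (P₁.const# ∘ P₁.X#)))
        (R₃.trans (R₃.+-cong {R₃.0# R₃.- R₃.1#} (R₃.+-identityˡ (R₃.- R₃.1#)) (R₃.zeroʳ x-y))
            (R₃.+-identityʳ (R₃.- R₃.1#)))

      ∂u≈x-y : Derivation.d ∂ (ιu P₁.X#) R₃.≈ x-y
      ∂u≈x-y = R₃.trans (∂-sum (ιu P₁.X#) (∂x-ιu P₁.X#) (∂y-ιu P₁.X#) ∂u-ιu)
        (R₃.trans (R₃.+-cong {R₃.0# R₃.- R₃.0#} (R₃.-‿inverseʳ R₃.0#) (R₃.*-identityʳ x-y))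
            (R₃.+-identityˡ x-y))

      ∂A≈0 : ∀ z → Derivation.d ∂ (ιx (P₁.const# z)) R₃.≈ R₃.0#
      ∂A≈0 z = R₃.trans (∂-sum (ιx (P₁.const# z))
        (R₃.trans (∂x-ιx (P₁.const# z) R₁.0# (V₀.derivative-const# z))
            (RingMorphisms.IsRingHomomorphism.0#-homo ιx-homo))
        (∂y-ιx (P₁.const# z)) (∂u-const (P₂.const# (P₁.const# z)))) (p-0+q0 R₃.0# x-y)

    module _ (A-sym : ∀ i j → A i j ≡ A j i) where
      private
        ∂Φ≈0 : Derivation.d ∂ Φ R₃.≈ R₃.0#
        ∂Φ≈0 = d-Det-gram ιx-homo ιy-homo ιu-homo P₁.X# C
          (λ i j → R₁.reflexive (≡.cong P₁.const# (A-sym i j))) (λ i j → ιy-const (A i j))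
          ∂ ∂x≈1 ∂y≈-1 ∂u≈x-y (λ i j → ∂A≈0 (A i j))

        -- The three variables separate. For f = h and l = k the value is `g s` times a square,
        -- which is why nonnegativity is claimed for equal exponents of x and y.
        coefficient : ∀ f g h s l k → (ιx f R₃.* (ιu g R₃.* ιy h)) s l k ≡ (g s ℤ.* h l) ℤ.* f k
        coefficient f g h s l k = begin
          (ιx f R₃.* G) s l k
            ≡⟨ ≡.trans (P₃.const#-⊛ (P₂.const# f) G s l k) (P₂.const#-⊛ f (G s) l k) ⟩
          (f P₁.⊛ G s l) k
            ≡⟨ P₁.⊛-comm f (G s l) k ⟩
          (G s l P₁.⊛ f) k
            ≡⟨ P₁.⊛-cong {G s l} {P₁.const# (g s ℤ.* h l)} {f} {f} G≈ (λ _ → ≡.refl) k ⟩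
          (P₁.const# (g s ℤ.* h l) P₁.⊛ f) k
            ≡⟨ P₁.const#-⊛ (g s ℤ.* h l) f k ⟩
          (g s ℤ.* h l) ℤ.* f k ∎
          where
          open ≡.≡-Reasoning
          G : R₃.Carrier
          G = ιu g R₃.* ιy h
          gₛ : R₁.Carrier
          gₛ = P₁.const# (g s)
          G≈ : G s l R₁.≈ P₁.const# (g s ℤ.* h l)
          G≈ = R₁.trans (R₃.*-comm (ιu g) (ιy h) s l)
            (R₁.trans (P₃.const#-⊛ (P₁.const# ∘ h) (ιu g) s l)
            (R₁.trans (R₂.*-comm (P₁.const# ∘ h) (P₂.const# gₛ) l)
            (R₁.trans (P₂.const#-⊛ gₛ (P₁.const# ∘ h) l)
            (R₁.sym (RingMorphisms.IsRingHomomorphism.*-homo P₁.const#-homo (g s) (h l))))))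

        weight≥0 : ∀ (J : Vector (Fin (n ℕ.+ n)) n) s → 0ℤ ℤ.≤ D₁.weight (colWeight {n} P₁.X#) J s
        weight≥0 J = ∏≥0 (λ i → colWeight {n} P₁.X# (J i)) λ i → colWeight≥0 (J i)
          where
          ⊛≥0 : ∀ f g → (∀ k → 0ℤ ℤ.≤ f k) → (∀ k → 0ℤ ℤ.≤ g k) → ∀ k → 0ℤ ℤ.≤ (f P₁.⊛ g) k
          ⊛≥0 f g f≥0 g≥0 zero    = 0≤i*j (f≥0 0) (g≥0 0)
          ⊛≥0 f g f≥0 g≥0 (suc k) = ℤ.+-mono-≤ (0≤i*j (f≥0 0) (g≥0 (suc k)))
            (⊛≥0 (f ∘ suc) g (f≥0 ∘ suc) g≥0 k)
          1≥0 : ∀ k → 0ℤ ℤ.≤ R₁.1# k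
          1≥0 zero    = ℤ.+≤+ ℕ.z≤n
          1≥0 (suc k) = ℤ.≤-refl
          X≥0 : ∀ k → 0ℤ ℤ.≤ P₁.X# k
          X≥0 zero    = ℤ.≤-refl
          X≥0 (suc k) = 1≥0 k
          ++-elim : ∀ {Q : R₁.Carrier → Set} {f g : Vector R₁.Carrier n} →
                    (∀ i → Q (f i)) → (∀ i → Q (g i)) → ∀ c → Q ((f ++ g) c)
          ++-elim Qf Qg c with splitAt n c
          ... | inj₁ i = Qf i
          ... | inj₂ i = Qg i
          colWeight≥0 : ∀ c k → 0ℤ ℤ.≤ colWeight {n} P₁.X# c k
          colWeight≥0 = ++-elim {λ f → ∀ k → 0ℤ ℤ.≤ f k} (λ _ → 1≥0) (λ _ → X≥0)
          ∏≥0 : ∀ {m} (f : Vector R₁.Carrier m) → (∀ i k → 0ℤ ℤ.≤ f i k) → ∀ k → 0ℤ ℤ.≤ D₁.∏ f k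
          ∏≥0 {zero}  f f≥0 k = ≡.subst (0ℤ ℤ.≤_) (≡.sym (D₁.∏-zero f k)) (1≥0 k)
          ∏≥0 {suc m} f f≥0 k = ≡.subst (0ℤ ℤ.≤_) (≡.sym (D₁.∏-suc f k))
            (⊛≥0 _ _ (f≥0 zero) (∏≥0 (f ∘ suc) (f≥0 ∘ suc)) k)

        DiagonalNonneg : R₃.Carrier → Set
        DiagonalNonneg F = ∀ s k → 0ℤ ℤ.≤ F s k k

        ∑-nonneg : ∀ {m} (f : Vector R₃.Carrier m) → (∀ i → DiagonalNonneg (f i)) → DiagonalNonneg
            (D₃.∑ f)
        ∑-nonneg {zero}  f f≥0 s k = ≡.subst (0ℤ ℤ.≤_) (≡.sym (D₃.∑-zero f s k k)) ℤ.≤-refl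
        ∑-nonneg {suc m} f f≥0 s k = ≡.subst (0ℤ ℤ.≤_) (≡.sym (D₃.∑-suc f s k k))
          (ℤ.+-mono-≤ (f≥0 zero s k) (∑-nonneg (f ∘ suc) (f≥0 ∘ suc) s k))

        ∑F-nonneg : ∀ {p} m (g : Vector (Fin p) m → R₃.Carrier) → (∀ J → DiagonalNonneg (g J)) →
                    DiagonalNonneg (D₃.∑F m g)
        ∑F-nonneg zero    g g≥0 = g≥0 []
        ∑F-nonneg (suc m) g g≥0 = ∑-nonneg _ λ a → ∑F-nonneg m _ λ J → g≥0 (a ∷ J)

        module M₃ = CommutativeMonoidMult R₃.+-commutativeMonoid

        ×₃-coefficient : ∀ m F s l k → (m M₃.× F) s l k ≡ m × F s l k
        ×₃-coefficient zero    F s l k = ≡.refl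
        ×₃-coefficient (suc m) F s l k = ≡.cong (ℤ._+_ (F s l k)) (×₃-coefficient m F s l k)

        Φ≥0 : DiagonalNonneg Φ
        Φ≥0 s k = 0≤-×-cancel (n !) (Φ s k k) {{ℕ._!≢0 n}} (≡.subst (0ℤ ℤ.≤_)
          (≡.trans (≡.sym (gram-cauchyBinet ιx-homo ιy-homo ιu-homo P₁.X# C s k k))
              (×₃-coefficient (n !) Φ s k k))
          (∑F-nonneg n _ (λ J s k → ≡.subst (0ℤ ℤ.≤_)
            (≡.sym (≡.trans (coefficient (μ J) (W J) (μ J) s k k) (ℤ.*-assoc (W J s) (μ J k) (μ J k))))
            (0≤i*j (weight≥0 J s) (0≤i*i (μ J k)))) s k))
          where
          μ W : Vector (Fin (n ℕ.+ n)) n → R₁.Carrier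
          μ = selected ιx-homo ιy-homo ιu-homo P₁.X# C
          W = D₁.weight (colWeight {n} P₁.X#)

        Φ₀ : ∀ l k → Φ 0 l k ≡ charSeries l ℤ.* charSeries k
        Φ₀ l k = begin
          Φ 0 l k
            ≡⟨ Det-homo ℤ⟦x,y,u⟧ ℤ⟦x,y⟧ P₃.head-homo (gram ιx-homo ιy-homo ιu-homo P₁.X# C) l k ⟩
          D₂.Det (λ i j → gram ιx-homo ιy-homo ιu-homo P₁.X# C i j 0) l k
            ≡⟨ D₂.Det-cong (λ i j → ∑-homo ℤ⟦x,y,u⟧ ℤ⟦x,y⟧ P₃.head-homo _) l k ⟩
          D₂.Det (Gram₂.gram P₂.const#-homo map-const-homo evalu-homo P₁.X# C) l k
            ≡⟨ Gram₂.gram-u≈0 P₂.const#-homo map-const-homo evalu-homo P₁.X# C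
                 (R₂.trans (RingMorphisms.IsRingHomomorphism.⟦⟧-cong P₂.const#-homo
                   (RingMorphisms.IsRingHomomorphism.0#-homo P₁.const#-homo))
                   (RingMorphisms.IsRingHomomorphism.0#-homo P₂.const#-homo)) l k ⟩
          (P₂.const# charSeries R₂.* (P₁.const# ∘ charSeries)) l k
            ≡⟨ P₂.const#-⊛ charSeries (P₁.const# ∘ charSeries) l k ⟩
          (charSeries P₁.⊛ P₁.const# (charSeries l)) k
            ≡⟨ ≡.trans (P₁.⊛-comm charSeries _ k) (P₁.const#-⊛ (charSeries l) charSeries k) ⟩
          charSeries l ℤ.* charSeries k ∎
          where
          open ≡.≡-Reasoning
          module Gram₂ = Gram ℤ⟦x⟧ ℤ⟦x,y⟧
          -- `ιu` followed by u = 0. Taking u-degree 0 in the three-variable Gram matrix thus gives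
          -- a Gram matrix of the same shape in which the second block of columns has weight 0.
          evalu-homo : Hom R₁.rawRing R₂.rawRing (λ f → P₂.const# (P₁.const# (f 0)))
          evalu-homo = isRingHomomorphism R₂.trans P₁.head-homo
            (isRingHomomorphism R₂.trans P₁.const#-homo P₂.const#-homo)

      charSeries-logConcave : ∀ k → charSeries k ℤ.* charSeries (suc (suc k)) ℤ.≤
                                    charSeries (suc k) ℤ.* charSeries (suc k)
      charSeries-logConcave k = ℤ.0≤i-j⇒j≤i (≡.subst (0ℤ ℤ.≤_)
        (≡.cong₂ ℤ._-_ (Φ₀ (suc k) (suc k)) (≡.trans (Φ₀ (suc (suc k)) k)
          (ℤ.*-comm (charSeries (suc (suc k))) (charSeries k))))
        (LogConcavityRecursion.lc≥0 Φ ∂Φ≈0 Φ≥0 (suc k) 0))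

-- Forms positive on vectors of sum zero, and signs of determinants.

module ConditionalPositivity where

  open import Defs hiding (δ)
  open import Data.Fin.Base using (Fin; zero; suc; toℕ; fromℕ; punchIn)
  open import Data.Fin.Properties using (punchInᵢ≢i)
  open import Data.Integer.Base as ℤ using (ℤ; +_; 0ℤ; 1ℤ)
  import Data.Integer.Properties as ℤ
  open import Data.Integer.Tactic.RingSolver using (solve-∀)
  open import Data.Nat.Base as ℕ using (ℕ; zero; suc)
  open import Data.Product.Base using (∃-syntax; _,_)
  open import Data.Sum.Base using ([_,_]′)
  open import Data.Vec.Functional using (Vector; _∷_; insertAt)
  open import Data.Vec.Functional.Properties using (insertAt-lookup; insertAt-punchIn)
  open import Function.Base using (_∘_; flip; _⟨_⟩_)
  open import Relation.Binary.PropositionalEquality as ≡ using (_≡_; _≢_)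
  open import Relation.Nullary.Negation using (contradiction)
  open DeterminantTheory
  open SeriesTheory
  open GramDeterminants
  open CharacteristicSeries

  open D₀ using (∑; ∑-cong; ∑-comm; *-∑; ∑-*; ∑-+; ∑-neg; ∑-remove; ∑-0; ∑-𝟙; 𝟙; 𝟙-diagonal; 𝟙-off;
      Det; Det-*; Det-transpose; minor; Det-suc; Det-zero; ∑-suc; ∑-zero; sgn; sgn-zero; sgn-cong;
      sgn-0)

  module _ {n} (A : Matrix ℤ n) where

    bilinear : Vector ℤ n → Vector ℤ n → ℤ
    bilinear u v = ∑ λ a → u a ℤ.* ∑ λ b → A a b ℤ.* v b

    quadratic : Vector ℤ n → ℤ
    quadratic x = bilinear x x

    bilinear-∑ˡ : ∀ {m} (x : Vector ℤ m) (u : Fin m → Vector ℤ n) v →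
      bilinear (λ a → ∑ λ i → x i ℤ.* u i a) v ≡ ∑ λ i → x i ℤ.* bilinear (u i) v
    bilinear-∑ˡ x u v = begin
      ∑ (λ a → ∑ (λ i → x i ℤ.* u i a) ℤ.* Av a)
        ≡⟨ ∑-cong (λ a → ≡.trans (∑-* _ (Av a)) (∑-cong λ i → ℤ.*-assoc (x i) (u i a) (Av a))) ⟩
      ∑ (λ a → ∑ λ i → x i ℤ.* (u i a ℤ.* Av a))
        ≡⟨ ∑-comm _ ⟩
      ∑ (λ i → ∑ λ a → x i ℤ.* (u i a ℤ.* Av a))
        ≡⟨ ∑-cong (λ i → *-∑ (x i) _) ⟨
      ∑ (λ i → x i ℤ.* bilinear (u i) v) ∎
      where
      open ≡.≡-Reasoning
      Av : Vector ℤ n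
      Av a = ∑ λ b → A a b ℤ.* v b

    bilinear-∑ʳ : ∀ {m} (x : Vector ℤ m) u (v : Fin m → Vector ℤ n) →
      bilinear u (λ b → ∑ λ j → x j ℤ.* v j b) ≡ ∑ λ j → bilinear u (v j) ℤ.* x j
    bilinear-∑ʳ x u v = begin
      ∑ (λ a → u a ℤ.* ∑ (λ b → A a b ℤ.* ∑ λ j → x j ℤ.* v j b))
        ≡⟨ ∑-cong (λ a → ≡.cong (ℤ._*_ (u a)) (≡.trans (∑-cong λ b → ≡.trans (*-∑ (A a b) _)
             (∑-cong λ j → swap (A a b) (x j) (v j b))) (∑-comm _))) ⟩
      ∑ (λ a → u a ℤ.* ∑ (λ j → ∑ λ b → A a b ℤ.* v j b ℤ.* x j))
        ≡⟨ ∑-cong (λ a → ≡.trans (≡.cong (ℤ._*_ (u a)) (∑-cong λ j → ≡.sym (∑-* _ (x j))))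
            (≡.trans (*-∑ (u a) _)
             (∑-cong λ j → ≡.sym (ℤ.*-assoc (u a) _ (x j))))) ⟩
      ∑ (λ a → ∑ λ j → u a ℤ.* ∑ (λ b → A a b ℤ.* v j b) ℤ.* x j)
        ≡⟨ ≡.trans (∑-comm _) (∑-cong λ j → ≡.sym (∑-* _ (x j))) ⟩
      ∑ (λ j → bilinear u (v j) ℤ.* x j) ∎
      where
      open ≡.≡-Reasoning
      swap : ∀ p q r → p ℤ.* (q ℤ.* r) ≡ p ℤ.* r ℤ.* q
      swap = solve-∀

    bilinear-𝟙 : ∀ i j → bilinear (𝟙 i) (𝟙 j) ≡ A i j
    bilinear-𝟙 i j = ≡.trans (∑-𝟙 i _) (≡.trans (∑-cong λ b → ℤ.*-comm (A i b) (𝟙 j b)) (∑-𝟙 j (A i)))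

    bilinear--ˡ : ∀ α β u u′ v → bilinear (λ a → α ℤ.* u a ℤ.- β ℤ.* u′ a) v ≡
                                 α ℤ.* bilinear u v ℤ.- β ℤ.* bilinear u′ v
    bilinear--ˡ α β u u′ v = ≡.trans (∑-cong λ a → expand α β (u a) (u′ a) (∑ λ b → A a b ℤ.* v b))
      (≡.trans (∑-+ _ _) (≡.cong₂ ℤ._+_ (≡.sym (*-∑ α _))
        (≡.trans (∑-neg _) (≡.cong ℤ.-_ (≡.sym (*-∑ β _))))))
      where
      expand : ∀ α β p q r → (α ℤ.* p ℤ.- β ℤ.* q) ℤ.* r ≡ α ℤ.* (p ℤ.* r) ℤ.- β ℤ.* (q ℤ.* r)
      expand = solve-∀

    bilinear--ʳ : ∀ α β u v v′ → bilinear u (λ b → α ℤ.* v b ℤ.- β ℤ.* v′ b) ≡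
                                 α ℤ.* bilinear u v ℤ.- β ℤ.* bilinear u v′
    bilinear--ʳ α β u v v′ = ≡.trans (∑-cong λ a → ≡.trans (≡.cong (ℤ._*_ (u a))
        (≡.trans (∑-cong λ b → expand α β (A a b) (v b) (v′ b)) (≡.trans (∑-+ _ _) (≡.cong₂ ℤ._+_
          (≡.sym (*-∑ α _)) (≡.trans (∑-neg _) (≡.cong ℤ.-_ (≡.sym (*-∑ β _))))))))
        (expand α β (u a) (∑ λ b → A a b ℤ.* v b) (∑ λ b → A a b ℤ.* v′ b)))
      (≡.trans (∑-+ _ _) (≡.cong₂ ℤ._+_ (≡.sym (*-∑ α _))
        (≡.trans (∑-neg _) (≡.cong ℤ.-_ (≡.sym (*-∑ β _))))))
      where
      expand : ∀ α β p q r → p ℤ.* (α ℤ.* q ℤ.- β ℤ.* r) ≡ α ℤ.* (p ℤ.* q) ℤ.- β ℤ.* (p ℤ.* r)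
      expand = solve-∀

    -- Every congruence below has rows of this shape, a multiple of a unit vector minus a multiple
    -- of one fixed unit vector, so this computes all their entries.
    bilinear-combination : ∀ α β i k α′ β′ j → bilinear (λ a → α ℤ.* 𝟙 i a ℤ.- β ℤ.* 𝟙 k a)
        (λ a → α′ ℤ.* 𝟙 j a ℤ.- β′ ℤ.* 𝟙 k a) ≡
      α ℤ.* (α′ ℤ.* A i j ℤ.- β′ ℤ.* A i k) ℤ.- β ℤ.* (α′ ℤ.* A k j ℤ.- β′ ℤ.* A k k)
    bilinear-combination α β i k α′ β′ j = ≡.trans (bilinear--ˡ α β (𝟙 i) (𝟙 k) _)
        (≡.cong₂ (λ p q → α ℤ.* p ℤ.- β ℤ.* q)
      (≡.trans (bilinear--ʳ α′ β′ (𝟙 i) (𝟙 j) (𝟙 k)) (≡.cong₂ (λ p q → α′ ℤ.* p ℤ.- β′ ℤ.* q)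
          (bilinear-𝟙 i j) (bilinear-𝟙 i k)))
      (≡.trans (bilinear--ʳ α′ β′ (𝟙 k) (𝟙 j) (𝟙 k)) (≡.cong₂ (λ p q → α′ ℤ.* p ℤ.- β′ ℤ.* q)
          (bilinear-𝟙 k j) (bilinear-𝟙 k k))))

    congruent : Matrix ℤ n → Matrix ℤ n
    congruent S i j = bilinear (S i) (S j)

    quadratic-congruent : ∀ S x → ∑ (λ i → x i ℤ.* ∑ λ j → congruent S i j ℤ.* x j) ≡
                                  quadratic (λ a → ∑ λ i → x i ℤ.* S i a)
    quadratic-congruent S x = ≡.sym (≡.trans (bilinear-∑ˡ x S _)
      (∑-cong λ i → ≡.cong (ℤ._*_ (x i)) (bilinear-∑ʳ x (S i) S)))

    -- `congruent S` is S A Sᵀ, with determinant det A · (det S)², and a square factor cannot make a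
    -- nonnegative number negative. This permits elimination with multipliers instead of divisions.
    Det-congruent<0 : ∀ S → Det (congruent S) ℤ.< 0ℤ → Det A ℤ.< 0ℤ
    Det-congruent<0 S T<0 = ℤ.≰⇒> λ 0≤A → ℤ.<⇒≱ T<0 (≡.subst (0ℤ ℤ.≤_) (≡.sym Det≡)
        (0≤i*j 0≤A (0≤i*i (Det S))))
      where
      rearrange′ : ∀ s d → s ℤ.* (d ℤ.* s) ≡ d ℤ.* (s ℤ.* s)
      rearrange′ = solve-∀
      Det≡ : Det (congruent S) ≡ Det A ℤ.* (Det S ℤ.* Det S)
      Det≡ = ≡.trans (Det-* S (λ a j → ∑ λ b → A a b ℤ.* S j b)) (≡.trans
        (≡.cong (ℤ._*_ (Det S)) (≡.trans (Det-* A (flip S)) (≡.cong (ℤ._*_ (Det A)) (Det-transpose S))))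
        (rearrange′ (Det S) (Det A)))

    bilinear-sym : (∀ i j → A i j ≡ A j i) → ∀ u v → bilinear u v ≡ bilinear v u
    bilinear-sym A-sym u v = begin
      ∑ (λ a → u a ℤ.* ∑ λ b → A a b ℤ.* v b)     ≡⟨ ∑-cong (λ a → *-∑ (u a) _) ⟩
      ∑ (λ a → ∑ λ b → u a ℤ.* (A a b ℤ.* v b))   ≡⟨ ∑-comm _ ⟩
      ∑ (λ b → ∑ λ a → u a ℤ.* (A a b ℤ.* v b))   ≡⟨ ∑-cong (λ b → ∑-cong λ a → ≡.trans
                                                            (swap (u a) (A a b) (v b)) (≡.cong
                                                                (λ z → v b ℤ.* (z ℤ.* u a)) (A-sym a
                                                                b))) ⟩
      ∑ (λ b → ∑ λ a → v b ℤ.* (A b a ℤ.* u a))   ≡⟨ ∑-cong (λ b → *-∑ (v b) _) ⟨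
      ∑ (λ b → v b ℤ.* ∑ λ a → A b a ℤ.* u a)     ∎
      where
      open ≡.≡-Reasoning
      swap : ∀ p q r → p ℤ.* (q ℤ.* r) ≡ r ℤ.* (q ℤ.* p)
      swap = solve-∀

    congruent-sym : (∀ i j → A i j ≡ A j i) → ∀ S i j → congruent S i j ≡ congruent S j i
    congruent-sym A-sym S i j = bilinear-sym A-sym (S i) (S j)

  NonZeroVec : ∀ {n} → Vector ℤ n → Set
  NonZeroVec x = ∃[ i ] x i ≢ 0ℤ

  -- Positive definiteness on the hyperplane where the last coordinate vanishes. Elimination pivots
  -- at index 0 and so keeps the one exceptional direction last until the end.
  PositiveOffLast : ∀ {m} → Matrix ℤ (suc m) → Set
  PositiveOffLast {m} H = ∀ x → x (fromℕ m) ≡ 0ℤ → NonZeroVec x → 0ℤ ℤ.< quadratic H x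

  Symmetric : ∀ {n} → Matrix ℤ n → Set
  Symmetric A = ∀ i j → A i j ≡ A j i

  elementary : ∀ {n} → Vector ℤ n → Vector ℤ n → Fin n → Matrix ℤ n
  elementary α β k i j = α i ℤ.* 𝟙 i j ℤ.- β i ℤ.* 𝟙 k j

  elementary-row : ∀ {n} (α β : Vector ℤ n) k (x : Vector ℤ n) j →
    ∑ (λ i → x i ℤ.* elementary α β k i j) ≡ α j ℤ.* x j ℤ.- ∑ (λ i → x i ℤ.* β i) ℤ.* 𝟙 k j
  elementary-row α β k x j = begin
    ∑ (λ i → x i ℤ.* (α i ℤ.* 𝟙 i j ℤ.- β i ℤ.* 𝟙 k j))
      ≡⟨ ∑-cong term ⟩
    ∑ (λ i → 𝟙 j i ℤ.* (α i ℤ.* x i) ℤ.- x i ℤ.* β i ℤ.* 𝟙 k j)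
      ≡⟨ ≡.trans (∑-+ (λ i → 𝟙 j i ℤ.* (α i ℤ.* x i)) (λ i → ℤ.- (x i ℤ.* β i ℤ.* 𝟙 k j)))
           (≡.cong₂ ℤ._+_ (∑-𝟙 j (λ i → α i ℤ.* x i))
             (≡.trans (∑-neg (λ i → x i ℤ.* β i ℤ.* 𝟙 k j)) (≡.cong ℤ.-_
                 (≡.sym (∑-* (λ i → x i ℤ.* β i) (𝟙 k j)))))) ⟩
    α j ℤ.* x j ℤ.- ∑ (λ i → x i ℤ.* β i) ℤ.* 𝟙 k j ∎
    where
    open ≡.≡-Reasoning
    term : ∀ i → x i ℤ.* (α i ℤ.* 𝟙 i j ℤ.- β i ℤ.* 𝟙 k j) ≡ 𝟙 j i ℤ.*
        (α i ℤ.* x i) ℤ.- x i ℤ.* β i ℤ.* 𝟙 k j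
    term i = ≡.trans (expand (x i) (α i) (𝟙 i j) (β i) (𝟙 k j))
      (≡.cong (λ z → z ℤ.* (α i ℤ.* x i) ℤ.- x i ℤ.* β i ℤ.* 𝟙 k j) (D₀.𝟙-sym i j))
      where
      expand : ∀ x a d b e → x ℤ.* (a ℤ.* d ℤ.- b ℤ.* e) ≡ d ℤ.* (a ℤ.* x) ℤ.- x ℤ.* b ℤ.* e
      expand = solve-∀

  0<i*j : ∀ {i j} → 0ℤ ℤ.< i → 0ℤ ℤ.< j → 0ℤ ℤ.< i ℤ.* j
  0<i*j {i} {j} 0<i 0<j = ≡.subst (ℤ._< i ℤ.* j) (ℤ.*-zeroʳ i)
    (ℤ.*-monoˡ-<-pos i {{ℤ.positive 0<i}} 0<j)

  i*j<0 : ∀ {i j} → 0ℤ ℤ.< i → j ℤ.< 0ℤ → i ℤ.* j ℤ.< 0ℤ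
  i*j<0 {i} {j} 0<i j<0 = ≡.subst (i ℤ.* j ℤ.<_) (ℤ.*-zeroʳ i)
    (ℤ.*-monoˡ-<-pos i {{ℤ.positive 0<i}} j<0)

  0<i*i : ∀ {i} → i ≢ 0ℤ → 0ℤ ℤ.< i ℤ.* i
  0<i*i {i} i≢0 = ℤ.≤∧≢⇒< (0≤i*i i) λ 0≡ii → [ i≢0 , i≢0 ]′ (ℤ.i*j≡0⇒i≡0∨j≡0 i (≡.sym 0≡ii))

  module _ {m} (H : Matrix ℤ (suc m)) where
    private
      α β : Vector ℤ (suc m)
      α = 1ℤ ∷ λ _ → H zero zero
      β = 0ℤ ∷ λ i → H zero (suc i)

    -- Gaussian elimination without division: row 0 is kept, and row i + 1 is H₀₀ e_(i+1) - H₀,(i+1)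
    -- e₀.
    eliminator : Matrix ℤ (suc m)
    eliminator = elementary α β zero

    eliminated : Matrix ℤ (suc m)
    eliminated = congruent H eliminator

    -- For symmetric H this is H₀₀² times the Schur complement of the pivot, the scaling that keeps
    -- the entries integral.
    complement : Matrix ℤ m
    complement i j = eliminated (suc i) (suc j)

    eliminated-pivot : eliminated zero zero ≡ H zero zero
    eliminated-pivot = ≡.trans (bilinear-combination H 1ℤ 0ℤ zero zero 1ℤ 0ℤ zero)
        (simplify (H zero zero))
      where
      simplify : ∀ a → 1ℤ ℤ.* (1ℤ ℤ.* a ℤ.- 0ℤ ℤ.* a) ℤ.- 0ℤ ℤ.* (1ℤ ℤ.* a ℤ.- 0ℤ ℤ.* a) ≡ a
      simplify = solve-∀

    eliminated-row : ∀ j → eliminated zero (suc j) ≡ 0ℤ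
    eliminated-row j = ≡.trans (bilinear-combination H 1ℤ 0ℤ zero zero (H zero zero)
        (H zero (suc j)) (suc j))
      (simplify (H zero zero) (H zero (suc j)))
      where
      simplify : ∀ a h → 1ℤ ℤ.* (a ℤ.* h ℤ.- h ℤ.* a) ℤ.- 0ℤ ℤ.* (a ℤ.* h ℤ.- h ℤ.* a) ≡ 0ℤ
      simplify = solve-∀

    complement-diagonal : Symmetric H → ∀ i → complement i i ≡
      H zero zero ℤ.* (H zero zero ℤ.* H (suc i) (suc i) ℤ.- H zero (suc i) ℤ.* H zero (suc i))
    complement-diagonal H-sym i = ≡.trans (bilinear-combination H a h (suc i) zero a h (suc i))
      (≡.trans (≡.cong (λ z → a ℤ.* (a ℤ.* H (suc i) (suc i) ℤ.- h ℤ.* z) ℤ.- h ℤ.*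
          (a ℤ.* h ℤ.- h ℤ.* a)) (H-sym (suc i) zero))
        (simplify a h (H (suc i) (suc i))))
      where
      a h : ℤ
      a = H zero zero
      h = H zero (suc i)
      simplify : ∀ a h b → a ℤ.* (a ℤ.* b ℤ.- h ℤ.* h) ℤ.- h ℤ.* (a ℤ.* h ℤ.- h ℤ.* a) ≡ a ℤ.*
          (a ℤ.* b ℤ.- h ℤ.* h)
      simplify = solve-∀

    Det-eliminated : Det eliminated ≡ H zero zero ℤ.* Det complement
    Det-eliminated = begin
      Det eliminated
        ≡⟨ ≡.trans (Det-suc _) (∑-suc _) ⟩
      sgn 0 (eliminated zero zero ℤ.* Det complement) ℤ.+ _
        ≡⟨ ≡.cong₂ ℤ._+_ (≡.trans (sgn-zero _) (≡.cong (ℤ._* Det complement) eliminated-pivot))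
             (∑-0 λ j → ≡.trans (sgn-cong (suc (toℕ j)) (≡.trans
               (≡.cong (ℤ._* Det (minor zero (suc j) eliminated)) (eliminated-row j))
               (ℤ.*-zeroˡ (Det (minor zero (suc j) eliminated))))) (sgn-0 (suc (toℕ j)))) ⟩
      H zero zero ℤ.* Det complement ℤ.+ 0ℤ
        ≡⟨ ℤ.+-identityʳ _ ⟩
      H zero zero ℤ.* Det complement ∎
      where open ≡.≡-Reasoning

    extend : Vector ℤ m → Vector ℤ (suc m)
    extend x j = ∑ λ i → (0ℤ ∷ x) i ℤ.* eliminator i j

    quadratic-complement : ∀ x → quadratic complement x ≡ quadratic H (extend x)
    quadratic-complement x = begin
      ∑ (λ i → x i ℤ.* ∑ λ j → complement i j ℤ.* x j)
        ≡⟨ ∑-cong (λ i → ≡.cong (ℤ._*_ (x i)) (row (suc i))) ⟨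
      ∑ (λ i → x i ℤ.* ∑ λ j → eliminated (suc i) j ℤ.* (0ℤ ∷ x) j)
        ≡⟨ ≡.trans (∑-suc (λ i → (0ℤ ∷ x) i ℤ.* ∑ λ j → eliminated i j ℤ.* (0ℤ ∷ x) j))
             (≡.trans (≡.cong (ℤ._+ rest) (ℤ.*-zeroˡ (∑ λ j → eliminated zero j ℤ.* (0ℤ ∷ x) j)))
                 (ℤ.+-identityˡ rest)) ⟨
      ∑ (λ i → (0ℤ ∷ x) i ℤ.* ∑ λ j → eliminated i j ℤ.* (0ℤ ∷ x) j)
        ≡⟨ quadratic-congruent H eliminator (0ℤ ∷ x) ⟩
      quadratic H (extend x) ∎
      where
      open ≡.≡-Reasoning
      rest : ℤ
      rest = ∑ (λ i → x i ℤ.* ∑ λ j → eliminated (suc i) j ℤ.* (0ℤ ∷ x) j)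
      row : ∀ i → ∑ (λ j → eliminated i j ℤ.* (0ℤ ∷ x) j) ≡ ∑ (λ j → eliminated i (suc j) ℤ.* x j)
      row i = ≡.trans (∑-suc (λ j → eliminated i j ℤ.* (0ℤ ∷ x) j)) (≡.trans
        (≡.cong (ℤ._+ ∑ (λ j → eliminated i (suc j) ℤ.* x j)) (ℤ.*-zeroʳ (eliminated i zero)))
            (ℤ.+-identityˡ _))

    -- The later coordinates are only multiplied by the pivot. When the pivot is positive, vanishing
    -- at the last index and being nonzero both pass from x to `extend x`.
    extend-suc : ∀ x j → extend x (suc j) ≡ H zero zero ℤ.* x j
    extend-suc x j = ≡.trans (elementary-row α β zero (0ℤ ∷ x) (suc j))
      (≡.trans (≡.cong (λ z → H zero zero ℤ.* x j ℤ.- s ℤ.* z) (𝟙-off {i = zero} {suc j} λ ()))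
        (simplify (H zero zero ℤ.* x j) s))
      where
      s : ℤ
      s = ∑ λ i → (0ℤ ∷ x) i ℤ.* β i
      simplify : ∀ a b → a ℤ.- b ℤ.* 0ℤ ≡ a
      simplify = solve-∀

  positiveOffLast-pivot : ∀ {m} (H : Matrix ℤ (suc (suc m))) → PositiveOffLast H → 0ℤ ℤ.< H zero zero
  positiveOffLast-pivot {m} H H-pos = ≡.subst (0ℤ ℤ.<_) (bilinear-𝟙 H zero zero)
    (H-pos (𝟙 zero) (𝟙-off {i = zero} {fromℕ (suc m)} λ ())
      (zero , λ 𝟙≡0 → contradiction (≡.trans (≡.sym (𝟙-diagonal {suc (suc m)} zero)) 𝟙≡0) λ ()))

  positiveOffLast-complement : ∀ {m}
      (H : Matrix ℤ (suc (suc m))) → PositiveOffLast H → PositiveOffLast (complement H)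
  positiveOffLast-complement {m} H H-pos x xₗ≡0 (i , xᵢ≢0) = ≡.subst (0ℤ ℤ.<_)
      (≡.sym (quadratic-complement H x))
    (H-pos (extend H x) (≡.trans (extend-suc H x (fromℕ m)) (≡.trans (≡.cong (ℤ._*_ a) xₗ≡0)
        (ℤ.*-zeroʳ a)))
      (suc i , λ e → [ ℤ.<⇒≢ 0<a ∘ ≡.sym , xᵢ≢0 ]′ (ℤ.i*j≡0⇒i≡0∨j≡0 a
          (≡.trans (≡.sym (extend-suc H x i)) e))))
    where
    a : ℤ
    a = H zero zero
    0<a : 0ℤ ℤ.< a
    0<a = positiveOffLast-pivot H H-pos

  -- Each elimination splits a positive pivot off the determinant and leaves a smaller form with the
  -- same three properties; at order 1 only the negative last entry remains.
  Det<0 : ∀ {m} (H : Matrix ℤ (suc m)) → Symmetric H → PositiveOffLast H →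
          H (fromℕ m) (fromℕ m) ℤ.< 0ℤ → Det H ℤ.< 0ℤ
  -- The condition says that the last diagonal entry of `complement` is negative. It also covers a
  -- vanishing last entry of H, the case in which the elimination for a conditionally positive
  -- matrix starts.
  Det<0-pivot : ∀ {m} (H : Matrix ℤ (suc (suc m))) → Symmetric H → PositiveOffLast H →
    (let l = fromℕ (suc m)) → H zero zero ℤ.* H l l ℤ.- H zero l ℤ.* H zero l ℤ.< 0ℤ → Det H ℤ.< 0ℤ

  Det<0 {zero}  H _ _ H<0 = ≡.subst (ℤ._< 0ℤ) (≡.sym Det≡) H<0
    where
    Det≡ : Det H ≡ H zero zero
    Det≡ = ≡.trans (Det-suc H) (≡.trans (∑-suc _) (≡.trans (≡.cong₂ ℤ._+_ (sgn-zero _) (∑-zero _))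
      (≡.trans (ℤ.+-identityʳ _) (≡.trans (≡.cong (ℤ._*_ (H zero zero))
          (Det-zero (minor zero zero H))) (ℤ.*-identityʳ _)))))
  Det<0 {suc m} H H-sym H-pos H<0 = Det<0-pivot H H-sym H-pos
    (ℤ.+-mono-<-≤ (i*j<0 (positiveOffLast-pivot H H-pos) H<0)
        (ℤ.neg-mono-≤ (0≤i*i (H zero (fromℕ (suc m))))))

  Det<0-pivot {m} H H-sym H-pos <0 = Det-congruent<0 H (eliminator H)
      (≡.subst (ℤ._< 0ℤ) (≡.sym (Det-eliminated H))
    (i*j<0 0<a (Det<0 (complement H) (λ i j → congruent-sym H H-sym (eliminator H) (suc i) (suc j))
      (positiveOffLast-complement H H-pos)
      (≡.subst (ℤ._< 0ℤ) (≡.sym (complement-diagonal H H-sym (fromℕ m))) (i*j<0 0<a <0)))))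
    where
    0<a : 0ℤ ℤ.< H zero zero
    0<a = positiveOffLast-pivot H H-pos

  record ConditionallyPositive {n} (A : Matrix ℤ n) : Set where
    field
      symmetric : Symmetric A
      diagonal  : ∀ i → A i i ≡ 0ℤ
      positive  : ∀ x → ∑ x ≡ 0ℤ → NonZeroVec x → 0ℤ ℤ.< quadratic A x

  module _ {m} (A : Matrix ℤ (suc (suc m))) (A-cp : ConditionallyPositive A) where
    open ConditionallyPositive A-cp
    private
      l : Fin (suc (suc m))
      l = fromℕ (suc m)

      -- Row i of S is e_i - e_l for i ≠ l, and e_l for i = l. The former span the vectors of sum 0,
      -- so positivity of A there becomes positivity of T off its last coordinate.
      β : Vector ℤ (suc (suc m))
      β i = 1ℤ ℤ.- 𝟙 i l

      βₗ≡0 : β l ≡ 0ℤ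
      βₗ≡0 = ≡.cong (ℤ._-_ 1ℤ) (𝟙-diagonal l)

      S T : Matrix ℤ (suc (suc m))
      S = elementary (λ _ → 1ℤ) β l
      T = congruent A S

      ∑𝟙 : ∀ (i : Fin (suc (suc m))) → ∑ (𝟙 i) ≡ 1ℤ
      ∑𝟙 i = ≡.trans (∑-cong λ j → ≡.sym (ℤ.*-identityʳ (𝟙 i j))) (∑-𝟙 i (λ _ → 1ℤ))

      entry : ∀ i → T i l ≡ 1ℤ ℤ.* (1ℤ ℤ.* A i l ℤ.- 0ℤ ℤ.* A i l) ℤ.- β i ℤ.* (1ℤ ℤ.* 0ℤ ℤ.- 0ℤ ℤ.* 0ℤ)
      entry i = ≡.trans (bilinear-combination A 1ℤ (β i) i l 1ℤ (β l) l)
        (≡.cong₂ (λ b d → 1ℤ ℤ.* (1ℤ ℤ.* A i l ℤ.- b ℤ.* A i l) ℤ.- β i ℤ.*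
            (1ℤ ℤ.* d ℤ.- b ℤ.* d)) βₗ≡0 (diagonal l))

      entry′ : ∀ i → T i l ≡ A i l
      entry′ i = ≡.trans (entry i) (simplify (A i l) (β i))
        where
        simplify : ∀ a b → 1ℤ ℤ.* (1ℤ ℤ.* a ℤ.- 0ℤ ℤ.* a) ℤ.- b ℤ.* (1ℤ ℤ.* 0ℤ ℤ.- 0ℤ ℤ.* 0ℤ) ≡ a
        simplify = solve-∀

      -- The vector e₀ - e_l has sum 0 and, the diagonal being zero, form value -2 A₀ₗ, which must
      -- be positive.
      A₀ₗ≢0 : A zero l ≢ 0ℤ
      A₀ₗ≢0 A₀ₗ≡0 = ℤ.<-irrefl (≡.sym q≡0) (positive x ∑x≡0 (zero , λ x₀≡0 → contradiction
          (≡.trans (≡.sym x₀≡1) x₀≡0) λ ()))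
        where
        x : Vector ℤ (suc (suc m))
        x j = 1ℤ ℤ.* 𝟙 zero j ℤ.- 1ℤ ℤ.* 𝟙 l j
        x₀≡1 : x zero ≡ 1ℤ
        x₀≡1 = ≡.cong₂ (λ p q → 1ℤ ℤ.* p ℤ.- 1ℤ ℤ.* q) (𝟙-diagonal {suc (suc m)} zero)
            (𝟙-off {i = l} {zero} λ ())
        ∑x≡0 : ∑ x ≡ 0ℤ
        ∑x≡0 = ≡.trans (∑-+ (λ j → 1ℤ ℤ.* 𝟙 zero j) (λ j → ℤ.- (1ℤ ℤ.* 𝟙 l j))) (≡.cong₂ ℤ._+_
          (≡.trans (≡.sym (*-∑ 1ℤ (𝟙 zero))) (≡.cong (ℤ._*_ 1ℤ) (∑𝟙 zero)))
          (≡.trans (∑-neg (λ j → 1ℤ ℤ.* 𝟙 l j)) (≡.cong ℤ.-_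
              (≡.trans (≡.sym (*-∑ 1ℤ (𝟙 l))) (≡.cong (ℤ._*_ 1ℤ) (∑𝟙 l))))))
        q≡0 : quadratic A x ≡ 0ℤ
        q≡0 = ≡.trans (bilinear-combination A 1ℤ 1ℤ zero l 1ℤ 1ℤ zero)
            (≡.cong₂ (λ p q → 1ℤ ℤ.* (1ℤ ℤ.* p ℤ.- 1ℤ ℤ.* A zero l) ℤ.- 1ℤ ℤ.*
            (1ℤ ℤ.* A l zero ℤ.- 1ℤ ℤ.* q))
          (diagonal zero) (diagonal l) ⟨ ≡.trans ⟩ ≡.cong₂ (λ p q → 1ℤ ℤ.*
              (1ℤ ℤ.* 0ℤ ℤ.- 1ℤ ℤ.* p) ℤ.- 1ℤ ℤ.* (1ℤ ℤ.* q ℤ.- 1ℤ ℤ.* 0ℤ)) A₀ₗ≡0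
              (≡.trans (symmetric l zero) A₀ₗ≡0))

      xS : ∀ x → x l ≡ 0ℤ → ∀ j → ∑ (λ i → x i ℤ.* S i j) ≡ x j ℤ.- ∑ x ℤ.* 𝟙 l j
      xS x xₗ≡0 j = ≡.trans (elementary-row (λ _ → 1ℤ) β l x j)
          (≡.cong₂ (λ p q → p ℤ.- q ℤ.* 𝟙 l j) (ℤ.*-identityˡ (x j)) (begin
        ∑ (λ i → x i ℤ.* (1ℤ ℤ.- 𝟙 i l))
          ≡⟨ ∑-cong term ⟩
        ∑ (λ i → x i ℤ.+ ℤ.- (𝟙 l i ℤ.* x i))
          ≡⟨ ≡.trans (∑-+ x (λ i → ℤ.- (𝟙 l i ℤ.* x i))) (≡.cong (ℤ._+_ (∑ x))
              (≡.trans (∑-neg (λ i → 𝟙 l i ℤ.* x i)) (≡.cong ℤ.-_ (≡.trans (∑-𝟙 l x) xₗ≡0)))) ⟩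
        ∑ x ℤ.+ ℤ.- 0ℤ
          ≡⟨ ℤ.+-identityʳ _ ⟩
        ∑ x ∎))
        where
        open ≡.≡-Reasoning
        expand : ∀ x d → x ℤ.* (1ℤ ℤ.- d) ≡ x ℤ.+ ℤ.- (d ℤ.* x)
        expand = solve-∀
        term : ∀ i → x i ℤ.* (1ℤ ℤ.- 𝟙 i l) ≡ x i ℤ.+ ℤ.- (𝟙 l i ℤ.* x i)
        term i = ≡.trans (expand (x i) (𝟙 i l)) (≡.cong (λ z → x i ℤ.+ ℤ.- (z ℤ.* x i)) (D₀.𝟙-sym i l))

      T-pos : PositiveOffLast T
      T-pos x xₗ≡0 (i , xᵢ≢0) = ≡.subst (0ℤ ℤ.<_) (≡.sym (quadratic-congruent A S x))
        (positive _ ∑xS≡0 (i , λ e → xᵢ≢0 (≡.trans (≡.sym xSᵢ) e)))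
        where
        ∑xS≡0 : ∑ (λ j → ∑ λ i → x i ℤ.* S i j) ≡ 0ℤ
        ∑xS≡0 = ≡.trans (∑-cong (xS x xₗ≡0)) (≡.trans (∑-+ x (λ j → ℤ.- (∑ x ℤ.* 𝟙 l j)))
          (≡.trans (≡.cong (ℤ._+_ (∑ x)) (≡.trans (∑-neg (λ j → ∑ x ℤ.* 𝟙 l j)) (≡.cong ℤ.-_
            (≡.trans (≡.sym (*-∑ (∑ x) (𝟙 l))) (≡.trans (≡.cong (ℤ._*_ (∑ x)) (∑𝟙 l))
                (ℤ.*-identityʳ (∑ x)))))))
            (ℤ.+-inverseʳ (∑ x))))
        l≢i : l ≢ i
        l≢i l≡i = xᵢ≢0 (≡.trans (≡.cong x (≡.sym l≡i)) xₗ≡0)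
        simplify : ∀ a b → a ℤ.- b ℤ.* 0ℤ ≡ a
        simplify = solve-∀
        xSᵢ : ∑ (λ k → x k ℤ.* S k i) ≡ x i
        xSᵢ = ≡.trans (xS x xₗ≡0 i) (≡.trans (≡.cong (λ z → x i ℤ.- ∑ x ℤ.* z) (𝟙-off l≢i))
            (simplify (x i) (∑ x)))

    conditionallyPositive-Det<0 : Det A ℤ.< 0ℤ
    conditionallyPositive-Det<0 = Det-congruent<0 A S (Det<0-pivot T (congruent-sym A symmetric S) T-pos
      -- Since the last diagonal entry of T is 0 and T₀ₗ = A₀ₗ, the pivot condition reduces to -A₀ₗ²
      -- < 0.
      (≡.subst (ℤ._< 0ℤ) (≡.sym (≡.cong₂ (λ p q → T zero zero ℤ.* p ℤ.- q ℤ.* q)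
          (≡.trans (entry′ l) (diagonal l)) (entry′ zero)))
        (≡.subst (ℤ._< 0ℤ) (simplify (T zero zero) (A zero l)) (ℤ.neg-mono-< (0<i*i A₀ₗ≢0)))))
      where
      simplify : ∀ t a → ℤ.- (a ℤ.* a) ≡ t ℤ.* 0ℤ ℤ.- a ℤ.* a
      simplify = solve-∀

  module _ {n} (A : Matrix ℤ (suc n)) (A-cp : ConditionallyPositive A) where
    open ConditionallyPositive A-cp

    conditionallyPositive-minor : ∀ k → ConditionallyPositive (minor k k A)
    conditionallyPositive-minor k = record
      { symmetric = λ i j → symmetric (punchIn k i) (punchIn k j)
      ; diagonal  = λ i → diagonal (punchIn k i)
      ; positive  = λ x ∑x≡0 (i , xᵢ≢0) → ≡.subst (0ℤ ℤ.<_) (≡.sym (quadratic-minor x))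
          (positive (insertAt x k 0ℤ) (≡.trans (∑-insertAt x (λ _ z → z) (λ _ → ≡.refl)) ∑x≡0)
            (punchIn k i , λ e → xᵢ≢0 (≡.trans (≡.sym (insertAt-punchIn x k 0ℤ i)) e)))
      }
      where
      -- The general f lets one identity handle the coordinate sum and both nested sums of the
      -- quadratic form when a vector is extended by 0 at k.
      ∑-insertAt : ∀ (x : Vector ℤ n) (f : Fin (suc n) → ℤ → ℤ) → (∀ i → f i 0ℤ ≡ 0ℤ) →
        ∑ (λ i → f i (insertAt x k 0ℤ i)) ≡ ∑ (λ i → f (punchIn k i) (x i))
      ∑-insertAt x f f0≡0 = ≡.trans (∑-remove k (λ i → f i (insertAt x k 0ℤ i))) (≡.trans
        (≡.cong₂ ℤ._+_ (≡.trans (≡.cong (f k) (insertAt-lookup x k 0ℤ)) (f0≡0 k))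
          (∑-cong λ i → ≡.cong (f (punchIn k i)) (insertAt-punchIn x k 0ℤ i)))
        (ℤ.+-identityˡ _))
      quadratic-minor : ∀ x → quadratic (minor k k A) x ≡ quadratic A (insertAt x k 0ℤ)
      quadratic-minor x = ≡.sym (≡.trans
        (∑-insertAt x (λ i z → z ℤ.* ∑ λ j → A i j ℤ.* insertAt x k 0ℤ j)
            (λ i → ℤ.*-zeroˡ (∑ λ j → A i j ℤ.* insertAt x k 0ℤ j)))
        (∑-cong λ i → ≡.cong (ℤ._*_ (x i)) (∑-insertAt x (λ j z → A (punchIn k i) j ℤ.* z)
            (λ j → ℤ.*-zeroʳ (A (punchIn k i) j)))))

  charSeries-derivative : ∀ {n} (A : Matrix ℤ (suc n)) k →
    + suc k ℤ.* charSeries A (suc k) ≡ ∑ (λ i → charSeries (minor i i A) k)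
  charSeries-derivative A k = begin
    + suc k ℤ.* charSeries A (suc k)
      ≡⟨ ×≡* (suc k) _ ⟨
    V₀.derivative (charSeries A) k
      ≡⟨ V₁.d-Det-trace V₀.formalDerivative (charMatrix A) on off k ⟩
    D₁.∑ (λ i → D₁.Det (D₁.minor i i (charMatrix A))) k
      ≡⟨ D₁.∑-cong (λ i → D₁.Det-cong λ a b → R₁.+-congʳ {P₁.const# (minor i i A a b)}
           (R₁.*-congˡ {P₁.X#} (R₁.reflexive (D₁.𝟙-punchIn i a b)))) k ⟩
    D₁.∑ (λ i → charSeries (minor i i A)) k
      ≡⟨ ∑-coefficient (λ i → charSeries (minor i i A)) k ⟩
    ∑ (λ i → charSeries (minor i i A) k) ∎
    where
    open ≡.≡-Reasoning
    module V₀ = Derivations ℤ-ring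
    module V₁ = Derivations ℤ⟦x⟧
    ∑-coefficient : ∀ {m} (f : Vector R₁.Carrier m) k → D₁.∑ f k ≡ ∑ (λ i → f i k)
    ∑-coefficient {zero}  f k = ≡.trans (D₁.∑-zero f k) (≡.sym (∑-zero _))
    ∑-coefficient {suc m} f k = ≡.trans (D₁.∑-suc f k)
      (≡.trans (≡.cong (ℤ._+_ (f zero k)) (∑-coefficient (f ∘ suc) k)) (≡.sym (∑-suc _)))
    open Derivation V₀.formalDerivative
    entry : ∀ i j → d (charMatrix A i j) R₁.≈ d (P₁.X# R₁.* D₁.𝟙 i j)
    entry i j k = ≡.trans (d-+ (P₁.X# R₁.* D₁.𝟙 i j) (P₁.const# (A i j)) k)
      (≡.trans (≡.cong (ℤ._+_ (d (P₁.X# R₁.* D₁.𝟙 i j) k)) (V₀.derivative-const# (A i j) k))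
          (ℤ.+-identityʳ _))
    on : ∀ i → d (charMatrix A i i) R₁.≈ R₁.1#
    on i = R₁.trans (entry i i) (R₁.trans (d-cong (R₁.trans
      (R₁.*-congˡ {P₁.X#} (R₁.reflexive (D₁.𝟙-diagonal i))) (R₁.*-identityʳ P₁.X#))) V₀.derivative-X#)
    off : ∀ i j → d (charMatrix A i (punchIn i j)) R₁.≈ R₁.0#
    off i j = R₁.trans (entry i (punchIn i j)) (R₁.trans (d-cong (R₁.trans
      (R₁.*-congˡ {P₁.X#} (R₁.reflexive (D₁.𝟙-off (punchInᵢ≢i i j ∘ ≡.sym)))) (R₁.zeroʳ P₁.X#)))
      (V₁.d-0 V₀.formalDerivative))

  charSeries-constant : ∀ {n} (A : Matrix ℤ n) → charSeries A 0 ≡ Det A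
  charSeries-constant A = ≡.trans (Det-homo ℤ⟦x⟧ ℤ-ring P₁.head-homo (charMatrix A))
    (D₀.Det-cong λ i j → ≡.trans (≡.cong (ℤ._+ A i j) (ℤ.*-zeroˡ (D₁.𝟙 i j 0))) (ℤ.+-identityˡ (A i j)))

  ∑<0 : ∀ {n} (f : Vector ℤ (suc n)) → (∀ i → f i ℤ.< 0ℤ) → ∑ f ℤ.< 0ℤ
  ∑<0 f f<0 = ≡.subst (ℤ._< 0ℤ) (≡.sym (∑-suc f)) (ℤ.+-mono-<-≤ (f<0 zero)
      (∑≤0 (f ∘ suc) (ℤ.<⇒≤ ∘ f<0 ∘ suc)))
    where
    ∑≤0 : ∀ {n} (f : Vector ℤ n) → (∀ i → f i ℤ.≤ 0ℤ) → ∑ f ℤ.≤ 0ℤ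
    ∑≤0 {zero}  f f≤0 = ℤ.≤-reflexive (∑-zero f)
    ∑≤0 {suc n} f f≤0 = ≡.subst (ℤ._≤ 0ℤ) (≡.sym (∑-suc f)) (ℤ.+-mono-≤ (f≤0 zero)
        (∑≤0 (f ∘ suc) (f≤0 ∘ suc)))

  -- Each derivative lowers the degree and the order by one. Writing the order as k + (m + 2) makes
  -- this definitional and leaves order at least 2 at k = 0, where the determinant is negative.
  charSeries<0 : ∀ k m (A : Matrix ℤ
      (k ℕ.+ suc (suc m))) → ConditionallyPositive A → charSeries A k ℤ.< 0ℤ
  charSeries<0 zero    m A A-cp = ≡.subst (ℤ._< 0ℤ) (≡.sym (charSeries-constant A))
      (conditionallyPositive-Det<0 A A-cp)
  charSeries<0 (suc k) m A A-cp = ℤ.≰⇒> λ 0≤ → ℤ.<⇒≱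
    (∑<0 (λ i → charSeries (minor i i A) k)
      (λ i → charSeries<0 k m (minor i i A) (conditionallyPositive-minor A A-cp i)))
    (≡.subst (0ℤ ℤ.≤_) (charSeries-derivative A k) (0≤i*j {+ suc k} (ℤ.+≤+ ℕ.z≤n) 0≤))

-- Walks and distances in a tree.

module TreeDistances where

  open import Defs hiding (δ)
  open import Data.Fin.Base using (Fin; zero; suc)
  open import Data.Fin.Properties using (_≟_)
  open import Data.Nat.Base as ℕ using (ℕ; zero; suc; z≤n; s≤s)
  import Data.Nat.Properties as ℕ
  open import Data.Product.Base using (∃-syntax; _×_; _,_; proj₁; proj₂)
  open import Data.Sum.Base using (_⊎_; inj₁; inj₂)
  open import Data.Unit.Base using (⊤; tt)
  open import Data.Vec.Base as Vec using (Vec; []; _∷_)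
  open import Data.Vec.Relation.Unary.All as All using (All; []; _∷_)
  open import Data.Vec.Relation.Unary.AllPairs.Core using ([]; _∷_)
  open import Data.Vec.Relation.Unary.Linked using (Linked; [-]; _∷_)
  open import Data.Vec.Relation.Unary.Unique.Propositional using (Unique)
  open import Relation.Binary.PropositionalEquality as ≡ using (_≡_; _≢_)
  open import Relation.Nullary using (yes; no)
  open import Relation.Nullary.Negation using (contradiction)

  module Walks {n} (G : Graph n) where
    open Graph G

    -- P holds at every vertex visited. Taking P to be `_≢ v` expresses that v is avoided, a
    -- property that survives shortening a walk to a path.
    data Walk (P : Fin n → Set) : Fin n → Fin n → ℕ → Set where
      nil  : ∀ {u} → P u → Walk P u u 0
      cons : ∀ {u w v ℓ} → P u → Adj u w → Walk P w v ℓ → Walk P u v (suc ℓ)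

    module _ {P : Fin n → Set} where

      append : ∀ {u v w ℓ k} → Walk P u v ℓ → Walk P v w k → Walk P u w (ℓ ℕ.+ k)
      append (nil _)        q = q
      append (cons Pu e p) q = cons Pu e (append p q)

      target : ∀ {u v ℓ} → Walk P u v ℓ → P v
      target (nil Pu)     = Pu
      target (cons _ _ p) = target p

      reverse : ∀ {u v ℓ} → Walk P u v ℓ → Walk P v u ℓ
      reverse p = go p
        where
        snoc : ∀ {u v w ℓ} → Walk P u v ℓ → Adj v w → P w → Walk P u w (suc ℓ)
        snoc (nil Pu)      e Pw = cons Pu e (nil Pw)
        snoc (cons Pu f p) e Pw = cons Pu f (snoc p e Pw)
        go : ∀ {u v ℓ} → Walk P u v ℓ → Walk P v u ℓ
        go (nil Pu)      = nil Pu
        go (cons Pu e p) = snoc (go p) (sym e) Pu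

      PathIn : Fin n → Fin n → ℕ → Set
      PathIn u v ℓ = ∃[ vs ] (IsPath G u v {ℓ} vs × All P vs)

      -- Loop removal: if u already lies on the path, the part from u on replaces it; otherwise u is
      -- fresh and can be prefixed.
      suffix : ∀ u {v ℓ} (vs : Vec (Fin n)
          (suc ℓ)) → Vec.last vs ≡ v → Linked Adj vs → Unique vs → All P vs →
               (∃[ k ] (k ℕ.≤ ℓ × PathIn u v k)) ⊎ All (u ≢_) vs
      suffix u (x ∷ []) last≡v linked unique Pvs with u ≟ x
      ... | yes u≡x = inj₁ (0 , z≤n , x ∷ [] , (≡.sym u≡x , last≡v , linked , unique) , Pvs)
      ... | no  u≢x = inj₂ (u≢x ∷ [])
      suffix u (x ∷ y ∷ ys) last≡v (e ∷ linked) (x∉ ∷ unique) (Px ∷ Pvs) with u ≟ x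
      ... | yes u≡x = inj₁ (_ , ℕ.≤-refl , x ∷ y ∷ ys ,
          (≡.sym u≡x , last≡v , e ∷ linked , x∉ ∷ unique) , Px ∷ Pvs)
      ... | no  u≢x with suffix u (y ∷ ys) last≡v linked unique Pvs
      ...   | inj₁ (k , k≤ , path) = inj₁ (k , ℕ.m≤n⇒m≤1+n k≤ , path)
      ...   | inj₂ u∉             = inj₂ (u≢x ∷ u∉)

      walk⇒path : ∀ {u v ℓ} → Walk P u v ℓ → ∃[ k ] (k ℕ.≤ ℓ × PathIn u v k)
      walk⇒path {u} (nil Pu) = 0 , z≤n , u ∷ [] , (≡.refl , ≡.refl , [-] , ([] ∷ [])) , (Pu ∷ [])
      walk⇒path {u} (cons Pu e p) with walk⇒path p
      ... | k , k≤ , w ∷ ws , (≡.refl , last≡v , linked , unique) , Pws with suffix u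
          (w ∷ ws) last≡v linked unique Pws
      ...   | inj₁ (j , j≤ , path) = j , ℕ.m≤n⇒m≤1+n (ℕ.≤-trans j≤ k≤) , path
      ...   | inj₂ u∉ = suc k , s≤s k≤ , u ∷ w ∷ ws ,
          (≡.refl , last≡v , e ∷ linked , u∉ ∷ unique) , Pu ∷ Pws

    mapWalk : ∀ {P Q : Fin n → Set} → (∀ {z} → P z → Q z) → ∀ {u v ℓ} → Walk P u v ℓ → Walk Q u v ℓ
    mapWalk f (nil Pu)      = nil (f Pu)
    mapWalk f (cons Pu e p) = cons (f Pu) e (mapWalk f p)

    module Distances (conn : Connected G) where

      dist : Fin n → Fin n → ℕ
      dist = distance G conn

      dist-path : ∀ u v → HasPath G u v (dist u v)
      dist-path u v = proj₁ (proj₂ (shortestPath G conn u v))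

      dist-≤ : ∀ {P u v ℓ} → Walk P u v ℓ → dist u v ℕ.≤ ℓ
      dist-≤ {u = u} {v} p with walk⇒path p
      ... | k , k≤ , vs , path , _ = ℕ.≤-trans (proj₂ (proj₂ (shortestPath G conn u v)) k
          (vs , path)) k≤

      dist-refl : ∀ u → dist u u ≡ 0
      dist-refl u = ℕ.n≤0⇒n≡0 (dist-≤ {λ _ → ⊤} (nil tt))

      dist-walk : ∀ u v → Walk (λ _ → ⊤) u v (dist u v)
      dist-walk u v with dist-path u v
      ... | vs , head≡u , last≡v , linked , _ = ≡.subst₂ (λ a b → Walk _ a b
          (dist u v)) head≡u last≡v (fromLinked vs linked)
        where
        fromLinked : ∀ {ℓ} (vs : Vec (Fin n) (suc ℓ)) → Linked Adj vs → Walk (λ _ → ⊤) (Vec.head vs)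
            (Vec.last vs) ℓ
        fromLinked (x ∷ [])     [-]          = nil tt
        fromLinked (x ∷ y ∷ ys) (e ∷ linked) = cons tt e (fromLinked (y ∷ ys) linked)

      dist-sym : ∀ u v → dist u v ≡ dist v u
      dist-sym u v = ℕ.≤-antisym (dist-≤ (reverse (dist-walk v u))) (dist-≤ (reverse (dist-walk u v)))

      dist≡0 : ∀ {u v} → dist u v ≡ 0 → u ≡ v
      dist≡0 {u} {v} d≡0 with ≡.subst (Walk _ u v) d≡0 (dist-walk u v)
      ... | nil _ = ≡.refl

      next : ∀ {u v k} → dist u v ≡ suc k → ∃[ w ] (Adj u w × dist w v ≡ k)
      next {u} {v} {k} d≡ with ≡.subst (Walk _ u v) d≡ (dist-walk u v)
      ... | cons {w = w} _ e p = w , e , ℕ.≤-antisym (dist-≤ p)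
        (ℕ.s≤s⁻¹ (≡.subst (ℕ._≤ suc (dist w v)) d≡ (dist-≤ (cons tt e (dist-walk w v)))))

      -- A geodesic carrying a bound on the distance to its target, from which it is immediate that
      -- it avoids any vertex farther away.
      descent : ∀ {u v} k → dist u v ≡ k → Walk (λ z → dist z v ℕ.≤ k) u v k
      descent {u} zero    d≡ with dist≡0 d≡
      ... | ≡.refl = nil (ℕ.≤-reflexive d≡)
      descent (suc k) d≡ with next d≡
      ... | w , e , d′≡ = cons (ℕ.≤-reflexive d≡) e (mapWalk ℕ.m≤n⇒m≤1+n (descent k d′≡))

      module _ (acyclic : Acyclic G) where

        -- A path of positive length from c to p that avoids v closes up through v to a cycle on at
        -- least three vertices, so only length 0 is possible.
        neighbours-separated : ∀ {v c p ℓ} → Adj v c → Adj v p → Walk (_≢ v) c p ℓ → c ≡ p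
        neighbours-separated {v} {c} {p} v~c v~p walk with walk⇒path walk
        ... | zero , _ , x ∷ [] , (≡.refl , ≡.refl , _) , _ = ≡.refl
        ... | suc k , _ , x ∷ y ∷ ys , (≡.refl , ≡.refl , linked , unique) , avoid =
          contradiction (v~c ∷ linked , All.map (λ z≢v v≡z → z≢v (≡.sym v≡z)) avoid ∷ unique , sym v~p)
            (acyclic (v ∷ x ∷ y ∷ ys))

        -- Otherwise the shortest paths from v to w, from w to r and from p to r
        -- would close up to a cycle through v.
        parent-distance : ∀ {r v p w k} → Adj v p → dist v r ≡ suc k → dist p r ≡ k →
                          dist w r ℕ.≤ dist v r → w ≢ v → dist v w ≡ suc (dist p w)
        parent-distance {r} {v} {p} {w} {k} v~p vr pr w≤v w≢v with dist v w in vw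
        ... | zero  = contradiction (≡.sym (dist≡0 vw)) w≢v
        ... | suc j with next vw
        ...   | c , v~c , cw = ≡.cong suc (≡.trans (≡.sym cw) (≡.cong (λ z → dist z w)
          (neighbours-separated v~c v~p (append c→w (append (w→r _ ≡.refl) r→p)))))
          where
          below : ∀ {m t z} → dist v t ≡ suc m → dist z t ℕ.≤ m → z ≢ v
          below {m} vt z≤ ≡.refl = ℕ.<⇒≱ (ℕ.≤-reflexive (≡.sym vt)) z≤
          c→w : Walk (_≢ v) c w j
          c→w = mapWalk (below vw) (descent j cw)
          r→p : Walk (_≢ v) r p k
          r→p = reverse (mapWalk (below vr) (descent k pr))
          -- The start w may be as far from r as v is, so it avoids v by `w≢v`; every later vertex
          -- is strictly closer to r than v.
          w→r : ∀ m → dist w r ≡ m → Walk (_≢ v) w r m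
          w→r zero wr with dist≡0 wr
          ... | ≡.refl = nil w≢v
          w→r (suc m) wr with next wr
          ... | w′ , e , w′r = cons w≢v e (mapWalk (λ z≤m → below vr
            (ℕ.≤-trans z≤m (ℕ.s≤s⁻¹ (≡.subst₂ ℕ._≤_ wr vr w≤v)))) (descent m w′r))

-- The quadratic form of the distances of a tree.

module TreeQuadraticForm where

  open import Defs hiding (δ)
  open import Data.Fin.Base using (Fin; zero; suc; toℕ)
  open import Data.Fin.Properties using (any?; toℕ<n; toℕ-injective) renaming (_≟_ to _≟ᶠ_)
  open import Data.Integer.Base as ℤ using (ℤ; +_; 0ℤ; 1ℤ)
  import Data.Integer.Properties as ℤ
  open import Data.Integer.Tactic.RingSolver using (solve-∀)
  open import Data.Nat.Base as ℕ using (ℕ; zero; suc)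
  open import Data.Nat.DivMod using (_%_; [m+kn]%n≡m%n; m<n⇒m%n≡m)
  import Data.Nat.Properties as ℕ
  open import Data.Product.Base using (∃-syntax; _×_; _,_; proj₁; proj₂)
  open import Data.Sum.Base using (_⊎_; inj₁; inj₂)
  open import Data.Vec.Functional using (Vector)
  open import Function.Base using (_∘_)
  open import Relation.Binary.PropositionalEquality as ≡ using (_≡_; _≢_)
  open import Relation.Nullary using (Dec; yes; no)
  open import Relation.Nullary.Decidable using (¬?; _×-dec_)
  open import Relation.Nullary.Negation using (contradiction)
  open DeterminantTheory
  open CharacteristicSeries
  open ConditionalPositivity
  open TreeDistances

  open D₀ using (∑; ∑-cong; ∑-+; *-∑; ∑-neg; ∑-0; ∑-𝟙; 𝟙; 𝟙-diagonal; 𝟙-off)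

  ∑-𝟙-row : ∀ {n} (i : Fin n) → ∑ (𝟙 i) ≡ 1ℤ
  ∑-𝟙-row i = ≡.trans (∑-cong λ j → ≡.sym (ℤ.*-identityʳ (𝟙 i j))) (∑-𝟙 i (λ _ → 1ℤ))

  module TreeForm {n} (T : Graph (suc n)) (tree : IsTree T) where
    open IsTree tree
    open Walks T
    open Distances connected

    negDist : Matrix ℤ (suc n)
    negDist i j = ℤ.- (+ dist i j)

    negDist-sym : Symmetric negDist
    negDist-sym i j = ≡.cong (λ d → ℤ.- (+ d)) (dist-sym i j)

    negDist-diagonal : ∀ i → negDist i i ≡ 0ℤ
    negDist-diagonal i = ≡.cong (λ d → ℤ.- (+ d)) (dist-refl i)

    -- The coefficient of x at v is moved to p; the factors 1ℤ match bilinear--ˡ.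
    module Merge (x : Vector ℤ (suc n)) (∑x≡0 : ∑ x ≡ 0ℤ) (v p : Fin (suc n)) (vp : dist v p ≡ 1)
      (via-p : ∀ w → x w ≢ 0ℤ → w ≢ v → dist v w ≡ suc (dist p w)) where

      t : ℤ
      t = x v

      e : Vector ℤ (suc n)
      e j = 1ℤ ℤ.* 𝟙 v j ℤ.- 1ℤ ℤ.* 𝟙 p j

      merged : Vector ℤ (suc n)
      merged j = 1ℤ ℤ.* x j ℤ.- t ℤ.* e j

      v≢p : v ≢ p
      v≢p v≡p = contradiction (≡.trans (≡.sym vp) (≡.trans (≡.cong (dist v) (≡.sym v≡p))
          (dist-refl v))) λ ()

      private
        A : Matrix ℤ (suc n)
        A = negDist

        Avp : A v p ≡ ℤ.- 1ℤ
        Avp = ≡.cong (λ d → ℤ.- (+ d)) vp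

        e-e : bilinear A e e ≡ + 2
        e-e = ≡.trans (bilinear-combination A 1ℤ 1ℤ v p 1ℤ 1ℤ v) (≡.trans
          (≡.cong₂ (λ a b → 1ℤ ℤ.* (1ℤ ℤ.* a ℤ.- 1ℤ ℤ.* A v p) ℤ.- 1ℤ ℤ.*
              (1ℤ ℤ.* A p v ℤ.- 1ℤ ℤ.* b)) (negDist-diagonal v) (negDist-diagonal p))
          (≡.cong₂ (λ a b → 1ℤ ℤ.* (1ℤ ℤ.* 0ℤ ℤ.- 1ℤ ℤ.* a) ℤ.- 1ℤ ℤ.* (1ℤ ℤ.* b ℤ.- 1ℤ ℤ.* 0ℤ)) Avp
              (≡.trans (negDist-sym p v) Avp)))

        column : ∀ i → bilinear A x (𝟙 i) ≡ ∑ (λ w → x w ℤ.* A w i)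
        column i = ∑-cong λ w → ≡.cong (ℤ._*_ (x w)) (≡.trans
            (∑-cong λ b → ℤ.*-comm (A w b) (𝟙 i b)) (∑-𝟙 i (A w)))

        -- On the support `A w v` is `A w p` - 1 for w ≠ v, but `A v v` = `A v p` + 1; the indicator
        -- term supplies the difference of 2. In the sum over w the middle terms cancel because x
        -- has sum 0.
        term : ∀ w → x w ℤ.* A w v ≡ x w ℤ.* A w p ℤ.+ (ℤ.- x w ℤ.+ + 2 ℤ.* (𝟙 v w ℤ.* x w))
        term w with w ≟ᶠ v | x w ℤ.≟ 0ℤ
        ... | yes ≡.refl | _ = ≡.trans (≡.cong (ℤ._*_ (x v)) (negDist-diagonal v))
            (≡.trans (simplify (x v))
                (≡.cong₂ (λ a d → x v ℤ.* a ℤ.+ (ℤ.- x v ℤ.+ + 2 ℤ.* (d ℤ.* x v))) (≡.sym Avp)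
                    (≡.sym (𝟙-diagonal v))))
          where
          simplify : ∀ x → x ℤ.* 0ℤ ≡ x ℤ.* (ℤ.- 1ℤ) ℤ.+ (ℤ.- x ℤ.+ + 2 ℤ.* (1ℤ ℤ.* x))
          simplify = solve-∀
        ... | no _ | yes xw≡0 = ≡.subst (λ z → z ℤ.* A w v ≡ z ℤ.* A w p ℤ.+
            (ℤ.- z ℤ.+ + 2 ℤ.* (𝟙 v w ℤ.* z))) (≡.sym xw≡0)
                (simplify (A w v) (A w p) (𝟙 v w))
          where
          simplify : ∀ a b d → 0ℤ ℤ.* a ≡ 0ℤ ℤ.* b ℤ.+ (ℤ.- 0ℤ ℤ.+ + 2 ℤ.* (d ℤ.* 0ℤ))
          simplify = solve-∀
        ... | no w≢v | no xw≢0 = ≡.trans (≡.cong (ℤ._*_ (x w)) Awv)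
            (≡.trans (simplify (x w) (+ dist w p))
                (≡.cong (λ d → x w ℤ.* A w p ℤ.+ (ℤ.- x w ℤ.+ + 2 ℤ.* (d ℤ.* x w)))
                    (≡.sym (𝟙-off (w≢v ∘ ≡.sym)))))
          where
          Awv : A w v ≡ ℤ.- (1ℤ ℤ.+ + dist w p)
          Awv = ≡.cong (λ d → ℤ.- (+ d)) (≡.trans (dist-sym w v)
              (≡.trans (via-p w xw≢0 w≢v) (≡.cong suc (dist-sym p w))))
          simplify : ∀ x d → x ℤ.* (ℤ.- (1ℤ ℤ.+ d)) ≡ x ℤ.* (ℤ.- d) ℤ.+ (ℤ.- x ℤ.+ + 2 ℤ.* (0ℤ ℤ.* x))
          simplify = solve-∀

        x-e : bilinear A x e ≡ + 2 ℤ.* t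
        x-e = ≡.trans (bilinear--ʳ A 1ℤ 1ℤ x (𝟙 v) (𝟙 p)) (≡.trans
          (≡.cong₂ (λ a b → 1ℤ ℤ.* a ℤ.- 1ℤ ℤ.* b) (≡.trans (column v) sum) (column p))
          (simplify (∑ λ w → x w ℤ.* A w p) t))
          where
          sum : ∑ (λ w → x w ℤ.* A w v) ≡ ∑ (λ w → x w ℤ.* A w p) ℤ.+ (ℤ.- 0ℤ ℤ.+ + 2 ℤ.* t)
          sum = ≡.trans (∑-cong term) (≡.trans (∑-+ (λ w → x w ℤ.* A w p)
              (λ w → ℤ.- x w ℤ.+ + 2 ℤ.* (𝟙 v w ℤ.* x w)))
            (≡.cong (ℤ._+_ (∑ λ w → x w ℤ.* A w p)) (≡.trans
                (∑-+ (λ w → ℤ.- x w) (λ w → + 2 ℤ.* (𝟙 v w ℤ.* x w)))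
              (≡.cong₂ ℤ._+_ (≡.trans (∑-neg x) (≡.cong ℤ.-_ ∑x≡0))
                (≡.trans (≡.sym (*-∑ (+ 2) (λ w → 𝟙 v w ℤ.* x w))) (≡.cong (ℤ._*_ (+ 2)) (∑-𝟙 v x)))))))
          simplify : ∀ a t → 1ℤ ℤ.* (a ℤ.+ (ℤ.- 0ℤ ℤ.+ + 2 ℤ.* t)) ℤ.- 1ℤ ℤ.* a ≡ + 2 ℤ.* t
          simplify = solve-∀

      -- For q the form and B its bilinear form, q(x - te) = q(x) - 2t B(x, e) + t² q(e), where B(x,
      -- e) = 2t and q(e) = 2.
      quadratic-merged : quadratic negDist x ≡ quadratic negDist merged ℤ.+ + 2 ℤ.* (t ℤ.* t)
      quadratic-merged = ≡.trans (simplify (quadratic A x) t)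
          (≡.cong (ℤ._+ + 2 ℤ.* (t ℤ.* t)) (≡.sym (begin
        bilinear A merged merged
          ≡⟨ bilinear--ˡ A 1ℤ t x e merged ⟩
        1ℤ ℤ.* bilinear A x merged ℤ.- t ℤ.* bilinear A e merged
          ≡⟨ ≡.cong₂ (λ a b → 1ℤ ℤ.* a ℤ.- t ℤ.* b) (bilinear--ʳ A 1ℤ t x x e)
              (bilinear--ʳ A 1ℤ t e x e) ⟩
        1ℤ ℤ.* (1ℤ ℤ.* quadratic A x ℤ.- t ℤ.* bilinear A x e) ℤ.- t ℤ.*
            (1ℤ ℤ.* bilinear A e x ℤ.- t ℤ.* bilinear A e e)
          ≡⟨ ≡.cong₂ (λ a b → 1ℤ ℤ.* (1ℤ ℤ.* quadratic A x ℤ.- t ℤ.* a) ℤ.- t ℤ.*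
              (1ℤ ℤ.* b ℤ.- t ℤ.* bilinear A e e))
               x-e (≡.trans (bilinear-sym A negDist-sym e x) x-e) ⟩
        1ℤ ℤ.* (1ℤ ℤ.* quadratic A x ℤ.- t ℤ.* (+ 2 ℤ.* t)) ℤ.- t ℤ.*
            (1ℤ ℤ.* (+ 2 ℤ.* t) ℤ.- t ℤ.* bilinear A e e)
          ≡⟨ ≡.cong (λ a → 1ℤ ℤ.* (1ℤ ℤ.* quadratic A x ℤ.- t ℤ.* (+ 2 ℤ.* t)) ℤ.- t ℤ.*
              (1ℤ ℤ.* (+ 2 ℤ.* t) ℤ.- t ℤ.* a)) e-e ⟩
        1ℤ ℤ.* (1ℤ ℤ.* quadratic A x ℤ.- t ℤ.* (+ 2 ℤ.* t)) ℤ.- t ℤ.*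
            (1ℤ ℤ.* (+ 2 ℤ.* t) ℤ.- t ℤ.* + 2) ∎)))
        where
        open ≡.≡-Reasoning
        simplify : ∀ q t → q ≡ 1ℤ ℤ.* (1ℤ ℤ.* q ℤ.- t ℤ.* (+ 2 ℤ.* t)) ℤ.- t ℤ.*
            (1ℤ ℤ.* (+ 2 ℤ.* t) ℤ.- t ℤ.* + 2) ℤ.+ + 2 ℤ.* (t ℤ.* t)
        simplify = solve-∀

      ∑-merged : ∑ merged ≡ 0ℤ
      ∑-merged = ≡.trans (∑-+ (λ j → 1ℤ ℤ.* x j) (λ j → ℤ.- (t ℤ.* e j))) (≡.trans (≡.cong₂ ℤ._+_
        (≡.trans (≡.sym (*-∑ 1ℤ x)) (≡.cong (ℤ._*_ 1ℤ) ∑x≡0))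
        (≡.trans (∑-neg (λ j → t ℤ.* e j)) (≡.cong ℤ.-_ (≡.trans (≡.sym (*-∑ t e))
            (≡.cong (ℤ._*_ t) ∑e≡0)))))
        (≡.trans (ℤ.+-identityˡ _) (≡.cong ℤ.-_ (ℤ.*-zeroʳ t))))
        where
        ∑e≡0 : ∑ e ≡ 0ℤ
        ∑e≡0 = ≡.trans (∑-+ (λ j → 1ℤ ℤ.* 𝟙 v j) (λ j → ℤ.- (1ℤ ℤ.* 𝟙 p j))) (≡.cong₂ ℤ._+_
          (≡.trans (≡.sym (*-∑ 1ℤ (𝟙 v))) (≡.cong (ℤ._*_ 1ℤ) (∑-𝟙-row v)))
          (≡.trans (∑-neg (λ j → 1ℤ ℤ.* 𝟙 p j)) (≡.cong ℤ.-_
              (≡.trans (≡.sym (*-∑ 1ℤ (𝟙 p))) (≡.cong (ℤ._*_ 1ℤ) (∑-𝟙-row p))))))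

      merged-v : merged v ≡ 0ℤ
      merged-v = ≡.trans (≡.cong₂ (λ a b → 1ℤ ℤ.* x v ℤ.- t ℤ.* (1ℤ ℤ.* a ℤ.- 1ℤ ℤ.* b))
          (𝟙-diagonal v) (𝟙-off (v≢p ∘ ≡.sym)))
        (simplify (x v))
        where
        simplify : ∀ t → 1ℤ ℤ.* t ℤ.- t ℤ.* (1ℤ ℤ.* 1ℤ ℤ.- 1ℤ ℤ.* 0ℤ) ≡ 0ℤ
        simplify = solve-∀

      merged-other : ∀ w → w ≢ v → w ≢ p → merged w ≡ x w
      merged-other w w≢v w≢p = ≡.trans
        (≡.cong₂ (λ a b → 1ℤ ℤ.* x w ℤ.- t ℤ.* (1ℤ ℤ.* a ℤ.- 1ℤ ℤ.* b)) (𝟙-off (w≢v ∘ ≡.sym))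
            (𝟙-off (w≢p ∘ ≡.sym)))
        (simplify (x w) t)
        where
        simplify : ∀ a t → 1ℤ ℤ.* a ℤ.- t ℤ.* (1ℤ ℤ.* 0ℤ ℤ.- 1ℤ ℤ.* 0ℤ) ≡ a
        simplify = solve-∀

    private
      root : Fin (suc n)
      root = zero

      depth : Fin (suc n) → ℕ
      depth v = dist v root

      -- Orders the vertices by depth, with ties broken by their number.
      key : Fin (suc n) → ℕ
      key v = toℕ v ℕ.+ depth v ℕ.* suc n

      key-injective : ∀ {v w} → key v ≡ key w → v ≡ w
      key-injective {v} {w} kv≡kw = toℕ-injective (≡.trans (≡.sym (key-% v))
          (≡.trans (≡.cong (_% suc n) kv≡kw) (key-% w)))
        where
        key-% : ∀ u → key u % suc n ≡ toℕ u
        key-% u = ≡.trans ([m+kn]%n≡m%n (toℕ u) (depth u) (suc n)) (m<n⇒m%n≡m (toℕ<n u))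

      key-< : ∀ {v w} → depth v ℕ.< depth w → key v ℕ.< key w
      key-< {v} {w} dv<dw = ℕ.<-≤-trans (ℕ.+-monoˡ-< (depth v ℕ.* suc n) (toℕ<n v))
        (ℕ.≤-trans (ℕ.*-monoˡ-≤ (suc n) dv<dw) (ℕ.m≤n+m _ (toℕ w)))

      depth-≤ : ∀ {v w} → key v ℕ.≤ key w → depth v ℕ.≤ depth w
      depth-≤ kv≤kw = ℕ.≮⇒≥ λ dw<dv → ℕ.<⇒≱ (key-< dw<dv) kv≤kw

      depth-case : ∀ v → depth v ≡ 0 ⊎ (∃[ k ] depth v ≡ suc k)
      depth-case v with depth v
      ... | zero  = inj₁ ≡.refl
      ... | suc k = inj₂ (k , ≡.refl)

      -- Induction on a strict bound for the keys of the support. If the top key occurs at v,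
      -- merging v into its parent, whose key is smaller, lowers the bound and costs the positive
      -- amount 2t².
      positive-below : ∀ K x → ∑ x ≡ 0ℤ →
          (∀ w → x w ≢ 0ℤ → key w ℕ.< K) → NonZeroVec x → 0ℤ ℤ.< quadratic negDist x
      positive-below zero    x ∑x≡0 below (i , xᵢ≢0) = contradiction (below i xᵢ≢0) λ ()
      positive-below (suc K) x ∑x≡0 below x≢0 with any? (λ v → (key v ℕ.≟ K) ×-dec ¬? (x v ℤ.≟ 0ℤ))
      ... | no none = positive-below K x ∑x≡0 (λ w xw≢0 → ℕ.≤∧≢⇒<
          (ℕ.s≤s⁻¹ (below w xw≢0)) λ kw≡K → none (w , kw≡K , xw≢0)) x≢0
      ... | yes (v , kv≡K , xv≢0) with depth-case v
      -- A vertex of largest key at depth 0 forces the whole support to be the root, and then the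
      -- sum of x is `x v`.
      ...   | inj₁ dv = contradiction (≡.trans (≡.sym (∑-𝟙 v x)) (≡.trans (∑-cong only-v) ∑x≡0)) xv≢0
        where
        only-v : ∀ w → 𝟙 v w ℤ.* x w ≡ x w
        only-v w = at (v ≟ᶠ w) (x w ℤ.≟ 0ℤ)
          where
          at : Dec (v ≡ w) → Dec (x w ≡ 0ℤ) → 𝟙 v w ℤ.* x w ≡ x w
          at (yes ≡.refl) _          = ≡.trans (≡.cong (ℤ._* x v) (𝟙-diagonal v)) (ℤ.*-identityˡ (x v))
          at (no _)       (yes xw≡0) = ≡.trans (≡.cong (ℤ._*_ (𝟙 v w)) xw≡0)
              (≡.trans (ℤ.*-zeroʳ (𝟙 v w)) (≡.sym xw≡0))
          at (no v≢w)     (no xw≢0)  = contradiction (≡.trans (dist≡0 dv) (≡.sym (dist≡0 (ℕ.n≤0⇒n≡0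
            (≡.subst (depth w ℕ.≤_) dv (depth-≤ {w} {v} (≡.subst (key w ℕ.≤_) (≡.sym kv≡K)
                (ℕ.s≤s⁻¹ (below w xw≢0))))))))) v≢w
      ...   | inj₂ (k , dv) with next dv
      ...     | p , v~p , dp = ≡.subst (0ℤ ℤ.<_) (≡.sym quadratic-merged)
          (ℤ.+-mono-≤-< q≥0 (0<i*j {+ 2} (ℤ.+<+ (ℕ.s≤s ℕ.z≤n)) (0<i*i xv≢0)))
        where
        p<v : depth p ℕ.< depth v
        p<v = ℕ.≤-reflexive (≡.trans (≡.cong suc dp) (≡.sym dv))
        via-p : ∀ w → depth w ℕ.≤ depth v → w ≢ v → dist v w ≡ suc (dist p w)
        via-p w = parent-distance acyclic v~p dv dp
        vp : dist v p ≡ 1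
        vp = ≡.trans (via-p p (ℕ.<⇒≤ p<v) λ { ≡.refl → ℕ.<-irrefl ≡.refl p<v })
            (≡.cong suc (dist-refl p))
        open Merge x ∑x≡0 v p vp (λ w xw≢0 → via-p w (depth-≤ {w} {v}
            (≡.subst (key w ℕ.≤_) (≡.sym kv≡K) (ℕ.s≤s⁻¹ (below w xw≢0)))))
        below′ : ∀ w → merged w ≢ 0ℤ → key w ℕ.< K
        below′ w mw≢0 with w ≟ᶠ v | w ≟ᶠ p
        ... | yes ≡.refl | _          = contradiction merged-v mw≢0
        ... | no _       | yes ≡.refl = ≡.subst (key p ℕ.<_) kv≡K (key-< p<v)
        ... | no w≢v     | no w≢p     = ℕ.≤∧≢⇒< (ℕ.s≤s⁻¹ (below w
            (mw≢0 ∘ ≡.trans (merged-other w w≢v w≢p))))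
                                          λ kw≡K → w≢v (key-injective (≡.trans kw≡K (≡.sym kv≡K)))
        -- The merged vector may be zero, so only nonnegativity is claimed here; strictness comes
        -- from 2t².
        q≥0 : 0ℤ ℤ.≤ quadratic negDist merged
        q≥0 with any? (λ w → ¬? (merged w ℤ.≟ 0ℤ))
        ... | yes nz = ℤ.<⇒≤ (positive-below K merged ∑-merged below′ nz)
        ... | no  none = ℤ.≤-reflexive (≡.sym (∑-0 λ w → ≡.cong
            (ℤ._* ∑ (λ b → negDist w b ℤ.* merged b)) (merged≡0 w)))
          where
          merged≡0 : ∀ w → merged w ≡ 0ℤ
          merged≡0 w with merged w ℤ.≟ 0ℤ
          ... | yes mw≡0 = mw≡0
          ... | no  mw≢0 = contradiction (w , mw≢0) none

      key-bound : ∃[ K ] (∀ w → key w ℕ.< K)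
      key-bound = go key
        where
        go : ∀ {m} (f : Fin m → ℕ) → ∃[ K ] (∀ w → f w ℕ.< K)
        go {zero}  f = 0 , λ ()
        go {suc m} f = let K , f< = go (f ∘ suc) in
          suc (f zero) ℕ.⊔ K , λ where
            zero    → ℕ.m≤m⊔n (suc (f zero)) K
            (suc w) → ℕ.≤-trans (f< w) (ℕ.m≤n⊔m (suc (f zero)) K)

    negDist-conditionallyPositive : ConditionallyPositive negDist
    negDist-conditionallyPositive = record
      { symmetric = negDist-sym
      ; diagonal  = negDist-diagonal
      ; positive  = λ x ∑x≡0 → positive-below (proj₁ key-bound) x ∑x≡0 (λ w _ → proj₂ key-bound w)
      }

open import Defs
open import Algebra.Bundles using (CommutativeRing)
open import Algebra.Morphism.Structures using (module RingMorphisms)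
import Algebra.Properties.CommutativeSemigroup as CommutativeSemigroupProperties
open import Data.Fin.Base using (Fin; zero; suc)
open import Data.Fin.Properties using () renaming (_≟_ to _≟ᶠ_)
open import Data.Integer.Base as ℤ using (ℤ; +_; 0ℤ; 1ℤ; ∣_∣)
import Data.Integer.Properties as ℤ
open import Data.Integer.Tactic.RingSolver using (solve-∀)
open import Data.List.Base as List using ([]; _∷_)
open import Data.Nat.Base as ℕ using (ℕ; zero; suc; _≤_; _∸_; _^_)
import Data.Nat.Properties as ℕ
open import Data.Product.Base using (∃-syntax; _×_; _,_)
open import Data.Rational.Base as ℚ using (ℚ; 0ℚ)
import Data.Rational.Properties as ℚ
open import Data.Rational.Unnormalised.Base using (mkℚᵘ; *≤*) renaming (_≃_ to _≃ᵘ_)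
import Data.Rational.Unnormalised.Properties as ℚᵘ
open import Relation.Binary.PropositionalEquality as ≡ using (_≡_)
open import Data.Sum.Base using (inj₁; inj₂)
open import Relation.Nullary using (yes; no)
open import Relation.Nullary.Negation using (contradiction)
open DeterminantTheory
open SeriesTheory
open GramDeterminants
open CharacteristicSeries
open ConditionalPositivity
open TreeDistances
open TreeQuadraticForm

-- Comparison of list polynomials with series.

coeff-homo : Hom polyRawRing R₁.rawRing coeff
coeff-homo = mkHom coeff (λ p≈q → p≈q) +-homo *-homo neg-homo (λ _ → ≡.refl)
  λ { zero → ≡.refl ; (suc k) → ≡.refl }
  where
  +-homo : ∀ p q k → coeff (p +ₚ q) k ≡ coeff p k ℤ.+ coeff q k
  +-homo []      q       k       = ≡.sym (ℤ.+-identityˡ _)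
  +-homo (a ∷ p) []      k       = ≡.sym (ℤ.+-identityʳ _)
  +-homo (a ∷ p) (b ∷ q) zero    = ≡.refl
  +-homo (a ∷ p) (b ∷ q) (suc k) = +-homo p q k
  map-coeff : ∀ (f : ℤ → ℤ) → f 0ℤ ≡ 0ℤ → ∀ p k → coeff (List.map f p) k ≡ f (coeff p k)
  map-coeff f f0 []      k       = ≡.sym f0
  map-coeff f f0 (a ∷ p) zero    = ≡.refl
  map-coeff f f0 (a ∷ p) (suc k) = map-coeff f f0 p k
  neg-homo : ∀ p k → coeff (-ₚ p) k ≡ ℤ.- coeff p k
  neg-homo = map-coeff ℤ.-_ ≡.refl
  *-homo : ∀ p q k → coeff (p *ₚ q) k ≡ (coeff p P₁.⊛ coeff q) k
  *-homo []      q k = ≡.sym (P₁.0⊛ (coeff q) k)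
  *-homo (a ∷ p) q k = ≡.trans (+-homo (List.map (a ℤ.*_) q) (0ℤ ∷ p *ₚ q) k) (≡.trans
    (≡.cong (ℤ._+ coeff (0ℤ ∷ p *ₚ q) k) (map-coeff (ℤ._*_ a) (ℤ.*-zeroʳ a) q k)) (rest k))
    where
    rest : ∀ k → a ℤ.* coeff q k ℤ.+ coeff (0ℤ ∷ p *ₚ q) k ≡ (coeff (a ∷ p) P₁.⊛ coeff q) k
    rest zero    = ℤ.+-identityʳ _
    rest (suc k) = ≡.cong (ℤ._+_ (a ℤ.* coeff q (suc k))) (*-homo p q k)

module _ {n} (D : Matrix ℤ n) where
  private
    -D : Matrix ℤ n
    -D i j = ℤ.- D i j

    coeff-xI : ∀ (i j : Fin n) k → coeff (xI i j) k ≡ (P₁.X# P₁.⊛ D₁.𝟙 i j) k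
    coeff-xI i j k with i ≟ᶠ j
    ... | yes _ = ≡.sym (≡.trans (P₁.X#-⊛ R₁.1# k) (X-coeff k))
      where
      X-coeff : ∀ k → P₁.shift R₁.1# k ≡ coeff X k
      X-coeff zero          = ≡.refl
      X-coeff (suc zero)    = ≡.refl
      X-coeff (suc (suc k)) = ≡.refl
    ... | no  _ = ≡.sym (R₁.zeroʳ P₁.X# k)

    module C = RingMorphisms.IsRingHomomorphism coeff-homo

    coeff-const : ∀ a k → coeff (const a) k ≡ P₁.const# a k
    coeff-const a zero    = ≡.refl
    coeff-const a (suc k) = ≡.refl

    coeff-difference : ∀ i j k → coeff (xI i j) k ℤ.- P₁.const# (D i j) k ≡ charMatrix -D i j k
    coeff-difference i j k = ≡.cong₂ ℤ._+_ (coeff-xI i j k) (neg-const k)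
      where
      neg-const : ∀ k → ℤ.- P₁.const# (D i j) k ≡ P₁.const# (-D i j) k
      neg-const zero    = ≡.refl
      neg-const (suc k) = ≡.refl

  coeff-det-xI-D : ∀ k → coeff (detₚ (xI -ₘ constMatrix D)) k ≡ charSeries -D k
  coeff-det-xI-D = det-Det-homo ℤ⟦x⟧ coeff-homo (xI -ₘ constMatrix D) λ i j k →
    ≡.trans (C.+-homo (xI i j) (-ₚ const (D i j)) k) (≡.trans
      (≡.cong (ℤ._+_ (coeff (xI i j) k)) (≡.trans (C.-‿homo (const (D i j)) k)
          (≡.cong ℤ.-_ (coeff-const (D i j) k))))
      (coeff-difference i j k))

  -- D - xI is the negative of xI - D, so the determinants differ by the sign (-1)^n, which the
  -- absolute value removes.
  ∣coeff-det-D-xI∣ : ∀ k → ∣ coeff (detₚ (constMatrix D -ₘ xI)) k ∣ ≡ ∣ charSeries -D k ∣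
  ∣coeff-det-D-xI∣ k = ≡.trans (≡.cong ∣_∣ (≡.trans (det-Det-homo ℤ⟦x⟧ coeff-homo
      (constMatrix D -ₘ xI) {λ i j → R₁.- charMatrix -D i j} entry k)
      (D₁.Det-neg (charMatrix -D) k))) (∣sgn∣ n (charSeries -D) k)
    where
    entry : ∀ i j k → coeff (const (D i j) -ₚ xI i j) k ≡ ℤ.- charMatrix -D i j k
    entry i j k = ≡.trans (C.+-homo (const (D i j)) (-ₚ xI i j) k) (≡.trans
      (≡.cong₂ ℤ._+_ (coeff-const (D i j) k) (C.-‿homo (xI i j) k))
      (≡.trans (flip-sub (P₁.const# (D i j) k) (coeff (xI i j) k))
          (≡.cong ℤ.-_ (coeff-difference i j k))))
      where
      flip-sub : ∀ a b → a ℤ.+ ℤ.- b ≡ ℤ.- (b ℤ.- a)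
      flip-sub = solve-∀
    ∣sgn∣ : ∀ m F k → ∣ D₁.sgn m F k ∣ ≡ ∣ F k ∣
    ∣sgn∣ zero    F k = ≡.cong ∣_∣ (D₁.sgn-zero F k)
    ∣sgn∣ (suc m) F k = ≡.trans (≡.cong ∣_∣ (D₁.sgn-suc m F k))
        (≡.trans (ℤ.∣-i∣≡∣i∣ (D₁.sgn m F k)) (∣sgn∣ m F k))

charSeries-negative : ∀ {n} (A : Matrix ℤ n) → ConditionallyPositive A → ∀ k → suc
    (suc k) ≤ n → charSeries A k ℤ.< 0ℤ
charSeries-negative {n} A A-cp k k+2≤n = go (n ∸ suc (suc k))
    (≡.trans (ℕ.+-suc k (suc m)) (≡.trans (≡.cong suc (ℕ.+-suc k m)) (ℕ.m+[n∸m]≡n k+2≤n))) A A-cp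
  where
  m : ℕ
  m = n ∸ suc (suc k)
  go : ∀ m → k ℕ.+ suc (suc m) ≡ n → (A : Matrix ℤ n) → ConditionallyPositive A → charSeries A k ℤ.< 0ℤ
  go m ≡.refl = charSeries<0 k m

-- Unimodality and the passage to rational sequences.

module _ (z : ℕ → ℤ) where

  LogConcaveℤ : ℕ → Set
  LogConcaveℤ m = ∀ k → suc (suc k) ≤ m → z k ℤ.* z (suc (suc k)) ℤ.≤ z (suc k) ℤ.* z (suc k)

  Positiveℤ : ℕ → Set
  Positiveℤ m = ∀ k → k ≤ m → 0ℤ ℤ.< z k

  UnimodalAt : ℕ → ℕ → Set
  UnimodalAt m k = (∀ i → suc i ≤ k → z i ℤ.≤ z (suc i)) × (∀ i → k ≤ i → i ℕ.< m → z (suc i) ℤ.≤ z i)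

  -- Induction on the length. A peak before the old end stays, since the descent continues; if it is
  -- the old end, comparing the last two values decides whether it moves.
  logConcave⇒unimodal : ∀ m → LogConcaveℤ m → Positiveℤ m → ∃[ k ] (k ≤ m × UnimodalAt m k)
  logConcave⇒unimodal zero    lc pos = 0 , ℕ.z≤n , (λ _ ()) , λ _ _ ()
  logConcave⇒unimodal (suc m) lc pos with logConcave⇒unimodal m (λ k k≤ → lc k (ℕ.m≤n⇒m≤1+n k≤))
      (λ k k≤ → pos k (ℕ.m≤n⇒m≤1+n k≤))
  ... | k , k≤m , up , down with ℕ.m≤n⇒m<n∨m≡n k≤m
  ...   | inj₁ k<m = k , ℕ.m≤n⇒m≤1+n k≤m , up , down′ m k<m lc pos down
    where
    down′ : ∀ m → k ℕ.< m → LogConcaveℤ (suc m) → Positiveℤ (suc m) →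
        (∀ i → k ≤ i → i ℕ.< m → z (suc i) ℤ.≤ z i) →
            ∀ i → k ≤ i → i ℕ.< suc m → z (suc i) ℤ.≤ z i
    down′ (suc m) k<m lc pos down i k≤i i<m with ℕ.m≤n⇒m<n∨m≡n (ℕ.s≤s⁻¹ i<m)
    ... | inj₁ i<m′   = down i k≤i i<m′
    -- The descent continues because z_(m+1) z_(m+2) ≤ z_m z_(m+2) ≤ z_(m+1)², from which the
    -- positive z_(m+1) is cancelled.
    ... | inj₂ ≡.refl = ℤ.*-cancelˡ-≤-pos _ _ (z (suc m)) {{ℤ.positive
        (pos (suc m) (ℕ.n≤1+n (suc m)))}} (ℤ.≤-trans
      (ℤ.*-monoʳ-≤-nonNeg (z (suc (suc m))) {{ℤ.nonNegative (ℤ.<⇒≤ (pos (suc (suc m)) ℕ.≤-refl))}}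
          (down m (ℕ.s≤s⁻¹ k<m) ℕ.≤-refl))
      (lc m ℕ.≤-refl))
  ...   | inj₂ ≡.refl with z (suc m) ℤ.≤? z m
  ...     | yes zm′≤zm = m , ℕ.n≤1+n m , up , λ i m≤i i<m′ →
    ≡.subst (λ i → z (suc i) ℤ.≤ z i) (ℕ.≤-antisym m≤i (ℕ.s≤s⁻¹ i<m′)) zm′≤zm
  ...     | no  zm′≰zm = suc m , ℕ.≤-refl , up′ , λ i m′≤i i<m′ → contradiction m′≤i (ℕ.<⇒≱ i<m′)
    where
    up′ : ∀ i → suc i ≤ suc m → z i ℤ.≤ z (suc i)
    up′ i i<m′ with ℕ.m≤n⇒m<n∨m≡n (ℕ.s≤s⁻¹ i<m′)
    ... | inj₁ i<m    = up i i<m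
    ... | inj₂ ≡.refl = ℤ.<⇒≤ (ℤ.≰⇒> zm′≰zm)

frac : ℤ → ℚ
frac z = z ℚ./ 1

private
  toℚᵘ-frac : ∀ z → ℚ.toℚᵘ (frac z) ≃ᵘ mkℚᵘ z 0
  toℚᵘ-frac z = ℚ.toℚᵘ-fromℚᵘ (mkℚᵘ z 0)

frac-mono : ∀ {z w} → z ℤ.≤ w → frac z ℚ.≤ frac w
frac-mono {z} {w} z≤w = ℚ.toℚᵘ-cancel-≤ (ℚᵘ.≤-respˡ-≃ (ℚᵘ.≃-sym (toℚᵘ-frac z))
    (ℚᵘ.≤-respʳ-≃ (ℚᵘ.≃-sym (toℚᵘ-frac w))
  (*≤* (ℤ.*-monoʳ-≤-nonNeg 1ℤ z≤w))))

frac-* : ∀ z w → frac z ℚ.* frac w ≡ frac (z ℤ.* w)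
frac-* z w = ℚ.toℚᵘ-injective (ℚᵘ.≃-trans (ℚ.toℚᵘ-homo-* (frac z) (frac w)) (ℚᵘ.≃-trans
  (ℚᵘ.*-cong (toℚᵘ-frac z) (toℚᵘ-frac w)) (ℚᵘ.≃-sym (toℚᵘ-frac (z ℤ.* w)))))

-- All three sequences of the theorem are integer sequences times a nonnegative constant, 1 or the
-- normalizing power of 1/2, and both properties survive such scaling.
module Scaled (c : ℚ) (0≤c : 0ℚ ℚ.≤ c) (z : ℕ → ℤ) (a : ℕ → ℚ) (a≡ : ∀ k → a k ≡ c ℚ.* frac (z k)) where

  private
    instance
      c-nonNeg : ℚ.NonNegative c
      c-nonNeg = ℚ.nonNegative 0≤c

    mono : ∀ {i j} → z i ℤ.≤ z j → a i ℚ.≤ a j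
    mono {i} {j} zi≤zj = ≡.subst₂ ℚ._≤_ (≡.sym (a≡ i)) (≡.sym (a≡ j))
        (ℚ.*-monoˡ-≤-nonNeg c (frac-mono zi≤zj))

    product : ∀ i j → a i ℚ.* a j ≡ c ℚ.* (c ℚ.* frac (z i ℤ.* z j))
    product i j = begin
      a i ℚ.* a j                               ≡⟨ ≡.cong₂ ℚ._*_ (a≡ i) (a≡ j) ⟩
      (c ℚ.* frac (z i)) ℚ.* (c ℚ.* frac (z j)) ≡⟨ ℚ.*-assoc c _ _ ⟩
      c ℚ.* (frac (z i) ℚ.* (c ℚ.* frac (z j))) ≡⟨ ≡.cong (c ℚ.*_)
          (x∙yz≈y∙xz (frac (z i)) c (frac (z j))) ⟩
      c ℚ.* (c ℚ.* (frac (z i) ℚ.* frac (z j))) ≡⟨ ≡.cong (λ q → c ℚ.* (c ℚ.* q)) (frac-* (z i) (z j)) ⟩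
      c ℚ.* (c ℚ.* frac (z i ℤ.* z j))          ∎
      where
      open ≡.≡-Reasoning
      open CommutativeSemigroupProperties
          (CommutativeRing.*-commutativeSemigroup ℚ.+-*-commutativeRing) using (x∙yz≈y∙xz)

  logConcave : ∀ m → (∀ k → suc k ≤ m ∸ 1 → z k ℤ.* z (suc (suc k)) ℤ.≤ z (suc k) ℤ.* z
      (suc k)) → LogConcave m a
  logConcave m lc (suc k) _ k<m rewrite ℕ.+-comm k 1 = ≡.subst₂ ℚ._≤_
    (≡.sym (product k (suc (suc k)))) (≡.sym (product (suc k) (suc k)))
    (ℚ.*-monoˡ-≤-nonNeg c (ℚ.*-monoˡ-≤-nonNeg c (frac-mono (lc k k<m))))

  unimodal : ∀ m → ∃[ k ] (k ≤ m × UnimodalAt z m k) → Unimodal m a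
  unimodal m (k , k≤m , up , down) = k , k≤m , up′ , down′
    where
    up′ : ∀ i → 1 ≤ i → i ≤ k → a (i ∸ 1) ℚ.≤ a i
    up′ (suc i) _ i<k = mono (up i i<k)
    down′ : ∀ i → k ≤ i → i ℕ.< m → a (i ℕ.+ 1) ℚ.≤ a i
    down′ i k≤i i<m rewrite ℕ.+-comm i 1 = mono (down i k≤i i<m)

-- The coefficient sequences of a tree on n + 2 vertices.

module _ {n} (T : Graph (suc (suc n))) (tree : IsTree T) where
  open IsTree tree
  open TreeForm T tree

  private
    s : ℕ → ℤ
    s k = + ∣ δ T connected k ∣

    t : ℕ → ℤ
    t k = + (2 ^ k) ℤ.* s k

    -- In this range all coefficients are negative, so absolute values are a common change of sign,
    -- and log-concavity passes over through products of two negatives.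
    s≡ : ∀ k → suc (suc k) ≤ suc (suc n) → s k ≡ ℤ.- charSeries negDist k
    s≡ k k≤n = ≡.trans (≡.cong +_ (∣coeff-det-D-xI∣ (distanceMatrix T connected) k))
      (≡.trans (≡.cong +_ (≡.sym (ℤ.∣-i∣≡∣i∣ p))) (ℤ.0≤i⇒+∣i∣≡i (ℤ.neg-mono-≤ (ℤ.<⇒≤ p<0))))
      where
      p : ℤ
      p = charSeries negDist k
      p<0 : p ℤ.< 0ℤ
      p<0 = charSeries-negative negDist negDist-conditionallyPositive k k≤n

    s-positive : Positiveℤ s n
    s-positive k k≤n = ≡.subst (0ℤ ℤ.<_) (≡.sym (s≡ k (ℕ.s≤s (ℕ.s≤s k≤n))))
      (ℤ.neg-mono-< (charSeries-negative negDist negDist-conditionallyPositive k (ℕ.s≤s (ℕ.s≤s k≤n))))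

    s-logConcave : LogConcaveℤ s n
    s-logConcave k k≤n = ≡.subst₂ ℤ._≤_
      (≡.sym (≡.trans (≡.cong₂ ℤ._*_ (s≡ k (≤2+ (ℕ.≤-trans (ℕ.n≤1+n k)
          (ℕ.≤-trans (ℕ.n≤1+n (suc k)) k≤n)))) (s≡ (suc (suc k)) (≤2+ k≤n)))
          (neg-*-neg (p k) (p (suc (suc k))))))
      (≡.sym (≡.trans (≡.cong₂ ℤ._*_ (s≡ (suc k) (≤2+ (ℕ.≤-trans (ℕ.n≤1+n (suc k)) k≤n)))
          (s≡ (suc k) (≤2+ (ℕ.≤-trans (ℕ.n≤1+n (suc k)) k≤n)))) (neg-*-neg (p (suc k)) (p (suc k)))))
      (charSeries-logConcave negDist negDist-sym k)
      where
      p : ℕ → ℤ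
      p = charSeries negDist
      ≤2+ : ∀ {k} → k ≤ n → suc (suc k) ≤ suc (suc n)
      ≤2+ k≤n = ℕ.s≤s (ℕ.s≤s k≤n)
      neg-*-neg : ∀ a b → ℤ.- a ℤ.* ℤ.- b ≡ a ℤ.* b
      neg-*-neg = solve-∀

    2^-pos : ∀ k → 0ℤ ℤ.< + (2 ^ k)
    2^-pos k = ℤ.+<+ (ℕ.m^n>0 2 k)

    t-positive : Positiveℤ t n
    t-positive k k≤n = 0<i*j (2^-pos k) (s-positive k k≤n)

    -- The weights are geometric: 2^k · 2^(k+2) = (2^(k+1))², so both sides of the inequality for s
    -- are multiplied by the same square.
    t-logConcave : LogConcaveℤ t n
    t-logConcave k k≤n = ≡.subst₂ ℤ._≤_ (≡.sym lhs) (≡.sym rhs)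
      (ℤ.*-monoˡ-≤-nonNeg (b ℤ.* b) {{ℤ.nonNegative (0≤i*i b)}} (s-logConcave k k≤n))
      where
      a b : ℤ
      a = + (2 ^ k)
      b = + (2 ^ suc k)
      double : ∀ k → + (2 ^ suc k) ≡ + 2 ℤ.* + (2 ^ k)
      double k = ℤ.pos-* 2 (2 ^ k)
      expand : ∀ a p q → a ℤ.* p ℤ.* (+ 2 ℤ.* (+ 2 ℤ.* a) ℤ.* q) ≡ (+ 2 ℤ.* a) ℤ.* (+ 2 ℤ.* a) ℤ.*
          (p ℤ.* q)
      expand = solve-∀
      square : ∀ b p → b ℤ.* p ℤ.* (b ℤ.* p) ≡ b ℤ.* b ℤ.* (p ℤ.* p)
      square = solve-∀
      lhs : t k ℤ.* t (suc (suc k)) ≡ b ℤ.* b ℤ.* (s k ℤ.* s (suc (suc k)))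
      lhs = ≡.trans (≡.cong (λ c → a ℤ.* s k ℤ.* (c ℤ.* s (suc (suc k))))
          (≡.trans (double (suc k)) (≡.cong (ℤ._*_ (+ 2)) (double k))))
        (≡.trans (expand a (s k) (s (suc (suc k)))) (≡.cong (λ c → c ℤ.* c ℤ.*
            (s k ℤ.* s (suc (suc k)))) (≡.sym (double k))))
      rhs : t (suc k) ℤ.* t (suc k) ≡ b ℤ.* b ℤ.* (s (suc k) ℤ.* s (suc k))
      rhs = square b (s (suc k))

    bound : ∀ (z : ℕ → ℤ) m → LogConcaveℤ z m → ∀ k → suc k ≤ m ∸ 1 → z k ℤ.* z (suc (suc k)) ℤ.≤ z
        (suc k) ℤ.* z (suc k)
    bound z (suc m) lc k k<m = lc k (ℕ.s≤s k<m)

    1≥0 : 0ℚ ℚ.≤ ℚ.1ℚ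
    1≥0 = ℚ.nonNegative⁻¹ ℚ.1ℚ

    c : ℚ
    c = (+ 1 ℚ./ (2 ^ n)) {{ℕ.m^n≢0 2 n}}

    c≥0 : 0ℚ ℚ.≤ c
    c≥0 = ℚ.nonNegative⁻¹ c {{ℚ.normalize-nonNeg 1 (2 ^ n) {{ℕ.m^n≢0 2 n}}}}

    module P = Scaled ℚ.1ℚ 1≥0 (charSeries negDist) (charCoeff T connected)
      (λ k → ≡.trans (≡.cong frac (coeff-det-xI-D (distanceMatrix T connected) k))
          (≡.sym (ℚ.*-identityˡ _)))
    module S = Scaled ℚ.1ℚ 1≥0 s (absδ T connected) (λ k → ≡.sym (ℚ.*-identityˡ _))
    module N = Scaled c c≥0 t (normalizedCoeff T connected)
      (λ k → ≡.trans (ℚ.*-assoc c _ _) (≡.cong (c ℚ.*_) (frac-* (+ (2 ^ k)) (s k))))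

  tree-coefficients :
    LogConcave (suc (suc n)) (charCoeff T connected)
    × (LogConcave n (absδ T connected) × Unimodal n (absδ T connected))
    × (LogConcave n (normalizedCoeff T connected) × Unimodal n (normalizedCoeff T connected))
  tree-coefficients =
      -- The inequality for the series holds at every index and regardless of signs, so it also
      -- covers the top, where the coefficients change from negative to 0 and then 1.
      P.logConcave (suc (suc n)) (λ k _ → charSeries-logConcave negDist negDist-sym k)
    , (S.logConcave n (bound s n s-logConcave) , S.unimodal n
        (logConcave⇒unimodal s n s-logConcave s-positive))
    , (N.logConcave n (bound t n t-logConcave) , N.unimodal n
        (logConcave⇒unimodal t n t-logConcave t-positive))

theorem2p1 : (n : ℕ) → 3 ≤ n → (T : Graph n) (tree : IsTree T) →
    let conn = IsTree.connected tree in
    LogConcave n (charCoeff T conn)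
    × (LogConcave (n ∸ 2) (absδ T conn) × Unimodal (n ∸ 2) (absδ T conn))
    × (LogConcave (n ∸ 2) (normalizedCoeff T conn) × Unimodal (n ∸ 2) (normalizedCoeff T conn))
theorem2p1 (suc zero) (ℕ.s≤s ())
theorem2p1 (suc (suc n)) _ T tree = tree-coefficients T tree
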